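{- For all positive integers $t,r$ there exists a number $f(t,r)$ such that if $G$ is a $(30t-15)$-connected graph which is the line graph of some graph, and $G$ has at least $f(t,r)$ vertices, then $G$ contains $L(C_{t,r})$ as a minor.
   Context: Graphs are finite and loopless but may have multiple edges. For a graph $H$, the line graph $L(H)$ is the simple graph whose vertex set is $E(H)$, two edges being adjacent in $L(H)$ iff they share at least one end in $H$. $C_{t,r}$ denotes the graph obtained from a cycle on $r$ vertices by replacing each edge with $t$ parallel edges. A graph $J$ is a minor of $G$ if a graph isomorphic to $J$ can be obtained from a subgraph of $G$ by contracting edges. -}

module Defs where

open import Data.Nat using (ℕ; zero; suc; _<_; _≤_; _%_; _*_)
open import Data.Nat.DivMod using (m%n<n)
open import Data.Fin using (Fin; toℕ; fromℕ<; remQuot)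
open import Data.Fin.Subset using (Subset; _∈_; _∉_; ∣_∣)
open import Data.Product using (Σ; _×_; _,_; proj₁; proj₂; ∃)
open import Data.Sum using (_⊎_; inj₁; inj₂)
open import Data.Maybe using (Maybe; just)
open import Data.Empty using (⊥)
open import Function.Bundles using (_⤖_; Bijection)
open import Relation.Nullary using (¬_)
open import Relation.Binary.PropositionalEquality using (_≡_; _≢_; refl; sym)

record Graph : Set₁ where
  field
    n     : ℕ
    Adj   : Fin n → Fin n → Set
    adj-sym : ∀ {u v} → Adj u v → Adj v u
    adj-irr : ∀ {u} → ¬ Adj u u
open Graph public

record RawMultigraph : Set where
  field
    V    : ℕ
    E    : ℕ
    ends : Fin E → Fin V × Fin V
open RawMultigraph public

-- loopless (the paper's notion of "graph")
Loopless : RawMultigraph → Set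
Loopless H = ∀ e → proj₁ (ends H e) ≢ proj₂ (ends H e)

ShareEnd : (H : RawMultigraph) → Fin (E H) → Fin (E H) → Set
ShareEnd H e f =
  (proj₁ (ends H e) ≡ proj₁ (ends H f)) ⊎ (proj₁ (ends H e) ≡ proj₂ (ends H f)) ⊎
  (proj₂ (ends H e) ≡ proj₁ (ends H f)) ⊎ (proj₂ (ends H e) ≡ proj₂ (ends H f))

ShareEnd-sym : ∀ H {e f} → ShareEnd H e f → ShareEnd H f e
ShareEnd-sym H (inj₁ p) = inj₁ (sym p)
ShareEnd-sym H (inj₂ (inj₁ p)) = inj₂ (inj₂ (inj₁ (sym p)))
ShareEnd-sym H (inj₂ (inj₂ (inj₁ p))) = inj₂ (inj₁ (sym p))
ShareEnd-sym H (inj₂ (inj₂ (inj₂ p))) = inj₂ (inj₂ (inj₂ (sym p)))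

LineGraph : RawMultigraph → Graph
LineGraph H = record
  { n   = E H
  ; Adj = λ e f → (e ≢ f) × ShareEnd H e f
  ; adj-sym = λ { (ne , s) → (λ q → ne (sym q)) , ShareEnd-sym H s }
  ; adj-irr = λ { (ne , _) → ne refl }
  }

_≅_ : Graph → Graph → Set
G ≅ K = Σ (Fin (n G) ⤖ Fin (n K)) λ φ →
  ∀ u v → (Adj G u v → Adj K (Bijection.to φ u) (Bijection.to φ v)) ×
          (Adj K (Bijection.to φ u) (Bijection.to φ v) → Adj G u v)

IsLineGraph : Graph → Set
IsLineGraph G = Σ RawMultigraph λ H → Loopless H × (G ≅ LineGraph H)

data Reach (G : Graph) (P : Fin (n G) → Set) : Fin (n G) → Fin (n G) → Set where
  here : ∀ {u} → P u → Reach G P u u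
  step : ∀ {u w v} → P u → Adj G u w → Reach G P w v → Reach G P u v

KConnected : ℕ → Graph → Set
KConnected k G = (k < n G) ×
  ((S : Subset (n G)) → ∣ S ∣ < k →
     ∀ u v → u ∉ S → v ∉ S → Reach G (λ w → w ∉ S) u v)

-- J is a minor of G, via a model: each vertex of G is assigned to at most
-- one branch set; branch sets are nonempty and connected, and each edge of
-- J is realised by an edge of G between the corresponding branch sets.
_≼_ : Graph → Graph → Set
J ≼ G = Σ (Fin (n G) → Maybe (Fin (n J))) λ β →
  (∀ j → ∃ λ v → β v ≡ just j) ×
  (∀ j u v → β u ≡ just j → β v ≡ just j → Reach G (λ w → β w ≡ just j) u v) ×
  (∀ i j → Adj J i j → ∃ λ u → ∃ λ v → β u ≡ just i × β v ≡ just j × Adj G u v)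

next : ∀ {r} → Fin r → Fin r
next {suc r} i = fromℕ< (m%n<n (suc (toℕ i)) (suc r))

-- C_{t,r}: cycle on r vertices 0,1,..,r-1 (edges i -- i+1 mod r), each edge
-- replaced by t parallel edges; edge set Fin (r * t) ≅ Fin r × Fin t.
C : ℕ → ℕ → RawMultigraph
C t r = record
  { V = r
  ; E = r * t
  ; ends = λ e → let i = proj₁ (remQuot t e) in i , next i
  }

{-# OPTIONS --safe #-}
-- Write G = L(H) and k = 30t − 15. If some vertex of H has degree at least rt, its star is a complete
-- minor of G, so let the degrees in H be bounded. Call a vertex high if its degree is at least 15t − 6:
-- every edge has a high end, and every cut of H separating two high vertices has at least 15t − 6 edges.
-- Cutting the edges into half-edges, one splits off pairs at low vertices (Lovász, Mader) until every
-- low vertex has degree at most three, keeping these cuts large. The result is a hypergraph on the high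
-- vertices with hyperedges of size at most three in which, for each partition of the vertices into q
-- classes, at least (15t − 6)q/3 ≥ 3tq hyperedges cross. An exchange argument as in the
-- Nash-Williams–Tutte theorem then gives 3t edge-disjoint connected subgraphs of H that all contain
-- every high vertex.
--
-- There are many high vertices, and bounded-degree trees containing many given vertices contain long
-- combs whose teeth are among them. By the Erdős–Szekeres argument some vertices w₀, …, w_r are, in this
-- order, the teeth of combs in all the subgraphs. Now t of the subgraphs as a whole form one group of
-- branch sets, t others are cut into paths joining w₀w₁, w₂w₃, … and the last t into paths joining
-- w₁w₂, w₃w₄, …; edge sets sharing a vertex are adjacent in G, so this is a model of L(C_{t,r}).
module Submission where

open import Defs
open import Data.Nat using (ℕ; zero; suc; pred; _+_; _*_; _∸_; _%_; _≤_; _<_; _≤?_; _<?_; z≤n; s≤s; s≤s⁻¹; _≤ᵇ_)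
open import Data.Product using (∃; _×_; _,_; proj₁; proj₂)
open import Data.Bool using (Bool; true; false; not; _∧_; _∨_; _xor_; T; if_then_else_)
open import Data.Bool.Properties using (T-∧; ∧-zeroʳ; ∨-zeroʳ; xor-comm) renaming (_≟_ to _≟ᵇ_)
open import Data.Empty using (⊥; ⊥-elim)
open import Data.Fin using (Fin; zero; suc; toℕ; fromℕ<; inject≤; combine; remQuot; _↑ˡ_; _↑ʳ_; splitAt; finToFun; funToFin)
open import Data.Fin.Properties using (_≟_; all?; any?; suc-injective; toℕ-injective; toℕ<n; toℕ-fromℕ<; fromℕ<-toℕ; combine-remQuot; remQuot-combine; inject≤-injective; ↑ˡ-injective; ↑ʳ-injective; splitAt-↑ˡ; splitAt-↑ʳ; splitAt⁻¹-↑ˡ; splitAt⁻¹-↑ʳ; finToFun-funToFin; ¬∀⟶∃¬)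
open import Data.Fin.Subset using (_∉_; ∣_∣)
open import Data.List as List using (List; []; _∷_; length; lookup; filter; allFin; _ʳ++_)
open import Data.List.Membership.Propositional using (_∈_)
open import Data.List.Membership.Propositional.Properties using (∈-filter⁺; ∈-filter⁻; ∈-allFin; ∈-lookup)
open import Data.List.Properties using (length-ʳ++)
open import Data.List.Relation.Binary.Sublist.Propositional using (_⊆_; []; _∷_; _∷ʳ_; ⊆-refl; ⊆-trans; minimum)
open import Data.List.Relation.Binary.Sublist.Propositional.Properties using (filter-⊆; All-resp-⊆)
open import Data.List.Relation.Unary.All as All using (All; []; _∷_)
open import Data.List.Relation.Unary.All.Properties using (all-filter) renaming (filter⁺ to all-filter⁺)
open import Data.List.Relation.Unary.AllPairs using (AllPairs; []; _∷_)
import Data.List.Relation.Unary.AllPairs.Properties as AllPairs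
open import Data.List.Relation.Unary.Any using (here; there; index)
open import Data.List.Relation.Unary.Any.Properties using (lookup-index)
open import Data.List.Relation.Unary.Unique.Propositional using (Unique)
import Data.List.Relation.Unary.Unique.Propositional.Properties as Unique
open import Data.Maybe using (Maybe; just; nothing; maybe; fromMaybe)
open import Data.Maybe.Properties using (just-injective)
open import Data.Nat.DivMod using (m%n<n; m<n⇒m%n≡m; n%n≡0)
open import Data.Nat.Induction using (<-wellFounded; Acc; acc)
open import Data.Nat.Properties hiding (_≟_; suc-injective)
import Data.Nat.Properties as ℕ
open import Data.Nat.Tactic.RingSolver using (solve-∀)
open import Data.Sum using (_⊎_; inj₁; inj₂; [_,_]′)
open import Data.Unit using (tt)
open import Data.Vec as Vec using ()
open import Data.Vec.Properties using (lookup∘tabulate; []=⇒lookup; lookup⇒[]=)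
open import Function using (_∘_; case_of_)
open import Function.Bundles using (Bijection; _⤖_; Equivalence)
open import Relation.Binary using (IsEquivalence; Tri; tri<; tri≈; tri>)
open import Relation.Binary.Construct.Closure.Equivalence using (EqClosure; fold; gfold; isEquivalence; return) renaming (map to eq-map)
open import Relation.Binary.Construct.Closure.ReflexiveTransitive using (ε; _◅_)
open import Relation.Binary.Construct.Closure.Symmetric using (fwd; bwd)
open import Relation.Binary.PropositionalEquality renaming (isEquivalence to ≡-isEquivalence)
open import Relation.Nullary using (¬_; Dec; yes; no; does; _×-dec_; _⊎-dec_; _→-dec_; ¬?)
open import Relation.Nullary.Decidable using (map′; dec-true; dec-false)
open import Relation.Nullary.Negation using (contradiction)
open import Relation.Unary using (Decidable)

open import Algebra.Properties.CommutativeMonoid.Sum +-0-commutativeMonoid using (sum; sum-cong-≗; ∑-distrib-+; ∑-comm)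

-- Sums and counting

-- The constants come from two places. An edge of `H` whose ends both have degree below 15t - 6
-- would have at most 30t - 16 neighbours in G, fewer than the connectivity. Splitting off cannot go
-- below degree three in general, and a hyperedge of size three may be counted at three classes of a
-- partition; so 3t subgraphs ask for cuts of size 9t, and 9t ≤ 15t - 6 for all t ≥ 1, with equality
-- at t = 1.
--
-- The packing is obtained by classical case distinctions and hence under a double negation. What it
-- asserts, a colouring of the edges all of whose colours join the high vertices, is decidable and
-- concerns finitely many colourings, so a search recovers the witness.
--
-- Combs of different subgraphs list their teeth in unrelated orders, while the branch sets of
-- neighbouring groups have to meet in the same vertices; numbering the vertices and choosing
-- monotone subsequences aligns the orders. The paths run along the sequence and never return to its
-- start. The cycle is closed by the whole subgraphs, which meet all vertices of the sequence.

sum-mono : ∀ {n} {f g : Fin n → ℕ} → (∀ i → f i ≤ g i) → sum f ≤ sum g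
sum-mono {zero}  f≤g = z≤n
sum-mono {suc n} f≤g = +-mono-≤ (f≤g zero) (sum-mono (f≤g ∘ suc))

sum-mono-< : ∀ {n} {f g : Fin n → ℕ} → (∀ i → f i ≤ g i) → ∀ i → f i < g i → sum f < sum g
sum-mono-< f≤g zero    lt = +-mono-<-≤ lt (sum-mono (f≤g ∘ suc))
sum-mono-< f≤g (suc i) lt = +-mono-≤-< (f≤g zero) (sum-mono-< (f≤g ∘ suc) i lt)

term≤sum : ∀ {n} (f : Fin n → ℕ) i → f i ≤ sum f
term≤sum f zero    = m≤m+n _ _
term≤sum f (suc i) = ≤-trans (term≤sum (f ∘ suc) i) (m≤n+m _ (f zero))

sum≤n*c : ∀ {n} {f : Fin n → ℕ} c → (∀ i → f i ≤ c) → sum f ≤ n * c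
sum≤n*c {zero}  c f≤c = z≤n
sum≤n*c {suc n} c f≤c = +-mono-≤ (f≤c zero) (sum≤n*c c (f≤c ∘ suc))

n*c≤sum : ∀ {n} {f : Fin n → ℕ} c → (∀ i → c ≤ f i) → n * c ≤ sum f
n*c≤sum {zero}  c c≤f = z≤n
n*c≤sum {suc n} c c≤f = +-mono-≤ (c≤f zero) (n*c≤sum c (c≤f ∘ suc))

sum-++ : ∀ m {n} (f : Fin (m + n) → ℕ) → sum f ≡ sum (λ i → f (i ↑ˡ n)) + sum (λ i → f (m ↑ʳ i))
sum-++ zero    f = refl
sum-++ (suc m) {n} f rewrite sum-++ m {n} (f ∘ suc) = sym (+-assoc (f zero) _ _)

sum-*-distribˡ : ∀ {n} c (f : Fin n → ℕ) → sum (λ i → c * f i) ≡ c * sum f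
sum-*-distribˡ {zero}  c f = sym (*-zeroʳ c)
sum-*-distribˡ {suc n} c f rewrite sum-*-distribˡ c (f ∘ suc) = sym (*-distribˡ-+ c (f zero) _)

sum-zero : ∀ {n} {f : Fin n → ℕ} → (∀ i → f i ≡ 0) → sum f ≡ 0
sum-zero {zero}  _ = refl
sum-zero {suc n} z rewrite z zero = sum-zero (z ∘ suc)

ind : Bool → ℕ
ind true  = 1
ind false = 0

ind≤1 : ∀ b → ind b ≤ 1
ind≤1 true  = ≤-refl
ind≤1 false = z≤n

count : ∀ {n} → (Fin n → Bool) → ℕ
count p = sum (ind ∘ p)

_==_ : ∀ {n} → Fin n → Fin n → Bool
i == j = does (i ≟ j)

==-refl : ∀ {n} (i : Fin n) → (i == i) ≡ true
==-refl i = dec-true (i ≟ i) refl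

==⇒≡ : ∀ {n} {i j : Fin n} → (i == j) ≡ true → i ≡ j
==⇒≡ {i = i} {j} eq with i ≟ j
... | yes p = p

≢⇒==-false : ∀ {n} {i j : Fin n} → i ≢ j → (i == j) ≡ false
≢⇒==-false {i = i} {j} = dec-false (i ≟ j)

true≢false : ∀ {b} → b ≡ true → b ≡ false → ⊥
true≢false refl ()

ind-mono : ∀ {b c} → (b ≡ true → c ≡ true) → ind b ≤ ind c
ind-mono {true}  f rewrite f refl = ≤-refl
ind-mono {false} f = z≤n

count-mono : ∀ {n} {p q : Fin n → Bool} → (∀ i → p i ≡ true → q i ≡ true) → count p ≤ count q
count-mono p⇒q = sum-mono (λ i → ind-mono (p⇒q i))

count-single : ∀ {n} (j : Fin n) → count (_== j) ≡ 1
count-single {suc n} zero = cong suc (sum-zero {n} (λ _ → refl))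
count-single {suc n} (suc j) = count-single j

count≥1⇒∃ : ∀ {n} (p : Fin n → Bool) → 1 ≤ count p → ∃ λ i → p i ≡ true
count≥1⇒∃ p 1≤ with any? (λ i → p i ≟ᵇ true)
... | yes w = w
... | no ¬w = contradiction (subst (1 ≤_) (sum-zero lem) 1≤) λ ()
  where
  lem : ∀ i → ind (p i) ≡ 0
  lem i with p i in eq
  ... | true  = contradiction (i , eq) ¬w
  ... | false = refl

true⇒count≥1 : ∀ {n} (p : Fin n → Bool) i → p i ≡ true → 1 ≤ count p
true⇒count≥1 p i eq = ≤-trans (≤-reflexive (cong ind (sym eq))) (term≤sum (ind ∘ p) i)

∧-true : ∀ {b c} → b ∧ c ≡ true → b ≡ true × c ≡ true
∧-true {true} {true} _ = refl , refl

∧-intro : ∀ {b c} → b ≡ true → c ≡ true → b ∧ c ≡ true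
∧-intro refl refl = refl

not-true : ∀ {b} → not b ≡ true → b ≡ false
not-true {false} _ = refl

¬true⇒false : ∀ {b} → ¬ b ≡ true → b ≡ false
¬true⇒false {true}  n = contradiction refl n
¬true⇒false {false} n = refl

does⇒ : ∀ {P : Set} (d : Dec P) → does d ≡ true → P
does⇒ (yes p) _ = p

two≤count⇒other : ∀ {n} (p : Fin n → Bool) → 2 ≤ count p → ∀ j → ∃ λ i → i ≢ j × p i ≡ true
two≤count⇒other p 2≤ j with any? (λ i → ¬? (i ≟ j) ×-dec (p i ≟ᵇ true))
... | yes w = w
... | no ¬w = contradiction (≤-trans 2≤ (≤-trans (count-mono lem) (≤-reflexive (count-single j)))) λ { (s≤s ()) }
  where
  lem : ∀ i → p i ≡ true → (i == j) ≡ true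
  lem i pi with i ≟ j
  ... | yes _ = refl
  ... | no i≢j = contradiction (i , i≢j , pi) ¬w

unique⇒count≤1 : ∀ {n} (p : Fin n → Bool) → (∀ {i j} → p i ≡ true → p j ≡ true → i ≡ j) → count p ≤ 1
unique⇒count≤1 p uniq = ≮⇒≥ λ 1<c → case count≥1⇒∃ p (≤-trans (s≤s z≤n) 1<c) of λ { (j , pj) →
  case two≤count⇒other p 1<c j of λ { (i , i≢j , pi) → i≢j (uniq pi pj) } }

count≤n : ∀ {n} (p : Fin n → Bool) → count p ≤ n
count≤n {n} p = ≤-trans (sum≤n*c 1 (ind≤1 ∘ p)) (≤-reflexive (*-identityʳ n))

¬¬-∀Fin : ∀ {n} {P : Fin n → Set} → (∀ i → ¬ ¬ P i) → ¬ ¬ (∀ i → P i)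
¬¬-∀Fin {zero}  f k = k λ ()
¬¬-∀Fin {suc n} f k = f zero λ p → ¬¬-∀Fin (f ∘ suc) λ q → k λ { zero → p ; (suc i) → q i }

¬¬-em : {P : Set} → ¬ ¬ Dec P
¬¬-em k = k (no (k ∘ yes))

-- Cut inequalities are sums of pointwise Boolean inequalities; these are proved by evaluating all cases.
BoolFun : ℕ → Set
BoolFun zero    = Bool
BoolFun (suc n) = Bool → BoolFun n

evaluate : ∀ n → BoolFun n → Bool
evaluate zero    b = b
evaluate (suc n) f = evaluate n (f true) ∧ evaluate n (f false)

Tautology : ∀ n → BoolFun n → Set
Tautology zero    b = T b
Tautology (suc n) f = ∀ b → Tautology n (f b)

tautology : ∀ n f → T (evaluate n f) → Tautology n f
tautology zero    b t = t
tautology (suc n) f t true  = tautology n (f true) (proj₁ (Equivalence.to T-∧ t))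
tautology (suc n) f t false = tautology n (f false) (proj₂ (Equivalence.to (T-∧ {evaluate n (f true)}) t))

-- Connectivity by a selected set of edges

Link : ∀ {v e} (a b : Fin e → Fin v) → (Fin e → Bool) → Fin v → Fin v → Set
Link a b A x y = ∃ λ s → A s ≡ true × a s ≡ x × b s ≡ y

Con : ∀ {v e} (a b : Fin e → Fin v) → (Fin e → Bool) → Fin v → Fin v → Set
Con a b A = EqClosure (Link a b A)

-- A walk needs the extra pair `p`, `q` at most once, since repeated uses can be shortcut inside
-- `C`. Both the deletion of an edge and the decision of connectivity rest on this.
insert-link : ∀ {V : Set} {R C : V → V → Set} {p q x y} → IsEquivalence C →
  (∀ {x y} → R x y → C x y ⊎ (x ≡ p × y ≡ q)) → EqClosure R x y →
  C x y ⊎ (C x p × C q y) ⊎ (C x q × C p y)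
insert-link {R = R} {C} {p} {q} eqv f = go
  where
  open IsEquivalence eqv renaming (refl to rf; sym to sy; trans to tr)
  D : _ → _ → Set
  D x y = C x y ⊎ (C x p × C q y) ⊎ (C x q × C p y)
  pre : ∀ {x y z} → C x y → D y z → D x z
  pre c (inj₁ d) = inj₁ (tr c d)
  pre c (inj₂ (inj₁ (d , d′))) = inj₂ (inj₁ (tr c d , d′))
  pre c (inj₂ (inj₂ (d , d′))) = inj₂ (inj₂ (tr c d , d′))
  via-pq : ∀ {z} → D q z → D p z
  via-pq (inj₁ d) = inj₂ (inj₁ (rf , d))
  via-pq (inj₂ (inj₁ (d , d′))) = inj₁ (tr (sy d) d′)
  via-pq (inj₂ (inj₂ (d , d′))) = inj₁ d′
  via-qp : ∀ {z} → D p z → D q z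
  via-qp (inj₁ d) = inj₂ (inj₂ (rf , d))
  via-qp (inj₂ (inj₁ (d , d′))) = inj₁ d′
  via-qp (inj₂ (inj₂ (d , d′))) = inj₁ (tr (sy d) d′)
  go : ∀ {x y} → EqClosure R x y → D x y
  go ε = inj₁ rf
  go (fwd r ◅ rs) with f r
  ... | inj₁ c = pre c (go rs)
  ... | inj₂ (refl , refl) = via-pq (go rs)
  go (bwd r ◅ rs) with f r
  ... | inj₁ c = pre (sy c) (go rs)
  ... | inj₂ (refl , refl) = via-qp (go rs)

abstract
  without : ∀ {e} → (Fin e → Bool) → Fin e → Fin e → Bool
  without A s s′ = A s′ ∧ not (s′ == s)

  without-⊆ : ∀ {e} (A : Fin e → Bool) s s′ → without A s s′ ≡ true → A s′ ≡ true
  without-⊆ A s s′ = proj₁ ∘ ∧-true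

  without-≢ : ∀ {e} (A : Fin e → Bool) s s′ → without A s s′ ≡ true → s′ ≢ s
  without-≢ A s .s w refl rewrite ==-refl s with A s
  ... | true = case w of λ ()
  ... | false = case w of λ ()

  without-intro : ∀ {e} (A : Fin e → Bool) {s s′} → A s′ ≡ true → s′ ≢ s → without A s s′ ≡ true
  without-intro A As ne = ∧-intro As (cong not (≢⇒==-false ne))

module _ {v e : ℕ} {a b : Fin e → Fin v} where

  con-equiv : ∀ {A} → IsEquivalence (Con a b A)
  con-equiv = isEquivalence _

  con-refl : ∀ {A x} → Con a b A x x
  con-refl = ε

  con-sym : ∀ {A x y} → Con a b A x y → Con a b A y x
  con-sym = IsEquivalence.sym con-equiv

  con-trans : ∀ {A x y z} → Con a b A x y → Con a b A y z → Con a b A x z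
  con-trans = IsEquivalence.trans con-equiv

  con-link : ∀ {A} s → A s ≡ true → Con a b A (a s) (b s)
  con-link s As = return (s , As , refl , refl)

  con-into : ∀ {A} {R : Fin v → Fin v → Set} → IsEquivalence R →
    (∀ s → A s ≡ true → R (a s) (b s)) → ∀ {x y} → Con a b A x y → R x y
  con-into eqv f = fold eqv λ { (s , As , refl , refl) → f s As }

  con-mono : ∀ {A B : Fin e → Bool} → (∀ s → A s ≡ true → B s ≡ true) →
    ∀ {x y} → Con a b A x y → Con a b B x y
  con-mono A⊆B = eq-map λ { (s , As , p , q) → s , A⊆B s As , p , q }

  con-without : ∀ {A x y} s → Con a b A x y →
    Con a b (without A s) x y
      ⊎ (Con a b (without A s) x (a s) × Con a b (without A s) (b s) y)
      ⊎ (Con a b (without A s) x (b s) × Con a b (without A s) (a s) y)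
  con-without {A} s = insert-link con-equiv λ { (s′ , As , refl , refl) → lem s′ As }
    where
    lem : ∀ s′ → A s′ ≡ true → Con a b (without A s) (a s′) (b s′) ⊎ (a s′ ≡ a s × b s′ ≡ b s)
    lem s′ As with s′ ≟ s
    ... | yes refl = inj₂ (refl , refl)
    ... | no  ne   = inj₁ (con-link s′ (without-intro A As ne))

con-transfer : ∀ {v e} {a b a′ b′ : Fin e → Fin v} {A B : Fin e → Bool} →
  (∀ s → A s ≡ true → B s ≡ true × a s ≡ a′ s × b s ≡ b′ s) → ∀ {x y} → Con a b A x y → Con a′ b′ B x y
con-transfer f = eq-map λ { (s , As , p , q) → case f s As of λ { (Bs , ea , eb) →
  s , Bs , trans (sym ea) p , trans (sym eb) q } }

-- Edge `zero` matters only through its two ends (`insert-link`), so questions about the remaining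
-- edges decide the closure.
con? : ∀ {v e} (a b : Fin e → Fin v) A x y → Dec (Con a b A x y)
con? {e = zero} a b A x y = map′ (λ { refl → ε }) (con-into ≡-isEquivalence λ ()) (x ≟ y)
con? {v} {suc e} a b A x y with A zero in eq
... | false = map′ (eq-map λ { (s , p) → suc s , p }) (con-into con-equiv lem) (con? (a ∘ suc) (b ∘ suc) (A ∘ suc) x y)
  where
  lem : ∀ s → A s ≡ true → Con (a ∘ suc) (b ∘ suc) (A ∘ suc) (a s) (b s)
  lem zero p = ⊥-elim (true≢false p eq)
  lem (suc s) p = con-link s p
... | true = map′ back (insert-link con-equiv lem) (Tail? x y ⊎-dec (Tail? x p ×-dec Tail? q y) ⊎-dec (Tail? x q ×-dec Tail? p y))
  where
  p = a zero
  q = b zero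
  Tail? = con? (a ∘ suc) (b ∘ suc) (A ∘ suc)
  Tail = Con (a ∘ suc) (b ∘ suc) (A ∘ suc)
  up : ∀ {x y} → Tail x y → Con a b A x y
  up = eq-map λ { (s , p) → suc s , p }
  back : Tail x y ⊎ (Tail x p × Tail q y) ⊎ (Tail x q × Tail p y) → Con a b A x y
  back (inj₁ c) = up c
  back (inj₂ (inj₁ (c , d))) = con-trans (up c) (con-trans (con-link zero eq) (up d))
  back (inj₂ (inj₂ (c , d))) = con-trans (up c) (con-trans (con-sym (con-link zero eq)) (up d))
  lem : ∀ {x y} → Link a b A x y → Tail x y ⊎ (x ≡ p × y ≡ q)
  lem (zero , _ , refl , refl) = inj₂ (refl , refl)
  lem (suc s , r , refl , refl) = inj₁ (con-link s r)

-- Counting the classes of a decidable equivalence relation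

module _ {v : ℕ} {R : Fin v → Fin v → Set} (R? : ∀ x y → Dec (R x y)) where

  -- The least vertex of a class represents it, so for an equivalence relation `reps` is the number
  -- of classes.
  Rep : Fin v → Set
  Rep x = ∀ y → R x y → toℕ x ≤ toℕ y

  rep? : ∀ x → Dec (Rep x)
  rep? x = all? λ y → R? x y →-dec (toℕ x ≤? toℕ y)

  reps : ℕ
  reps = count (λ x → does (rep? x))

  has-rep : IsEquivalence R → ∀ x → ∃ λ y → R x y × Rep y
  has-rep eqv x = go x (<-wellFounded (toℕ x))
    where
    open IsEquivalence eqv renaming (refl to rf; trans to tr)
    go : ∀ x → Acc _<_ (toℕ x) → ∃ λ y → R x y × Rep y
    go x (acc rs) with any? (λ y → R? x y ×-dec (toℕ y <? toℕ x))
    ... | yes (y , r , lt) = case go y (rs lt) of λ { (z , r′ , rz) → z , tr r r′ , rz }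
    ... | no ¬lt = x , rf , λ y r → ≮⇒≥ λ lt → ¬lt (y , r , lt)

  rep-unique : IsEquivalence R → ∀ {x y} → Rep x → Rep y → R x y → x ≡ y
  rep-unique eqv rx ry r = toℕ-injective (≤-antisym (rx _ r) (ry _ (IsEquivalence.sym eqv r)))

reps-mono : ∀ {v} {R R′ : Fin v → Fin v → Set} (R? : ∀ x y → Dec (R x y)) (R′? : ∀ x y → Dec (R′ x y)) →
  (∀ {x y} → R x y → R′ x y) → reps R′? ≤ reps R?
reps-mono R? R′? R⊆R′ = count-mono λ i d → dec-true (rep? R? i) λ j r → does⇒ (rep? R′? i) d j (R⊆R′ r)

-- Of the representatives of the two merged classes, the larger is no longer least.
reps-merge : ∀ {v} {R R′ : Fin v → Fin v → Set} (R? : ∀ x y → Dec (R x y)) (R′? : ∀ x y → Dec (R′ x y)) →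
  IsEquivalence R → IsEquivalence R′ → (∀ {x y} → R x y → R′ x y) →
  ∀ {p q} → R′ p q → ¬ R p q → reps R′? < reps R?
reps-merge {R = R} {R′} R? R′? eq eq′ R⊆R′ {p} {q} r′ ¬r
  with has-rep R? eq p | has-rep R? eq q
... | x , px , rx | y , qy , ry = lemma (<-cmp (toℕ x) (toℕ y))
  where
  open IsEquivalence eq′ renaming (sym to sy′; trans to tr′)
  open IsEquivalence eq renaming (sym to sy; trans to tr)
  xy′ : R′ x y
  xy′ = tr′ (sy′ (R⊆R′ px)) (tr′ r′ (R⊆R′ qy))
  mono : ∀ i → ind (does (rep? R′? i)) ≤ ind (does (rep? R? i))
  mono i = ind-mono λ d → dec-true (rep? R? i) λ j r → does⇒ (rep? R′? i) d j (R⊆R′ r)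
  strict : ∀ i → Rep R? i → ¬ Rep R′? i → reps R′? < reps R?
  strict i ri ¬ri = sum-mono-< mono i
    (subst₂ (λ b c → ind b < ind c) (sym (dec-false (rep? R′? i) ¬ri)) (sym (dec-true (rep? R? i) ri)) ≤-refl)
  lemma : Tri (toℕ x < toℕ y) (toℕ x ≡ toℕ y) (toℕ y < toℕ x) → reps R′? < reps R?
  lemma (tri< lt _ _) = strict y ry λ ry′ → <⇒≱ lt (ry′ x (sy′ xy′))
  lemma (tri≈ _ e _) = contradiction (tr px (subst (λ z → R z q) (sym (toℕ-injective e)) (sy qy))) ¬r
  lemma (tri> _ _ gt) = strict x rx λ rx′ → <⇒≱ gt (rx′ y xy′)

-- Splitting off

_⇒ᵇ_ : Bool → Bool → Bool
g ⇒ᵇ b = not g ∨ b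

⇒ᵇ-elim : ∀ {g b} → T (g ⇒ᵇ b) → g ≡ true → T b
⇒ᵇ-elim {true} t _ = t

Nonconst : ∀ {n} → (Fin n → Bool) → Set
Nonconst X = (∃ λ u → X u ≡ true) × (∃ λ w → X w ≡ false)

module _ {nV nJ : ℕ} (h : Fin nJ → Fin nV) where

  -- A half-edge j joins the vertex h j to the block ℓ j; X is a set of vertices, Y a set of blocks.
  cut : ∀ {nL} → (Fin nJ → Fin nL) → (Fin nV → Bool) → (Fin nL → Bool) → ℕ
  cut ℓ X Y = count (λ j → X (h j) xor Y (ℓ j))

  -- As `Y` is arbitrary, blocks sit on whichever side is cheaper: only cuts separating two vertices
  -- have to be large, and a block may have few half-edges.
  Connected : ∀ {nL} → ℕ → (Fin nJ → Fin nL) → Set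
  Connected k ℓ = ∀ X Y → Nonconst X → k ≤ cut ℓ X Y

  -- Splitting off in the sense of Lovász and Mader: the half-edges j₁ and j₂ form a block of their own.
  detach : ∀ {nL} → (Fin nJ → Fin nL) → Fin nJ → Fin nJ → Fin nJ → Fin (suc nL)
  detach ℓ j₁ j₂ j with j ≟ j₁ | j ≟ j₂
  ... | yes _ | _     = zero
  ... | no _  | yes _ = zero
  ... | no _  | no _  = suc (ℓ j)

module Block {nV nJ nL : ℕ} (h : Fin nJ → Fin nV) (ℓ : Fin nJ → Fin nL) (s : Fin nL) (k : ℕ) where

  at : Fin nJ → Bool
  at j = ℓ j == s

  deg : ℕ
  deg = count at

  -- One side of a cut, normalised so as to avoid the block s.
  record Side : Set where
    constructor side
    field
      X   : Fin nV → Bool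
      Y   : Fin nL → Bool
      off : Y s ≡ false

  open Side public

  _∋_ : Side → Fin nJ → Bool
  Z ∋ j = X Z (h j)

  δ : Side → ℕ
  δ Z = cut h ℓ (X Z) (Y Z)

  p : Side → ℕ
  p Z = count (λ j → at j ∧ (Z ∋ j))

  p₂ : Side → Side → ℕ
  p₂ Z W = count (λ j → at j ∧ ((Z ∋ j) ∧ (W ∋ j)))

  off-block : ∀ Z j → not (at j ∧ Y Z (ℓ j)) ≡ true
  off-block Z j with ℓ j ≟ s
  ... | yes refl rewrite off Z = refl
  ... | no _ = refl

  _∖_ : Side → Side → Side
  Z ∖ W = side (λ v → X Z v ∧ not (X W v)) (λ l → Y Z l ∧ not (Y W l)) (cong (_∧ not (Y W s)) (off Z))

  _∩_ : Side → Side → Side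
  Z ∩ W = side (λ v → X Z v ∧ X W v) (λ l → Y Z l ∧ Y W l) (cong (_∧ Y W s) (off Z))

  ∖-in : ∀ {Z W j} → Z ∋ j ≡ true → W ∋ j ≡ false → (Z ∖ W) ∋ j ≡ true
  ∖-in zj wj = ∧-intro zj (cong not wj)

  ∖-out : ∀ {Z W j} → W ∋ j ≡ true → (Z ∖ W) ∋ j ≡ false
  ∖-out {Z} {W} {j} wj rewrite wj with X Z (h j)
  ... | true = refl
  ... | false = refl

  -- A half-edge from the intersection to the complement of the union counts twice on the right and
  -- in neither cut on the left. Since `s` lies outside both sides, those at `s` pay for the two
  -- terms `p₂ Z W`.
  posimodular : ∀ Z W → δ (Z ∖ W) + δ (W ∖ Z) + (p₂ Z W + p₂ Z W) ≤ δ Z + δ W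
  posimodular Z W = subst₂ _≤_
    (trans (∑-distrib-+ (λ j → f j + g j) (λ j → c j + c j)) (cong₂ _+_ (∑-distrib-+ f g) (∑-distrib-+ c c)))
    (∑-distrib-+ (ind ∘ zt) (ind ∘ wt))
    (sum-mono λ j → ≤ᵇ⇒≤ _ _ (⇒ᵇ-elim (⇒ᵇ-elim
      (check (at j) (X Z (h j)) (Y Z (ℓ j)) (X W (h j)) (Y W (ℓ j))) (off-block Z j)) (off-block W j)))
    where
    f g c : Fin nJ → ℕ
    f j = ind (X (Z ∖ W) (h j) xor Y (Z ∖ W) (ℓ j))
    g j = ind (X (W ∖ Z) (h j) xor Y (W ∖ Z) (ℓ j))
    c j = ind (at j ∧ ((Z ∋ j) ∧ (W ∋ j)))
    zt wt : Fin nJ → Bool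
    zt j = X Z (h j) xor Y Z (ℓ j)
    wt j = X W (h j) xor Y W (ℓ j)
    F : BoolFun 5
    F σ x y x′ y′ = not (σ ∧ y) ⇒ᵇ (not (σ ∧ y′) ⇒ᵇ
      ((ind ((x ∧ not x′) xor (y ∧ not y′)) + ind ((x′ ∧ not x) xor (y′ ∧ not y))
        + (ind (σ ∧ (x ∧ x′)) + ind (σ ∧ (x ∧ x′)))) ≤ᵇ (ind (x xor y) + ind (x′ xor y′))))
    check = tautology 5 F tt

  p₃ : Side → Side → Side → ℕ
  p₃ Z W U = count (λ j → at j ∧ ((Z ∋ j) ∧ ((W ∋ j) ∧ (U ∋ j))))

  -- A half-edge at `s` ending in all three sides counts three times on the right but only in the
  -- first cut on the left, which leaves two.
  three-sets : ∀ Z W U →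
    δ (Z ∩ (W ∩ U)) + δ ((Z ∖ W) ∖ U) + (δ ((W ∖ Z) ∖ U) + δ ((U ∖ Z) ∖ W)) + (p₃ Z W U + p₃ Z W U)
      ≤ δ Z + δ W + δ U
  three-sets Z W U = subst₂ _≤_
    (trans (∑-distrib-+ (λ j → f₁ j + f₂ j + (f₃ j + f₄ j)) (λ j → c j + c j))
      (cong₂ _+_ (trans (∑-distrib-+ (λ j → f₁ j + f₂ j) (λ j → f₃ j + f₄ j))
        (cong₂ _+_ (∑-distrib-+ f₁ f₂) (∑-distrib-+ f₃ f₄))) (∑-distrib-+ c c)))
    (trans (∑-distrib-+ (λ j → ind (zt j) + ind (wt j)) (ind ∘ ut)) (cong (_+ δ U) (∑-distrib-+ (ind ∘ zt) (ind ∘ wt))))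
    (sum-mono λ j → ≤ᵇ⇒≤ _ _ (⇒ᵇ-elim (⇒ᵇ-elim (⇒ᵇ-elim
      (check (at j) (X Z (h j)) (Y Z (ℓ j)) (X W (h j)) (Y W (ℓ j)) (X U (h j)) (Y U (ℓ j)))
      (off-block Z j)) (off-block W j)) (off-block U j)))
    where
    side-ind : Side → Fin nJ → ℕ
    side-ind S j = ind (X S (h j) xor Y S (ℓ j))
    f₁ f₂ f₃ f₄ c : Fin nJ → ℕ
    f₁ = side-ind (Z ∩ (W ∩ U))
    f₂ = side-ind ((Z ∖ W) ∖ U)
    f₃ = side-ind ((W ∖ Z) ∖ U)
    f₄ = side-ind ((U ∖ Z) ∖ W)
    c j = ind (at j ∧ ((Z ∋ j) ∧ ((W ∋ j) ∧ (U ∋ j))))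
    zt wt ut : Fin nJ → Bool
    zt j = X Z (h j) xor Y Z (ℓ j)
    wt j = X W (h j) xor Y W (ℓ j)
    ut j = X U (h j) xor Y U (ℓ j)
    F : BoolFun 7
    F σ x y x′ y′ x″ y″ = not (σ ∧ y) ⇒ᵇ (not (σ ∧ y′) ⇒ᵇ (not (σ ∧ y″) ⇒ᵇ
      ((ind ((x ∧ (x′ ∧ x″)) xor (y ∧ (y′ ∧ y″))) + ind (((x ∧ not x′) ∧ not x″) xor ((y ∧ not y′) ∧ not y″))
        + (ind (((x′ ∧ not x) ∧ not x″) xor ((y′ ∧ not y) ∧ not y″))
          + ind (((x″ ∧ not x) ∧ not x′) xor ((y″ ∧ not y) ∧ not y′)))
        + (ind (σ ∧ (x ∧ (x′ ∧ x″))) + ind (σ ∧ (x ∧ (x′ ∧ x″)))))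
       ≤ᵇ (ind (x xor y) + ind (x′ xor y′) + ind (x″ xor y″)))))
    check = tautology 7 F tt

  p+p₂-cover : ∀ Z W → (∀ j → at j ≡ true → Z ∋ j ≡ false → W ∋ j ≡ true) → deg + p₂ Z W ≤ p Z + p W
  p+p₂-cover Z W cover = subst₂ _≤_ (∑-distrib-+ (ind ∘ at) _) (∑-distrib-+ (λ j → ind (at j ∧ (Z ∋ j))) _) (sum-mono lem)
    where
    lem : ∀ j → ind (at j) + ind (at j ∧ ((Z ∋ j) ∧ (W ∋ j))) ≤ ind (at j ∧ (Z ∋ j)) + ind (at j ∧ (W ∋ j))
    lem j with at j in aj | Z ∋ j in zj
    ... | false | _ = z≤n
    ... | true | true = ≤-refl
    ... | true | false rewrite cover j aj zj = ≤-refl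

  p-∖ : ∀ Z W → p Z ≡ p (Z ∖ W) + p₂ Z W
  p-∖ Z W = trans (sum-cong-≗ lem) (∑-distrib-+ (λ j → ind (at j ∧ ((Z ∖ W) ∋ j))) _)
    where
    lem : ∀ j → ind (at j ∧ (Z ∋ j)) ≡ ind (at j ∧ ((Z ∖ W) ∋ j)) + ind (at j ∧ ((Z ∋ j) ∧ (W ∋ j)))
    lem j with at j | Z ∋ j | W ∋ j
    ... | false | _ | _ = refl
    ... | true | false | _ = refl
    ... | true | true | true = refl
    ... | true | true | false = refl

  member≤ : ∀ (q : Fin nJ → Bool) j → at j ≡ true → q j ≡ true → 1 ≤ count (λ j → at j ∧ q j)
  member≤ q j aj qj = true⇒count≥1 _ j (∧-intro aj qj)

  p-mono : ∀ {Z W} → (∀ j → at j ≡ true → Z ∋ j ≡ true → W ∋ j ≡ true) → p Z ≤ p W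
  p-mono Z⊆W = count-mono λ j e → case ∧-true e of λ { (aj , zj) → ∧-intro aj (Z⊆W j aj zj) }

  p-mono-< : ∀ {Z W} → (∀ j → at j ≡ true → Z ∋ j ≡ true → W ∋ j ≡ true) →
    ∀ j → at j ≡ true → Z ∋ j ≡ false → W ∋ j ≡ true → p Z < p W
  p-mono-< {Z} {W} Z⊆W j aj zj wj = sum-mono-<
    (λ i → ind-mono λ e → case ∧-true {at i} e of λ { (ai , zi) → ∧-intro ai (Z⊆W i ai zi) }) j
    (subst₂ (λ b c → ind b < ind c) (sym (cong₂ _∧_ aj zj)) (sym (cong₂ _∧_ aj wj)) ≤-refl)

  difference? : ∀ Z W → (∃ λ j → at j ≡ true × Z ∋ j ≡ true × W ∋ j ≡ false)
    ⊎ (∀ j → at j ≡ true → Z ∋ j ≡ true → W ∋ j ≡ true)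
  difference? Z W with any? (λ j → (at j ≟ᵇ true) ×-dec (Z ∋ j ≟ᵇ true) ×-dec (W ∋ j ≟ᵇ false))
  ... | yes d = inj₁ d
  ... | no ¬d = inj₂ lem
    where
    lem : ∀ j → at j ≡ true → Z ∋ j ≡ true → W ∋ j ≡ true
    lem j aj zj with W ∋ j in wj
    ... | true = refl
    ... | false = contradiction (j , aj , zj , wj) ¬d

  -- Splitting off two half-edges at `s` that both end in `Z` brings this cut down to at most
  -- `k - 1`, once the new block is put on the side of `Z`.
  record Dangerous (Z : Side) : Set where
    field
      separates : Nonconst (X Z)
      small     : δ Z ≤ suc k

  open Dangerous

  -- Together Z and W contain all neighbours of s, and j₀ is their only common half-edge at s.
  record Cover (j₀ : Fin nJ) : Set where
    field
      Z W       : Side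
      Z-danger  : Dangerous Z
      W-danger  : Dangerous W
      Z∋j₀      : Z ∋ j₀ ≡ true
      W∋j₀      : W ∋ j₀ ≡ true
      j₁        : Fin nJ
      j₁∈s      : at j₁ ≡ true
      Z∋j₁      : Z ∋ j₁ ≡ true
      W∌j₁      : W ∋ j₁ ≡ false
      common    : p₂ Z W ≡ 1
      tight     : δ (Z ∖ W) ≤ k
      all       : ∀ j → at j ≡ true → Z ∋ j ≡ false → W ∋ j ≡ true

  -- Three pairwise crossing dangerous sets are impossible, so two of them cover the block s. Then
  -- A = Z ∖ W is tight, and lies inside both sets Z′ and W′ covering s for a half-edge of A, although
  -- these share a single half-edge.
  module Stuck (conn : Connected h k ℓ) (2≤k : 2 ≤ k) (4≤deg : 4 ≤ deg)
    (blocked : ∀ j₁ j₂ → at j₁ ≡ true → at j₂ ≡ true → j₁ ≢ j₂ →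
      ¬ ¬ (∃ λ Z → Dangerous Z × Z ∋ j₁ ≡ true × Z ∋ j₂ ≡ true)) where

    -- Moving `s` to the side of `Z` changes the cut by `deg - 2 p Z`, and the new cut still has at
    -- least `k` half-edges.
    2p≤deg+1 : ∀ {Z} → Dangerous Z → p Z + p Z ≤ suc deg
    2p≤deg+1 {Z} dz = +-cancelˡ-≤ k _ _ (≤-trans (+-monoˡ-≤ _ (conn (X Z) Y⁺ (separates dz)))
      (≤-trans absorbed (≤-trans (+-monoˡ-≤ deg (small dz)) (≤-reflexive (sym (+-suc k deg))))))
      where
      Y⁺ : Fin nL → Bool
      Y⁺ l = Y Z l ∨ (l == s)
      c : Fin nJ → ℕ
      c j = ind (at j ∧ (Z ∋ j))
      f : Fin nJ → ℕ
      f j = ind (X Z (h j) xor Y⁺ (ℓ j))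
      F : BoolFun 3
      F σ x y = not (σ ∧ y) ⇒ᵇ ((ind (x xor (y ∨ σ)) + (ind (σ ∧ x) + ind (σ ∧ x))) ≤ᵇ (ind (x xor y) + ind σ))
      check = tautology 3 F tt
      absorbed : cut h ℓ (X Z) Y⁺ + (p Z + p Z) ≤ δ Z + deg
      absorbed = subst₂ _≤_
        (trans (∑-distrib-+ f (λ j → c j + c j)) (cong (sum f +_) (∑-distrib-+ c c)))
        (∑-distrib-+ (λ j → ind (X Z (h j) xor Y Z (ℓ j))) (ind ∘ at))
        (sum-mono λ j → ≤ᵇ⇒≤ _ _ (⇒ᵇ-elim (check (at j) (X Z (h j)) (Y Z (ℓ j))) (off-block Z j)))

    sep-δ : ∀ Z {j j′} → Z ∋ j ≡ true → Z ∋ j′ ≡ false → k ≤ δ Z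
    sep-δ Z {j} {j′} zj zj′ = conn (X Z) (Y Z) ((h j , zj) , (h j′ , zj′))

    p<deg : ∀ {Z} → Dangerous Z → p Z < deg
    p<deg {Z} dz = ≰⇒> λ deg≤p → <⇒≱ (≤-trans (s≤s (s≤s z≤n)) 4≤deg)
      (+-cancelʳ-≤ deg deg 1 (≤-trans (+-mono-≤ deg≤p deg≤p) (2p≤deg+1 dz)))

    outside : ∀ {Z} → Dangerous Z → ∃ λ j → at j ≡ true × Z ∋ j ≡ false
    outside {Z} dz with any? (λ j → (at j ≟ᵇ true) ×-dec (Z ∋ j ≟ᵇ false))
    ... | yes w = w
    ... | no ¬w = contradiction (count-mono lem) (<⇒≱ (p<deg dz))
      where
      lem : ∀ j → at j ≡ true → at j ∧ (Z ∋ j) ≡ true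
      lem j aj with Z ∋ j in zj
      ... | true = ∧-intro aj refl
      ... | false = contradiction (j , aj , zj) ¬w

    differ : ∀ Z {j j′} → Z ∋ j ≡ true → Z ∋ j′ ≡ false → j ≢ j′
    differ Z zj zj′ refl = true≢false zj zj′

    -- Both differences separate vertices, so posimodularity reads `2 k + 2 p₂ ≤ 2 k + 2`. With the
    -- common half-edge `j₀` there is no slack left, which fixes `p₂` and makes a difference tight.
    module Crossing {Z W j₀ j₁ j₂} (dz : Dangerous Z) (dw : Dangerous W)
      (a₀ : at j₀ ≡ true) (zj₀ : Z ∋ j₀ ≡ true) (wj₀ : W ∋ j₀ ≡ true)
      (zj₁ : Z ∋ j₁ ≡ true) (wj₁ : W ∋ j₁ ≡ false)
      (wj₂ : W ∋ j₂ ≡ true) (zj₂ : Z ∋ j₂ ≡ false) where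

      δ₁ : k ≤ δ (Z ∖ W)
      δ₁ = sep-δ (Z ∖ W) {j₁} {j₀} (∖-in {Z} {W} {j₁} zj₁ wj₁) (∖-out {Z} {W} {j₀} wj₀)

      δ₂ : k ≤ δ (W ∖ Z)
      δ₂ = sep-δ (W ∖ Z) {j₂} {j₀} (∖-in {W} {Z} {j₂} wj₂ zj₂) (∖-out {W} {Z} {j₀} zj₀)

      common≥1 : 1 ≤ p₂ Z W
      common≥1 = member≤ _ j₀ a₀ (∧-intro zj₀ wj₀)

      bound : δ (Z ∖ W) + δ (W ∖ Z) + (p₂ Z W + p₂ Z W) ≤ suc k + suc k
      bound = ≤-trans (posimodular Z W) (+-mono-≤ (small dz) (small dw))

      sk+sk : suc k + suc k ≡ k + k + 2
      sk+sk = lem k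
        where
        lem : ∀ k → suc k + suc k ≡ k + k + 2
        lem = solve-∀

      common≡1 : p₂ Z W ≡ 1
      common≡1 = ≤-antisym (≮⇒≥ λ 1<q → <⇒≱ (+-mono-≤ 1<q (≤-trans (s≤s z≤n) 1<q))
          (+-cancelˡ-≤ (k + k) _ _ (≤-trans (+-monoˡ-≤ _ (+-mono-≤ δ₁ δ₂)) (≤-trans bound (≤-reflexive sk+sk)))))
        common≥1

      tight : δ (Z ∖ W) ≤ k
      tight = +-cancelʳ-≤ (k + 2) _ _ (≤-trans
        (≤-trans (≤-reflexive (sym (+-assoc (δ (Z ∖ W)) k 2)))
          (+-mono-≤ (+-monoʳ-≤ (δ (Z ∖ W)) δ₂) (+-mono-≤ common≥1 common≥1)))
        (≤-trans bound (≤-reflexive (trans sk+sk (+-assoc k k 2)))))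

    -- The four sets on the left of `three-sets` separate vertices, so `4 k + 2 ≤ 3 k + 3`, contrary
    -- to `2 ≤ k`.
    no-three : ∀ {Z W U j₀ j₁ j₂ j₃} → Dangerous Z → Dangerous W → Dangerous U → at j₀ ≡ true →
      Z ∋ j₀ ≡ true → W ∋ j₀ ≡ true → U ∋ j₀ ≡ true →
      Z ∋ j₁ ≡ true → W ∋ j₁ ≡ false → U ∋ j₁ ≡ false →
      W ∋ j₂ ≡ true → Z ∋ j₂ ≡ false → U ∋ j₂ ≡ false →
      U ∋ j₃ ≡ true → Z ∋ j₃ ≡ false → W ∋ j₃ ≡ false → ⊥
    no-three {Z} {W} {U} {j₀} {j₁} {j₂} {j₃} dz dw du a₀ z₀ w₀ u₀ z₁ w₁ u₁ w₂ z₂ u₂ u₃ z₃ w₃ =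
      <⇒≱ 2≤k (+-cancelˡ-≤ (k + k + k + 2) k 1 total)
      where
      c≥1 : 1 ≤ p₃ Z W U
      c≥1 = member≤ _ j₀ a₀ (∧-intro z₀ (∧-intro w₀ u₀))
      b₁ : k ≤ δ (Z ∩ (W ∩ U))
      b₁ = sep-δ (Z ∩ (W ∩ U)) {j₀} {j₃} (∧-intro z₀ (∧-intro w₀ u₀)) (cong (_∧ (X W (h j₃) ∧ X U (h j₃))) z₃)
      b₂ : k ≤ δ ((Z ∖ W) ∖ U)
      b₂ = sep-δ ((Z ∖ W) ∖ U) {j₁} {j₀} (∖-in {Z ∖ W} {U} {j₁} (∖-in {Z} {W} {j₁} z₁ w₁) u₁) (∖-out {Z ∖ W} {U} {j₀} u₀)
      b₃ : k ≤ δ ((W ∖ Z) ∖ U)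
      b₃ = sep-δ ((W ∖ Z) ∖ U) {j₂} {j₀} (∖-in {W ∖ Z} {U} {j₂} (∖-in {W} {Z} {j₂} w₂ z₂) u₂) (∖-out {W ∖ Z} {U} {j₀} u₀)
      b₄ : k ≤ δ ((U ∖ Z) ∖ W)
      b₄ = sep-δ ((U ∖ Z) ∖ W) {j₃} {j₀} (∖-in {U ∖ Z} {W} {j₃} (∖-in {U} {Z} {j₃} u₃ z₃) w₃) (∖-out {U ∖ Z} {W} {j₀} w₀)
      l : ∀ k → k + k + k + 2 + k ≡ k + k + (k + k) + (1 + 1)
      l = solve-∀
      r : ∀ k → suc k + suc k + suc k ≡ k + k + k + 2 + 1
      r = solve-∀
      total : k + k + k + 2 + k ≤ k + k + k + 2 + 1
      total = ≤-trans (≤-reflexive (l k)) (≤-trans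
        (+-mono-≤ (+-mono-≤ (+-mono-≤ b₁ b₂) (+-mono-≤ b₃ b₄)) (+-mono-≤ c≥1 c≥1))
        (≤-trans (three-sets Z W U) (≤-trans (+-mono-≤ (+-mono-≤ (small dz) (small dw)) (small du)) (≤-reflexive (r k)))))

    module _ (j₀ : Fin nJ) (a₀ : at j₀ ≡ true) (no-cover : ¬ Cover j₀) where

      -- The search replaces `Z`, or for fixed `Z` the second set `W`, by a dangerous set with
      -- strictly more half-edges at `s`; `n` and `m` bound how many are still missing. It can end
      -- only in a cover or in three crossing sets.
      enlarge : ∀ n Z → Dangerous Z → Z ∋ j₀ ≡ true → deg ≤ p Z + n → ⊥
      enlarge-second : ∀ n m Z W → Dangerous Z → Z ∋ j₀ ≡ true → deg ≤ p Z + suc n →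
        Dangerous W → W ∋ j₀ ≡ true → deg ≤ p W + m →
        ∀ j₁ → at j₁ ≡ true → W ∋ j₁ ≡ true → Z ∋ j₁ ≡ false → ⊥

      enlarge zero Z dz z₀ fuel = <⇒≱ (p<deg dz) (subst (deg ≤_) (+-identityʳ _) fuel)
      enlarge (suc n) Z dz z₀ fuel with outside dz
      ... | j₁ , a₁ , z₁ = blocked j₀ j₁ a₀ a₁ (differ Z z₀ z₁) λ { (W , dw , w₀ , w₁) →
        enlarge-second n deg Z W dz z₀ fuel dw w₀ (m≤n+m deg _) j₁ a₁ w₁ z₁ }

      grow : ∀ {m} {Z W} → deg ≤ p Z + suc m → p Z < p W → deg ≤ p W + m
      grow {m} {Z} {W} fuel lt = ≤-trans fuel (≤-trans (≤-reflexive (+-suc (p Z) m)) (+-monoˡ-≤ m lt))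

      enlarge-second n zero Z W dz z₀ fuel dw w₀ fuel′ j₁ a₁ w₁ z₁ =
        <⇒≱ (p<deg dw) (subst (deg ≤_) (+-identityʳ _) fuel′)
      enlarge-second n (suc m) Z W dz z₀ fuel dw w₀ fuel′ j₁ a₁ w₁ z₁ with difference? Z W
      ... | inj₂ Z⊆W = enlarge n W dw w₀ (grow {Z = Z} {W} fuel (p-mono-< {Z} {W} Z⊆W j₁ a₁ z₁ w₁))
      ... | inj₁ (j₂ , a₂ , z₂ , w₂) with any? (λ j → (at j ≟ᵇ true) ×-dec (Z ∋ j ≟ᵇ false) ×-dec (W ∋ j ≟ᵇ false))
      ...   | no none = no-cover record
        { Z = Z ; W = W ; Z-danger = dz ; W-danger = dw ; Z∋j₀ = z₀ ; W∋j₀ = w₀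
        ; j₁ = j₂ ; j₁∈s = a₂ ; Z∋j₁ = z₂ ; W∌j₁ = w₂
        ; common = Crossing.common≡1 {Z} {W} {j₀} {j₂} {j₁} dz dw a₀ z₀ w₀ z₂ w₂ w₁ z₁
        ; tight = Crossing.tight {Z} {W} {j₀} {j₂} {j₁} dz dw a₀ z₀ w₀ z₂ w₂ w₁ z₁
        ; all = λ j aj zj → case W ∋ j ≟ᵇ true of λ
            { (yes wj) → wj ; (no ¬wj) → contradiction (j , aj , zj , ¬true⇒false ¬wj) none } }
      ...   | yes (j₃ , a₃ , z₃ , w₃) = blocked j₀ j₃ a₀ a₃ (differ Z z₀ z₃) third
        where
        only-j₀ : ∀ j → at j ≡ true → Z ∋ j ≡ true → W ∋ j ≡ true → j ≡ j₀
        only-j₀ j aj zj wj with j ≟ j₀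
        ... | yes e = e
        ... | no ne = contradiction (≤-reflexive (Crossing.common≡1 {Z} {W} {j₀} {j₂} {j₁} dz dw a₀ z₀ w₀ z₂ w₂ w₁ z₁))
          (<⇒≱ (≤-trans (≤-reflexive (sym (cong₂ _+_ (count-single j) (count-single j₀))))
            (≤-trans (≤-reflexive (sym (∑-distrib-+ (λ i → ind (i == j)) _))) (sum-mono both))))
          where
          both : ∀ i → ind (i == j) + ind (i == j₀) ≤ ind (at i ∧ ((Z ∋ i) ∧ (W ∋ i)))
          both i with i ≟ j | i ≟ j₀
          ... | yes refl | yes refl = contradiction refl ne
          ... | yes refl | no _ = ≤-reflexive (cong ind (sym (∧-intro aj (∧-intro zj wj))))
          ... | no _ | yes refl = ≤-reflexive (cong ind (sym (∧-intro a₀ (∧-intro z₀ w₀))))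
          ... | no _ | no _ = z≤n
        third : (∃ λ U → Dangerous U × U ∋ j₀ ≡ true × U ∋ j₃ ≡ true) → ⊥
        third (U , du , u₀ , u₃) with difference? Z U | difference? W U
        ... | inj₂ Z⊆U | _ = enlarge n U du u₀ (grow {Z = Z} {U} fuel (p-mono-< {Z} {U} Z⊆U j₃ a₃ z₃ u₃))
        ... | inj₁ _ | inj₂ W⊆U = enlarge-second n m Z U dz z₀ fuel du u₀
            (grow {Z = W} {U} fuel′ (p-mono-< {W} {U} W⊆U j₃ a₃ w₃ u₃)) j₃ a₃ u₃ z₃
        -- No set contains another. As `Z` and `W` share only `j₀` at `s`, the half-edge `j₄` avoids
        -- `W` and `j₅` avoids `Z`, so each of the three sets has a private half-edge.
        ... | inj₁ (j₄ , a₄ , z₄ , u₄) | inj₁ (j₅ , a₅ , w₅ , u₅) =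
          no-three {Z} {W} {U} {j₀} {j₄} {j₅} {j₃} dz dw du a₀ z₀ w₀ u₀ z₄
            (¬true⇒false λ w₄ → differ U u₀ u₄ (sym (only-j₀ j₄ a₄ z₄ w₄))) u₄ w₅
            (¬true⇒false λ z₅ → differ U u₀ u₅ (sym (only-j₀ j₅ a₅ z₅ w₅))) u₅ u₃ z₃ w₃

      cover-exists : (∃ λ j → at j ≡ true × j₀ ≢ j) → ⊥
      cover-exists (j , aj , ne) = blocked j₀ j a₀ aj ne λ { (Z , dz , z₀ , _) → enlarge deg Z dz z₀ (m≤n+m deg _) }

    cover : ∀ j₀ → at j₀ ≡ true → ¬ ¬ Cover j₀
    cover j₀ a₀ ¬c with two≤count⇒other at (≤-trans (s≤s (s≤s z≤n)) 4≤deg) j₀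
    ... | j , ne , aj = cover-exists j₀ a₀ ¬c (j , aj , λ e → ne (sym e))

    module Finish {j₀} (c₀ : Cover j₀) where
      module C = Cover c₀
      A : Side
      A = C.Z ∖ C.W

      half : ∀ {a b d} → d + 1 ≤ a + b → a + a ≤ suc d → b + b ≤ suc d → suc d ≤ a + a
      half {a} {b} {d} h₁ h₂ h₃ = +-cancelʳ-≤ (suc d) _ _ (≤-trans
        (≤-trans (≤-reflexive (lem d)) (+-mono-≤ h₁ h₁))
        (≤-trans (≤-reflexive (lem′ a b)) (+-monoʳ-≤ (a + a) h₃)))
        where
        lem : ∀ d → suc d + suc d ≡ d + 1 + (d + 1)
        lem = solve-∀
        lem′ : ∀ a b → a + b + (a + b) ≡ a + a + (b + b)
        lem′ = solve-∀

      covered : ∀ {j} (c : Cover j) → let open Cover c in deg + 1 ≤ p Z + p W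
      covered c = subst (λ q → deg + q ≤ p Z + p W) common (p+p₂-cover Z W all)
        where open Cover c

      -- The two sides cover `s` and share one half-edge, so `p Z + p W` is at least `deg + 1`; as
      -- neither term exceeds half of that, each is exactly half.
      pZ : ∀ {j} (c : Cover j) → suc deg ≤ p (Cover.Z c) + p (Cover.Z c)
      pZ c = half {p Z} {p W} (covered c) (2p≤deg+1 Z-danger) (2p≤deg+1 W-danger)
        where open Cover c

      pW : ∀ {j} (c : Cover j) → suc deg ≤ p (Cover.W c) + p (Cover.W c)
      pW c = half {p W} {p Z} (subst (deg + 1 ≤_) (+-comm (p Z) (p W)) (covered c)) (2p≤deg+1 W-danger) (2p≤deg+1 Z-danger)
        where open Cover c

      pA : p C.Z ≡ p A + 1
      pA = trans (p-∖ C.Z C.W) (cong (p A +_) C.common)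

      -- From `4 ≤ deg` one gets `2 p Z ≥ 5`, hence `p Z ≥ 3`, and `A` loses a single half-edge of
      -- `Z`. In degree three only one half-edge would be sure to remain, so blocks of size three
      -- stay.
      2≤pA : 2 ≤ p A
      2≤pA = ≮⇒≥ λ pA<2 → <⇒≱ (≤-trans (s≤s 4≤deg) (pZ c₀))
        (subst (λ q → q + q ≤ 4) (sym pA) (+-mono-≤ (+-monoˡ-≤ 1 (s≤s⁻¹ pA<2)) (+-monoˡ-≤ 1 (s≤s⁻¹ pA<2))))

      2pA<deg : p A + p A < suc deg
      2pA<deg = ≤-trans (s≤s (m≤m+n _ 1)) (≤-trans
        (≤-reflexive (lem (p A))) (≤-trans (≤-reflexive (cong₂ _+_ (sym pA) (sym pA))) (2p≤deg+1 C.Z-danger)))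
        where
        lem : ∀ a → suc (a + a + 1) ≡ a + 1 + (a + 1)
        lem = solve-∀

      A∋j₁ : A ∋ C.j₁ ≡ true
      A∋j₁ = ∖-in {C.Z} {C.W} {C.j₁} C.Z∋j₁ C.W∌j₁

      -- `U` is too big to lie inside `A`. If the two crossed, tightness of `A` would turn
      -- posimodularity into `2 k + 2 ≤ 2 k + 1`.
      inside : ∀ {U} → Dangerous U → U ∋ C.j₁ ≡ true → suc deg ≤ p U + p U →
        ∀ j → at j ≡ true → A ∋ j ≡ true → U ∋ j ≡ true
      inside {U} du u₁ big with difference? A U | difference? U A
      ... | inj₂ A⊆U | _ = A⊆U
      ... | inj₁ _ | inj₂ U⊆A = contradiction (+-mono-≤ (p-mono {U} {A} U⊆A) (p-mono {U} {A} U⊆A)) (<⇒≱ (≤-trans 2pA<deg big))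
      ... | inj₁ (j , aj , Aj , uj) | inj₁ (i , ai , ui , Ai) = ⊥-elim (<⇒≱ (s≤s ≤-refl) (+-cancelˡ-≤ (k + k) 2 1 (≤-trans
          (+-mono-≤ (+-mono-≤ (sep-δ (A ∖ U) {j} {C.j₁} (∖-in {A} {U} {j} Aj uj) (∖-out {A} {U} {C.j₁} u₁))
                              (sep-δ (U ∖ A) {i} {C.j₁} (∖-in {U} {A} {i} ui Ai) (∖-out {U} {A} {C.j₁} A∋j₁)))
            (+-mono-≤ shared shared))
          (≤-trans (posimodular A U) (≤-trans (+-mono-≤ C.tight (small du)) (≤-reflexive (lem k)))))))
        where
        shared : 1 ≤ p₂ A U
        shared = member≤ _ C.j₁ C.j₁∈s (∧-intro A∋j₁ u₁)
        lem : ∀ k → k + suc k ≡ k + k + 1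
        lem = solve-∀

      finish : Cover C.j₁ → ⊥
      finish c = <⇒≱ 2≤pA (≤-trans (count-mono λ j e → case ∧-true {at j} e of λ { (aj , Aj) →
          ∧-intro aj (∧-intro (inside (Cover.Z-danger c) (Cover.Z∋j₀ c) (pZ c) j aj Aj)
                              (inside (Cover.W-danger c) (Cover.W∋j₀ c) (pW c) j aj Aj)) })
        (≤-reflexive (Cover.common c)))

    stuck : ⊥
    stuck with count≥1⇒∃ at (≤-trans (s≤s z≤n) 4≤deg)
    ... | j₀ , a₀ = cover j₀ a₀ λ c₀ → cover (Cover.j₁ c₀) (Cover.j₁∈s c₀) (Finish.finish c₀)

-- Packing trees in a hypergraph

_[_≔_] : ∀ {n} {B : Set} → (Fin n → B) → Fin n → B → Fin n → B
(f [ s ≔ v ]) s′ = if s′ == s then v else f s′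

≔-same : ∀ {n} {B : Set} (f : Fin n → B) s v → (f [ s ≔ v ]) s ≡ v
≔-same f s v rewrite ==-refl s = refl

≔-other : ∀ {n} {B : Set} (f : Fin n → B) {s s′} v → s′ ≢ s → (f [ s ≔ v ]) s′ ≡ f s′
≔-other f v ne rewrite ≢⇒==-false ne = refl

abstract
  isColor : ∀ {m} → Maybe (Fin m) → Fin m → Bool
  isColor (just c) i = c == i
  isColor nothing  i = false

  isColor⇒ : ∀ {m} {c : Maybe (Fin m)} {i} → isColor c i ≡ true → c ≡ just i
  isColor⇒ {c = just c} e = cong just (==⇒≡ e)

  ⇒isColor : ∀ {m} {c : Maybe (Fin m)} {i} → c ≡ just i → isColor c i ≡ true
  ⇒isColor {i = i} refl = ==-refl i

abstract
  below : ∀ {n} → ℕ → Fin n → Bool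
  below k s = does (toℕ s <? k)

  below-⇒ : ∀ {n k} {s : Fin n} → below k s ≡ true → toℕ s < k
  below-⇒ {k = k} {s} = does⇒ (toℕ s <? k)

  below-intro : ∀ {n k} {s : Fin n} → toℕ s < k → below k s ≡ true
  below-intro {k = k} {s} = dec-true (toℕ s <? k)

  below-false : ∀ {n k} {s : Fin n} → k ≤ toℕ s → below k s ≡ false
  below-false {k = k} {s} k≤s = dec-false (toℕ s <? k) (≤⇒≯ k≤s)

below-suc : ∀ {n k} {s : Fin n} → below (suc k) s ≡ true → toℕ s ≢ k → below k s ≡ true
below-suc e ne = below-intro (≤∧≢⇒< (s≤s⁻¹ (below-⇒ e)) ne)

below-step : ∀ {n k} {s : Fin n} → below k s ≡ true → below (suc k) s ≡ true
below-step e = below-intro (m≤n⇒m≤1+n (below-⇒ e))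

xor-false : ∀ {b c} → c ≡ false → b xor c ≡ true → b ≡ true
xor-false {true} refl _ = refl
xor-false {false} refl ()

is-used : ∀ {A : Set} → Maybe A → Bool
is-used (just _) = true
is-used nothing  = false

module _ {nV nJ nL : ℕ} (h : Fin nJ → Fin nV) (ℓ : Fin nJ → Fin nL) where

  -- Colours sit on half-edges rather than on blocks: when split-off pairs are merged back, one
  -- block may carry several colours, and the links survive because the split blocks refine the
  -- original ones.
  Monochromatic : ∀ {m} → (Fin nJ → Fin m) → Fin m → Fin nV → Fin nV → Set
  Monochromatic c i x y = ∃ λ j → ∃ λ j′ → ℓ j ≡ ℓ j′ × c j ≡ i × c j′ ≡ i × h j ≡ x × h j′ ≡ y

  Packs : ∀ {m} → (Fin nJ → Fin m) → Set
  Packs c = ∀ i x y → EqClosure (Monochromatic c i) x y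

module Hypergraph {nV nJ nL : ℕ} (h : Fin nJ → Fin nV) (ℓ : Fin nJ → Fin nL) (m₀ : ℕ) where

  m : ℕ
  m = suc m₀

  Ep : Fin nL → Fin nV → Set
  Ep s x = ∃ λ j → ℓ j ≡ s × h j ≡ x

  -- The hyperedge s, if coloured, is trimmed to the edge from a s to b s; otherwise a s and b s are junk.
  record State : Set where
    constructor state
    field
      col : Fin nL → Maybe (Fin m)
      a b : Fin nL → Fin nV

  open State

  class : State → Fin m → Fin nL → Bool
  class F i s = isColor (col F s) i

  In : State → (Fin nL → Bool) → Fin nV → Fin nV → Set
  In F = Con (a F) (b F)

  record Valid (F : State) : Set where
    field
      trimmed : ∀ {s i} → col F s ≡ just i → Ep s (a F s) × Ep s (b F s)
      forest  : ∀ {s i} → col F s ≡ just i → ¬ In F (without (class F i) s) (a F s) (b F s)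

  open Valid

  size : State → ℕ
  size F = count (λ s → is-used (col F s))

  delete : State → Fin nL → State
  delete F f = state (col F [ f ≔ nothing ]) (a F) (b F)

  insert : State → Fin nL → Fin m → Fin nV → Fin nV → State
  insert F s i x y = state (col F [ s ≔ just i ]) (a F [ s ≔ x ]) (b F [ s ≔ y ])

  delete-col : ∀ F f {s i} → col (delete F f) s ≡ just i → s ≢ f × col F s ≡ just i
  delete-col F f {s} e with s ≟ f
  ... | no ne = ne , e

  delete-valid : ∀ {F} f → Valid F → Valid (delete F f)
  delete-valid {F} f v = record
    { trimmed = λ e → trimmed v (proj₂ (delete-col F f e))
    ; forest = λ {s} e c → forest v (proj₂ (delete-col F f e)) (con-mono (λ s′ w →
        without-intro _ (⇒isColor (proj₂ (delete-col F f (isColor⇒ (without-⊆ _ s s′ w))))) (without-≢ _ s s′ w)) c)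
    }

  -- A new cycle through an old edge `s` must use `s₀`, and the rest of it would join `x` to `y` in
  -- the old forest of colour `i`. The other colours are untouched.
  insert-valid : ∀ {F s₀ i x y} → Valid F → Ep s₀ x → Ep s₀ y →
    ¬ In F (class F i) x y → Valid (insert F s₀ i x y)
  insert-valid {F} {s₀} {i} {x} {y} v ex ey ¬xy = record { trimmed = tr ; forest = fo }
    where
    F′ = insert F s₀ i x y
    old : ∀ {s i′} → s ≢ s₀ → col F′ s ≡ just i′ → col F s ≡ just i′
    old ne e = trans (sym (≔-other (col F) _ ne)) e
    olda : ∀ {s} → s ≢ s₀ → a F′ s ≡ a F s
    olda ne = ≔-other (a F) x ne
    oldb : ∀ {s} → s ≢ s₀ → b F′ s ≡ b F s
    oldb ne = ≔-other (b F) y ne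
    tr : ∀ {s i′} → col F′ s ≡ just i′ → Ep s (a F′ s) × Ep s (b F′ s)
    tr {s} e with s ≟ s₀
    ... | yes refl = ex , ey
    ... | no ne = trimmed v e
    old-links : ∀ i′ s → without (class F′ i′) s₀ s ≡ true →
      class F i′ s ≡ true × a F′ s ≡ a F s × b F′ s ≡ b F s
    old-links i′ s w = ⇒isColor (old ne (isColor⇒ (without-⊆ _ s₀ s w))) , olda ne , oldb ne
      where ne = without-≢ _ s₀ s w
    fo : ∀ {s i′} → col F′ s ≡ just i′ → ¬ In F′ (without (class F′ i′) s) (a F′ s) (b F′ s)
    fo {s} {i′} e c with s ≟ s₀
    ... | yes refl = ¬xy (subst (λ i → In F (class F i) x y) (sym (just-injective e)) (con-transfer (old-links i′) c))
    ... | no ne = go (con-without s₀ c)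
      where
      A = without (without (class F′ i′) s) s₀
      down : ∀ {u w} → In F′ A u w → In F (without (class F i′) s) u w
      down = con-transfer λ s′ w → case old-links i′ s′ (without-intro _ (without-⊆ _ s s′ (without-⊆ _ s₀ s′ w)) (without-≢ _ s₀ s′ w)) of
        λ { (cl , ea , eb) → without-intro _ cl (without-≢ _ s s′ (without-⊆ _ s₀ s′ w)) , ea , eb }
      up : ∀ {u w} → In F (without (class F i′) s) u w → In F (class F i′) u w
      up = con-mono λ s′ w → without-⊆ _ s s′ w
      self : In F (class F i′) (a F s) (b F s)
      self = con-link s (⇒isColor e)
      not-i : i′ ≢ i → In F′ (without (class F′ i′) s) (a F s) (b F s) → ⊥
      not-i i′≢i c′ = forest v e (down (con-mono (λ s′ w → without-intro _ w λ { refl →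
        i′≢i (sym (just-injective (trans (sym (≔-same (col F) s₀ (just i))) (isColor⇒ (without-⊆ _ s s′ w))))) }) c′))
      x₀ : a F′ s₀ ≡ x
      x₀ = ≔-same (a F) s₀ x
      y₀ : b F′ s₀ ≡ y
      y₀ = ≔-same (b F) s₀ y
      go : In F′ A (a F s) (b F s)
        ⊎ (In F′ A (a F s) (a F′ s₀) × In F′ A (b F′ s₀) (b F s))
        ⊎ (In F′ A (a F s) (b F′ s₀) × In F′ A (a F′ s₀) (b F s)) → ⊥
      go (inj₁ d) = forest v e (down d)
      go (inj₂ d) with i′ ≟ i
      ... | no ne′ = not-i ne′ c
      go (inj₂ (inj₁ (d , d′))) | yes refl = ¬xy (con-trans (con-sym (subst (In F _ _) x₀ (up (down d))))
        (con-trans self (con-sym (subst (λ z → In F _ z _) y₀ (up (down d′))))))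
      go (inj₂ (inj₂ (d , d′))) | yes refl = ¬xy (con-trans (subst (λ z → In F _ z _) x₀ (up (down d′)))
        (con-trans (con-sym self) (subst (In F _ _) y₀ (up (down d)))))

  size-insert : ∀ F {s₀} i x y → col F s₀ ≡ nothing → size (insert F s₀ i x y) ≡ suc (size F)
  size-insert F {s₀} i x y free = trans (sum-cong-≗ lem) (trans (∑-distrib-+ (λ s → ind (s == s₀)) _) (cong (_+ size F) (count-single s₀)))
    where
    lem : ∀ s → ind (is-used (col (insert F s₀ i x y) s)) ≡ ind (s == s₀) + ind (is-used (col F s))
    lem s with s ≟ s₀
    ... | yes refl rewrite free = refl
    ... | no ne = refl

  size-delete : ∀ F {f i} → col F f ≡ just i → size F ≡ suc (size (delete F f))
  size-delete F {f} used = trans (sum-cong-≗ lem) (trans (∑-distrib-+ (λ s → ind (s == f)) _) (cong (_+ size (delete F f)) (count-single f)))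
    where
    lem : ∀ s → ind (is-used (col F s)) ≡ ind (s == f) + ind (is-used (col (delete F f) s))
    lem s with s ≟ f
    ... | yes refl rewrite used = refl
    ... | no ne = refl

  swap : State → Fin nL → Fin nL → Fin m → Fin nV → Fin nV → State
  swap F f s i x y = insert (delete F f) s i x y

  -- An uncoloured hyperedge s replaces an edge f on the path joining x and y in its forest.
  data Reachable (F₀ : State) : State → Set where
    base : Reachable F₀ F₀
    move : ∀ {F f s i x y} → Reachable F₀ F → col F s ≡ nothing → Ep s x → Ep s y → col F f ≡ just i →
      ¬ In F (without (class F i) f) x y → Reachable F₀ (swap F f s i x y)

  just≢nothing : ∀ {A : Set} {c : Maybe A} {i} → c ≡ just i → c ≡ nothing → ⊥
  just≢nothing refl ()

  ¬delete : ∀ {F f i x y} → ¬ In F (without (class F i) f) x y → ¬ In (delete F f) (class (delete F f) i) x y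
  ¬delete {F} {f} ¬c c = ¬c (con-mono (λ s e → case delete-col F f {s} (isColor⇒ e) of λ { (ne , e′) → without-intro _ (⇒isColor e′) ne }) c)

  reachable-valid : ∀ {F₀ F} → Valid F₀ → Reachable F₀ F → Valid F
  reachable-valid v base = v
  reachable-valid v (move {F} {f} r free ex ey used ¬c) =
    insert-valid (delete-valid f (reachable-valid v r)) ex ey (¬delete {F} ¬c)

  swap-free : ∀ {F f s i} → col F s ≡ nothing → col F f ≡ just i → col (delete F f) s ≡ nothing
  swap-free {F} {f} {s} free used = trans (≔-other (col F) nothing λ { refl → just≢nothing used free }) free

  reachable-size : ∀ {F₀ F} → Reachable F₀ F → size F ≡ size F₀
  reachable-size base = refl
  reachable-size (move {F} {f} {s} {i} {x} {y} r free ex ey used ¬c) =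
    trans (size-insert (delete F f) i x y (swap-free {F} free used)) (trans (sym (size-delete F used)) (reachable-size r))

  Freeable : State → Fin nL → Set
  Freeable F₀ s = ∃ λ F → Reachable F₀ F × col F s ≡ nothing

  module Maximal (F₀ : State) (valid₀ : Valid F₀) (maximal : ∀ F → Valid F → ¬ (size F₀ < size F))
    (freeable? : ∀ s → Dec (Freeable F₀ s)) where

    loose : Fin nL → Bool
    loose s = does (freeable? s)

    -- Otherwise the free hyperedge could be inserted with colour `i`, giving a valid state larger
    -- than `F₀`.
    joined : ∀ {F s x y} → Reachable F₀ F → col F s ≡ nothing → Ep s x → Ep s y → ∀ i → In F (class F i) x y
    joined {F} {s} {x} {y} r free ex ey i with con? (a F) (b F) (class F i) x y
    ... | yes c = c
    ... | no ¬c = contradiction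
      (≤-reflexive (trans (cong suc (sym (reachable-size r))) (sym (size-insert F i x y free))))
      (maximal _ (insert-valid (reachable-valid valid₀ r) ex ey ¬c))

    -- Otherwise `s` could be swapped for `f`, which would make `f` freeable.
    joined-without : ∀ {F s x y} → Reachable F₀ F → col F s ≡ nothing → Ep s x → Ep s y → ∀ i f →
      loose f ≡ false → In F (without (class F i) f) x y
    joined-without {F} {s} {x} {y} r free ex ey i f nf with con? (a F) (b F) (without (class F i) f) x y
    ... | yes c = c
    ... | no ¬c with class F i f in cf
    ...   | false = contradiction (con-mono (λ s′ e → without-intro (class F i) {f} {s′} e λ { refl → true≢false e cf }) (joined r free ex ey i)) ¬c
    ...   | true = ⊥-elim (true≢false (dec-true (freeable? f) (_ , move r free ex ey used ¬c , freed)) nf)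
      where
      used : col F f ≡ just i
      used = isColor⇒ cf
      freed : col (swap F f s i x y) f ≡ nothing
      freed = trans (≔-other (col F [ f ≔ nothing ]) (just i) λ { refl → just≢nothing used free })
        (≔-same (col F) f nothing)

    -- In a forest the path from x to y avoids every f ∉ loose, hence stays inside loose.
    joined-freeable : ∀ {F s x y} → Reachable F₀ F → col F s ≡ nothing → Ep s x → Ep s y → ∀ i →
      In F (λ s → class F i s ∧ loose s) x y
    joined-freeable {F} {s} {x} {y} r free ex ey i = con-mono last (peel nL ≤-refl)
      where
      A : ℕ → Fin nL → Bool
      A n s = class F i s ∧ (loose s ∨ not (below n s))
      last : ∀ s → A nL s ≡ true → class F i s ∧ loose s ≡ true
      last s e with ∧-true {class F i s} e
      ... | cl , q rewrite below-intro {k = nL} {s} (toℕ<n s) with loose s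
      ...   | true = ∧-intro cl refl
      peel : ∀ n → n ≤ nL → In F (A n) x y
      peel zero _ = con-mono (λ s e → ∧-intro e (lem s)) (joined r free ex ey i)
        where
        lem : ∀ s → loose s ∨ not (below 0 s) ≡ true
        lem s with loose s
        ... | true = refl
        ... | false = cong not (below-false {k = 0} {s} z≤n)
      peel (suc n) n<nL = case₂ (class F i f) (loose f) refl refl
        where
        f = fromℕ< n<nL
        tof : toℕ f ≡ n
        tof = toℕ-fromℕ< n<nL
        keep-other : ∀ s → A n s ≡ true → s ≢ f → A (suc n) s ≡ true
        keep-other s e ne with ∧-true {class F i s} e
        ... | cl , q with loose s | below (suc n) s in eq
        ...   | true | _ = ∧-intro cl refl
        ...   | false | false = ∧-intro cl refl
        ...   | false | true rewrite below-suc {k = n} {s} eq (λ e → ne (toℕ-injective (trans e (sym tof)))) = case q of λ ()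
        rest : In F (A n) x y
        rest = peel n (<⇒≤ n<nL)
        case₂ : ∀ c e → class F i f ≡ c → loose f ≡ e → In F (A (suc n)) x y
        case₂ false _ cf _ = con-mono (λ s e → keep-other s e λ { refl → true≢false (proj₁ (∧-true e)) cf }) rest
        case₂ true true cf ef = con-mono lem rest
          where
          lem : ∀ s → A n s ≡ true → A (suc n) s ≡ true
          lem s e with s ≟ f
          ... | yes refl rewrite cf | ef = refl
          ... | no ne = keep-other s e ne
        case₂ true false cf ef with con-without f rest
        ... | inj₁ c = con-mono (λ s w → keep-other s (without-⊆ _ f s w) (without-≢ _ f s w)) c
        -- The path runs through `f`. Since `x` and `y` are also joined without `f`, the two
        -- connections close a cycle through `f` in a forest.
        ... | inj₂ d = ⊥-elim (forest (reachable-valid valid₀ r) (isColor⇒ cf) (loop d))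
          where
          W = without (class F i) f
          sub : ∀ {u w} → In F (without (A n) f) u w → In F W u w
          sub = con-mono λ s w → without-intro _ (proj₁ (∧-true (without-⊆ _ f s w))) (without-≢ _ f s w)
          xy : In F W x y
          xy = joined-without r free ex ey i f ef
          loop : (In F (without (A n) f) x (a F f) × In F (without (A n) f) (b F f) y)
            ⊎ (In F (without (A n) f) x (b F f) × In F (without (A n) f) (a F f) y) → In F W (a F f) (b F f)
          loop (inj₁ (d , d′)) = con-trans (con-sym (sub d)) (con-trans xy (con-sym (sub d′)))
          loop (inj₂ (d , d′)) = con-trans (sub d′) (con-trans (con-sym xy) (sub d))

    -- Undo the moves one at a time: the edge brought in by a move joins two vertices that loose
    -- edges of its colour joined before the move, by `joined-freeable`.
    back-to-start : ∀ {F} → Reachable F₀ F → ∀ i {x y} →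
      In F (λ s → class F i s ∧ loose s) x y → In F₀ (λ s → class F₀ i s ∧ loose s) x y
    back-to-start base i c = c
    back-to-start (move {F} {f} {s₀} {i} {x} {y} r free ex ey used ¬c) i′ =
      back-to-start r i′ ∘ con-into con-equiv lem
      where
      F′ = swap F f s₀ i x y
      lem : ∀ s → class F′ i′ s ∧ loose s ≡ true → In F (λ s → class F i′ s ∧ loose s) (a F′ s) (b F′ s)
      lem s e with ∧-true {class F′ i′ s} e
      ... | cl , Es with s ≟ s₀
      ...   | yes refl = subst (λ i → In F (λ s → class F i s ∧ loose s) x y) (just-injective (isColor⇒ cl)) (joined-freeable r free ex ey i)
      ...   | no ne = con-link s (∧-intro (⇒isColor (proj₂ (delete-col F f {s} (isColor⇒ cl)))) Es)

    loose-joined : ∀ {s x y} → loose s ≡ true → Ep s x → Ep s y → ∀ i → In F₀ (λ s → class F₀ i s ∧ loose s) x y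
    loose-joined {s} Es ex ey i with does⇒ (freeable? s) Es
    ... | F , r , free = back-to-start r i (joined-freeable r free ex ey i)

    _∼[_]_ : Fin nV → Fin m → Fin nV → Set
    x ∼[ i ] y = In F₀ (λ s → class F₀ i s ∧ loose s) x y

    -- Each link is a loose hyperedge, and its ends are joined by loose edges of every colour. So
    -- all colours induce one partition of the vertices, the one tested in the counting.
    ∼-color : ∀ i i′ {x y} → x ∼[ i ] y → x ∼[ i′ ] y
    ∼-color i i′ = con-into con-equiv λ s e → case ∧-true {class F₀ i s} e of λ { (cl , Es) →
      case trimmed valid₀ (isColor⇒ cl) of λ { (ea , eb) → loose-joined Es ea eb i′ } }

    ∼? : ∀ x y → Dec (x ∼[ zero ] y)
    ∼? = con? (a F₀) (b F₀) _

    q : ℕ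
    q = reps ∼?

    fixed : Fin m → ℕ
    fixed i = count (λ s → class F₀ i s ∧ not (loose s))

    -- After contracting the `q` classes, the rigid edges of colour `i` form a forest: each one
    -- added merges two classes, and at least the class of `x₀` remains.
    fixed<q : Fin nV → ∀ i → fixed i < q
    fixed<q x₀ i = ≤-trans (s≤s (count-mono final)) (≤-trans (+-monoˡ-≤ _ one) (add nL ≤-refl))
      where
      g : Fin nL → Bool
      g s = class F₀ i s ∧ not (loose s)
      A : ℕ → Fin nL → Bool
      A n s = class F₀ i s ∧ (loose s ∨ below n s)
      R? : ∀ n x y → Dec (In F₀ (A n) x y)
      R? n = con? (a F₀) (b F₀) (A n)
      final : ∀ s → g s ≡ true → g s ∧ below nL s ≡ true
      final s e = ∧-intro e (below-intro {k = nL} {s} (toℕ<n s))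
      one : 1 ≤ reps (R? nL)
      one with has-rep (R? nL) con-equiv x₀
      ... | y , _ , ry = true⇒count≥1 _ y (dec-true (rep? (R? nL) y) ry)
      loose-or : ∀ s {n} → loose s ≡ true → loose s ∨ below n s ≡ true
      loose-or s e rewrite e = refl
      add : ∀ n → n ≤ nL → reps (R? n) + count (λ s → g s ∧ below n s) ≤ q
      add zero _ = ≤-trans (+-mono-≤ (reps-mono ∼? (R? 0)
          (λ c → con-mono (λ s e → case ∧-true {class F₀ i s} e of λ { (cl , Es) → ∧-intro cl (loose-or s {0} Es) }) (∼-color zero i c)))
          (≤-reflexive (sum-zero none))) (≤-reflexive (+-identityʳ q))
        where
        none : ∀ s → ind (g s ∧ below 0 s) ≡ 0
        none s rewrite below-false {k = 0} {s} z≤n with g s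
        ... | true = refl
        ... | false = refl
      add (suc n) n<nL = case₂ (g f) refl
        where
        f = fromℕ< n<nL
        tof : toℕ f ≡ n
        tof = toℕ-fromℕ< n<nL
        rest = add n (<⇒≤ n<nL)
        other : ∀ {s} → s ≢ f → below (suc n) s ≡ true → below n s ≡ true
        other ne e = below-suc e λ e → ne (toℕ-injective (trans e (sym tof)))
        A-step : ∀ s → A n s ≡ true → A (suc n) s ≡ true
        A-step s e with ∧-true {class F₀ i s} e
        ... | cl , z with loose s
        ...   | true = ∧-intro cl refl
        ...   | false = ∧-intro cl (below-step z)
        case₂ : ∀ c → g f ≡ c → reps (R? (suc n)) + count (λ s → g s ∧ below (suc n) s) ≤ q
        case₂ false gf = ≤-trans (+-mono-≤ (reps-mono (R? n) (R? (suc n)) (con-mono A-step)) (count-mono cm)) rest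
          where
          cm : ∀ s → g s ∧ below (suc n) s ≡ true → g s ∧ below n s ≡ true
          cm s e with ∧-true {g s} e
          ... | gs , bs = ∧-intro gs (other (λ { refl → true≢false gs gf }) bs)
        case₂ true gf = ≤-trans (+-monoʳ-≤ (reps (R? (suc n))) (≤-trans (sum-mono cm)
            (≤-reflexive (trans (∑-distrib-+ (λ s → ind (s == f)) _) (cong (_+ count (λ s → g s ∧ below n s)) (count-single f))))))
          (≤-trans (≤-reflexive (+-suc _ _)) (≤-trans (+-monoˡ-≤ _ merge) rest))
          where
          cf : class F₀ i f ≡ true
          cf = proj₁ (∧-true gf)
          ef : loose f ≡ false
          ef = not-true (proj₂ (∧-true {class F₀ i f} gf))
          cm : ∀ s → ind (g s ∧ below (suc n) s) ≤ ind (s == f) + ind (g s ∧ below n s)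
          cm s with s ≟ f
          ... | yes _ = ≤-trans (ind≤1 _) (m≤m+n 1 _)
          ... | no ne = ind-mono λ e → case ∧-true {g s} e of λ { (gs , bs) → ∧-intro gs (other ne bs) }
          A⊆ : ∀ s → A n s ≡ true → without (class F₀ i) f s ≡ true
          A⊆ s e with ∧-true {class F₀ i s} e
          ... | cl , z = without-intro _ cl λ { refl → lem z }
            where
            lem : loose f ∨ below n f ≡ true → ⊥
            lem z rewrite ef | below-false {k = n} {f} (≤-reflexive (sym tof)) = case z of λ ()
          merge : reps (R? (suc n)) < reps (R? n)
          merge = reps-merge (R? n) (R? (suc n)) con-equiv con-equiv (con-mono A-step)
            (con-link f (∧-intro cf (subst (λ e → e ∨ below (suc n) f ≡ true) (sym ef)
              (below-intro {k = suc n} {f} (s≤s (≤-reflexive tof))))))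
            (λ c → forest valid₀ (isColor⇒ cf) (con-mono A⊆ c))

    rigid : ℕ
    rigid = count (not ∘ loose)

    -- A rigid hyperedge is coloured, since an uncoloured one is freeable without any move. It
    -- remains to sum `fixed i < q` over the colours.
    rigid-bound : Fin nV → rigid + m ≤ m * q
    rigid-bound x₀ = ≤-trans (+-mono-≤ (≤-trans (sum-mono some) (≤-reflexive (∑-comm (λ s i → ind (class F₀ i s ∧ not (loose s))))))
        (≤-trans (≤-reflexive (sym (*-identityʳ m))) (n*c≤sum {m} {λ _ → 1} 1 λ _ → ≤-refl)))
      (≤-trans (≤-reflexive (sym (∑-distrib-+ fixed (λ _ → 1))))
        (sum≤n*c q λ i → ≤-trans (≤-reflexive (+-comm (fixed i) 1)) (fixed<q x₀ i)))
      where
      some : ∀ s → ind (not (loose s)) ≤ sum (λ i → ind (class F₀ i s ∧ not (loose s)))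
      some s with loose s in es
      ... | true = z≤n
      ... | false with col F₀ s in cs
      ...   | nothing = ⊥-elim (true≢false (dec-true (freeable? s) (F₀ , base , cs)) es)
      ...   | just i = ≤-trans (≤-reflexive (cong ind (sym (∧-intro (⇒isColor {c = just i} {i} refl) refl))))
                (term≤sum (λ i′ → ind (isColor (just i) i′ ∧ true)) i)

    module Count (k : ℕ) (conn : Connected h k ℓ) (3m≤k : 3 * m ≤ k)
      (small : ∀ s → count (λ j → ℓ j == s) ≤ 3) where

      Xρ : Fin nV → Fin nV → Bool
      Xρ ρ x = does (∼? x ρ)

      meets? : ∀ ρ s → Dec (∃ λ j → ℓ j ≡ s × (h j ∼[ zero ] ρ))
      meets? ρ s = any? λ j → (ℓ j ≟ s) ×-dec ∼? (h j) ρ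

      -- A loose block lies within one class and goes along with it. Rigid blocks are always put
      -- outside, so that a half-edge of one is cut only at the class of its own vertex.
      Yρ : Fin nV → Fin nL → Bool
      Yρ ρ s = loose s ∧ does (meets? ρ s)

      loose-uncut : ∀ ρ j → loose (ℓ j) ≡ true → Xρ ρ (h j) xor Yρ ρ (ℓ j) ≡ false
      loose-uncut ρ j Es = go (∼? (h j) ρ)
        where
        go : Dec (h j ∼[ zero ] ρ) → Xρ ρ (h j) xor Yρ ρ (ℓ j) ≡ false
        go (yes r) = cong₂ _xor_ (dec-true (∼? (h j) ρ) r) (∧-intro Es (dec-true (meets? ρ (ℓ j)) (j , refl , r)))
        go (no ¬r) = cong₂ _xor_ (dec-false (∼? (h j) ρ) ¬r) (cong₂ _∧_ Es (dec-false (meets? ρ (ℓ j))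
          λ { (j′ , e , r) → ¬r (con-trans (loose-joined Es (j , refl , refl) (j′ , e , refl) zero) r) }))

      isRep : Fin nV → Bool
      isRep ρ = does (rep? ∼? ρ)

      rep-eq : ∀ {ρ ρ′} → isRep ρ ≡ true → isRep ρ′ ≡ true → ρ ∼[ zero ] ρ′ → ρ ≡ ρ′
      rep-eq r r′ = rep-unique ∼? con-equiv (does⇒ (rep? ∼? _) r) (does⇒ (rep? ∼? _) r′)

      boundary : Fin nV → Fin nJ → Bool
      boundary ρ j = isRep ρ ∧ (Xρ ρ (h j) xor Yρ ρ (ℓ j))

      lower : 2 ≤ q → q * k ≤ sum (λ ρ → count (boundary ρ))
      lower 2≤q = ≤-trans (≤-reflexive (trans (*-comm q k) (sym (sum-*-distribˡ k (ind ∘ isRep))))) (sum-mono each)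
        where
        each : ∀ ρ → k * ind (isRep ρ) ≤ count (boundary ρ)
        each ρ with isRep ρ in rr
        ... | false = ≤-trans (≤-reflexive (*-zeroʳ k)) z≤n
        ... | true with two≤count⇒other isRep 2≤q ρ
        ...   | ρ′ , ne , r′ = ≤-trans (≤-reflexive (*-identityʳ k)) (conn (Xρ ρ) (Yρ ρ)
                  ((ρ , dec-true (∼? ρ ρ) con-refl) ,
                   (ρ′ , dec-false (∼? ρ′ ρ) λ r → ne (rep-eq r′ rr r))))

      -- Every half-edge leaving a class lies in a rigid hyperedge, and these have at most three half-edges.
      upper : sum (λ ρ → count (boundary ρ)) ≤ 3 * rigid
      upper = ≤-trans (≤-reflexive (∑-comm (λ ρ j → ind (boundary ρ j)))) (≤-trans (sum-mono each-j)
        (≤-trans (≤-reflexive (∑-comm (λ j s → ind ((ℓ j == s) ∧ not (loose s)))))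
          (≤-trans (sum-mono each-s) (≤-reflexive (sum-*-distribˡ 3 (ind ∘ not ∘ loose))))))
        where
        each-s : ∀ s → sum (λ j → ind ((ℓ j == s) ∧ not (loose s))) ≤ 3 * ind (not (loose s))
        each-s s with loose s
        ... | true = ≤-reflexive (sum-zero λ j → cong ind (∧-zeroʳ (ℓ j == s)))
        ... | false = ≤-trans (count-mono {p = λ j → (ℓ j == s) ∧ true} {λ j → ℓ j == s} λ j → proj₁ ∘ ∧-true) (small s)
        each-j : ∀ j → sum (λ ρ → ind (boundary ρ j)) ≤ sum (λ s → ind ((ℓ j == s) ∧ not (loose s)))
        each-j j = go (loose (ℓ j)) refl
         where
         go : ∀ e → loose (ℓ j) ≡ e → sum (λ ρ → ind (boundary ρ j)) ≤ sum (λ s → ind ((ℓ j == s) ∧ not (loose s)))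
         go true es = ≤-trans (≤-reflexive (sum-zero λ ρ → cong ind (trans (cong (isRep ρ ∧_) (loose-uncut ρ j es)) (∧-zeroʳ (isRep ρ))))) z≤n
         go false es = ≤-trans (unique⇒count≤1 (λ ρ → boundary ρ j) uniq)
            (≤-trans (≤-reflexive (cong ind (sym (∧-intro (==-refl (ℓ j)) (cong not es)))))
              (term≤sum (λ s → ind ((ℓ j == s) ∧ not (loose s))) (ℓ j)))
          where
          near : ∀ ρ → Xρ ρ (h j) xor Yρ ρ (ℓ j) ≡ true → h j ∼[ zero ] ρ
          near ρ e = does⇒ (∼? (h j) ρ) (xor-false (cong (_∧ does (meets? ρ (ℓ j))) es) e)
          uniq : ∀ {ρ ρ′} → boundary ρ j ≡ true → boundary ρ′ j ≡ true → ρ ≡ ρ′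
          uniq {ρ} {ρ′} e e′ with ∧-true {isRep ρ} e | ∧-true {isRep ρ′} e′
          ... | r , n | r′ , n′ = rep-eq r r′ (con-trans (con-sym (near ρ n)) (near ρ′ n′))

      -- With a second class every boundary is a genuine cut, and
      -- `3 rigid + 3 m ≤ 3 m q ≤ k q ≤ 3 rigid` is absurd.
      q<2 : Fin nV → ¬ 2 ≤ q
      q<2 x₀ 2≤q = <⇒≱ {0} {3 * m} (s≤s z≤n)
        (+-cancelˡ-≤ (3 * rigid) (3 * m) 0 (≤-trans (≤-reflexive (sym (*-distribˡ-+ 3 rigid m)))
          (≤-trans (*-monoʳ-≤ 3 (rigid-bound x₀)) (≤-trans (≤-reflexive (sym (*-assoc 3 m q)))
            (≤-trans (*-monoˡ-≤ q 3m≤k) (≤-trans (≤-reflexive (*-comm k q))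
              (≤-trans (≤-trans (lower 2≤q) upper) (≤-reflexive (sym (+-identityʳ _))))))))))

      all-joined : ∀ i x y → x ∼[ i ] y
      all-joined i x y with has-rep ∼? con-equiv x | has-rep ∼? con-equiv y
      ... | u , xu , ru | w , yw , rw with u ≟ w
      ...   | yes refl = ∼-color zero i (con-trans xu (con-sym yw))
      ...   | no ne = contradiction (≤-trans (≤-reflexive (sym (trans (∑-distrib-+ (λ z → ind (z == u)) (λ z → ind (z == w)))
                (cong₂ _+_ (count-single u) (count-single w))))) (sum-mono two)) (q<2 x)
        where
        two : ∀ z → ind (z == u) + ind (z == w) ≤ ind (isRep z)
        two z with z ≟ u | z ≟ w
        ... | yes refl | yes refl = contradiction refl ne
        ... | yes refl | no _ = ≤-reflexive (cong ind (sym (dec-true (rep? ∼? z) ru)))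
        ... | no _ | yes refl = ≤-reflexive (cong ind (sym (dec-true (rep? ∼? z) rw)))
        ... | no _ | no _ = z≤n

      packing : ∃ λ (c : Fin nJ → Fin m) → Packs h ℓ c
      packing = c , λ i x y → con-into (isEquivalence _) (lem i) (all-joined i x y)
        where
        c : Fin nJ → Fin m
        -- Uncoloured hyperedges may take any colour, as further links do no harm.
        c j = fromMaybe zero (col F₀ (ℓ j))
        lem : ∀ i s → class F₀ i s ∧ loose s ≡ true → EqClosure (Monochromatic h ℓ c i) (a F₀ s) (b F₀ s)
        lem i s e with isColor⇒ (proj₁ (∧-true {class F₀ i s} e))
        ... | cs with trimmed valid₀ cs
        ...   | (j , js , ja) , (j′ , js′ , jb) = return (j , j′ , trans js (sym js′) , col≡ j js , col≡ j′ js′ , ja , jb)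
          where
          col≡ : ∀ j → ℓ j ≡ s → c j ≡ i
          col≡ j refl = cong (fromMaybe zero) cs

  -- Starting from the empty state, pass to a larger valid state as long as there is one; `size` is
  -- at most `nL`. The double negation comes from deciding `Freeable` classically.
  small-blocks-pack : ∀ k → Connected h k ℓ → 3 * m ≤ k → (∀ s → count (λ j → ℓ j == s) ≤ 3) →
    Fin nV → ¬ ¬ (∃ λ (c : Fin nJ → Fin m) → Packs h ℓ c)
  small-blocks-pack k conn 3m≤k small x₀ no-pack = improve nL (state (λ _ → nothing) (λ _ → x₀) (λ _ → x₀))
    (record { trimmed = λ () ; forest = λ () }) (m≤n+m nL _)
    where
    improve : ∀ n F → Valid F → nL ≤ size F + n → ⊥
    improve n F v fuel = ¬¬-∀Fin (λ s → ¬¬-em) λ D → no-pack (Maximal.Count.packing F v (mx n fuel) D k conn 3m≤k small)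
      where
      mx : ∀ n → nL ≤ size F + n → ∀ F′ → Valid F′ → ¬ (size F < size F′)
      mx zero fuel F′ v′ lt = <⇒≱ lt (≤-trans (count≤n _) (≤-trans fuel (≤-reflexive (+-identityʳ _))))
      mx (suc n) fuel F′ v′ lt = improve n F′ v′ (≤-trans fuel (≤-trans (≤-reflexive (+-suc (size F) n)) (+-monoˡ-≤ n lt)))

-- Reduction to blocks of at most three half-edges

third-member : ∀ {n} (p : Fin n → Bool) → 3 ≤ count p → ∀ i j → ∃ λ l → p l ≡ true × l ≢ i × l ≢ j
third-member p 3≤ i j with any? (λ l → (p l ≟ᵇ true) ×-dec ¬? (l ≟ i) ×-dec ¬? (l ≟ j))
... | yes w = w
... | no ¬w = contradiction (≤-trans 3≤ (≤-trans (sum-mono lem) (≤-reflexive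
    (trans (∑-distrib-+ (λ l → ind (l == i)) _) (cong₂ _+_ (count-single i) (count-single j)))))) λ { (s≤s (s≤s ())) }
  where
  lem : ∀ l → ind (p l) ≤ ind (l == i) + ind (l == j)
  lem l with p l in pl | l ≟ i | l ≟ j
  ... | false | _ | _ = z≤n
  ... | true | yes _ | _ = s≤s z≤n
  ... | true | no _ | yes _ = s≤s z≤n
  ... | true | no l≢i | no l≢j = contradiction (l , pl , l≢i , l≢j) ¬w

module Detach {nV nJ nL} (h : Fin nJ → Fin nV) (ℓ : Fin nJ → Fin nL) (s : Fin nL) (k : ℕ)
  (conn : Connected h k ℓ) {jA jB : Fin nJ} (A∈s : ℓ jA ≡ s) (B∈s : ℓ jB ≡ s)
  (ℓ′ : Fin nJ → Fin (suc nL)) (newA : ℓ′ jA ≡ zero) (newB : ℓ′ jB ≡ zero)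
  (keep : ∀ j → j ≢ jA → j ≢ jB → ℓ′ j ≡ suc (ℓ j)) where

  open Block h ℓ s k

  module _ (X : Fin nV → Bool) (Y′ : Fin (suc nL) → Bool) (sep : Nonconst X)
    (off : Y′ (suc s) ≡ false) (bad : cut h ℓ′ X Y′ < k) where

    old new : Fin nJ → ℕ
    old j = ind (X (h j) xor Y′ (suc (ℓ j)))
    new j = ind (X (h j) xor Y′ (ℓ′ j))

    -- If `X` missed `h jA`, the old cut would be no larger than the new one: what `jB` may save by
    -- its new block, `jA` pays. The tags book this exchange by adding the same amount at `jA` on
    -- the left and at `jB` on the right.
    meets : X (h jA) ≡ true
    meets with X (h jA) in xA
    ... | true = refl
    ... | false = contradiction (≤-trans (conn X (Y′ ∘ suc) sep) (+-cancelʳ-≤ (ind (Y′ zero)) _ _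
        (subst₂ _≤_ (trans (∑-distrib-+ old (λ j → tag jA j)) (cong (sum old +_) (tag-sum jA)))
                    (trans (∑-distrib-+ new (λ j → tag jB j)) (cong (sum new +_) (tag-sum jB)))
          (sum-mono lem)))) (<⇒≱ bad)
      where
      tag : Fin nJ → Fin nJ → ℕ
      tag j₀ j = ind (Y′ zero ∧ (j == j₀))
      tag-sum : ∀ j₀ → sum (tag j₀) ≡ ind (Y′ zero)
      tag-sum j₀ with Y′ zero
      ... | true = count-single j₀
      ... | false = sum-zero {nJ} λ _ → refl
      atA : old jA ≡ 0
      atA rewrite xA | A∈s | off = refl
      at-B : ∀ x y → ind (x xor false) ≤ ind (x xor y) + ind (y ∧ true)
      at-B true true = ≤-refl
      at-B true false = ≤-refl
      at-B false y = z≤n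
      lem : ∀ j → old j + tag jA j ≤ new j + tag jB j
      lem j with j ≟ jA | j ≟ jB
      ... | yes refl | yes refl = +-monoˡ-≤ _ (≤-trans (≤-reflexive atA) z≤n)
      ... | yes refl | no _ = ≤-trans (+-monoˡ-≤ _ (≤-reflexive atA)) (≤-trans (≤-reflexive e) (m≤m+n _ _))
        where
        e : ind (Y′ zero ∧ true) ≡ new jA
        e rewrite xA | newA with Y′ zero
        ... | true = refl
        ... | false = refl
      ... | no _ | yes refl rewrite B∈s | off | newB | ∧-zeroʳ (Y′ zero) =
        ≤-trans (≤-reflexive (+-identityʳ _)) (at-B (X (h jB)) (Y′ zero))
      ... | no nA | no nB rewrite keep j nA nB = ≤-refl

    -- Only `jA` and `jB` change their blocks, each contributing at most one, so the old cut is at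
    -- most `(k - 1) + 2`.
    small : cut h ℓ X (Y′ ∘ suc) ≤ suc k
    small = ≤-trans (sum-mono lem) (≤-trans (≤-reflexive (trans (∑-distrib-+ new _)
        (cong (sum new +_) (trans (∑-distrib-+ (λ j → ind (j == jA)) _) (cong₂ _+_ (count-single jA) (count-single jB))))))
      (≤-trans (≤-reflexive (+-comm (sum new) 2)) (s≤s bad)))
      where
      lem : ∀ j → old j ≤ new j + (ind (j == jA) + ind (j == jB))
      lem j with j ≟ jA | j ≟ jB
      ... | yes _ | _ = ≤-trans (ind≤1 _) (≤-trans (s≤s z≤n) (m≤n+m _ (new j)))
      ... | no _ | yes _ = ≤-trans (ind≤1 _) (m≤n+m _ (new j))
      ... | no nA | no nB rewrite keep j nA nB = m≤m+n _ _

module _ {nV nJ : ℕ} (h : Fin nJ → Fin nV) where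

  -- The measure that makes splitting off terminate: a third half-edge of the block ceases to share
  -- it with the detached pair.
  pairs : ∀ {nL} → (Fin nJ → Fin nL) → ℕ
  pairs ℓ = sum (λ j → count (λ j′ → ℓ j == ℓ j′))

  module _ {nL} (ℓ : Fin nJ → Fin nL) {j₁ j₂ : Fin nJ} where

    detach-first : detach h ℓ j₁ j₂ j₁ ≡ zero
    detach-first with j₁ ≟ j₁ | j₁ ≟ j₂
    ... | yes _ | _ = refl
    ... | no ne | _ = contradiction refl ne

    detach-second : detach h ℓ j₁ j₂ j₂ ≡ zero
    detach-second with j₂ ≟ j₁ | j₂ ≟ j₂
    ... | yes _ | _ = refl
    ... | no _ | yes _ = refl
    ... | no _ | no ne = contradiction refl ne

    detach-keep : ∀ j → j ≢ j₁ → j ≢ j₂ → detach h ℓ j₁ j₂ j ≡ suc (ℓ j)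
    detach-keep j n₁ n₂ with j ≟ j₁ | j ≟ j₂
    ... | yes e | _ = contradiction e n₁
    ... | no _ | yes e = contradiction e n₂
    ... | no _ | no _ = refl

    detach-refines : ∀ {s} → ℓ j₁ ≡ s → ℓ j₂ ≡ s → ∀ {i j} → detach h ℓ j₁ j₂ i ≡ detach h ℓ j₁ j₂ j → ℓ i ≡ ℓ j
    detach-refines e₁ e₂ {i} {j} e with i ≟ j₁ | i ≟ j₂ | j ≟ j₁ | j ≟ j₂
    ... | yes refl | _ | yes refl | _ = refl
    ... | yes refl | _ | no _ | yes refl = trans e₁ (sym e₂)
    ... | no _ | yes refl | yes refl | _ = trans e₂ (sym e₁)
    ... | no _ | yes refl | no _ | yes refl = refl
    ... | no _ | no _ | no _ | no _ = suc-injective e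
    ... | yes refl | _ | no _ | no _ = case e of λ ()
    ... | no _ | yes refl | no _ | no _ = case e of λ ()
    ... | no _ | no _ | yes refl | _ = case e of λ ()
    ... | no _ | no _ | no _ | yes refl = case e of λ ()

  -- At a block with at least four half-edges, a pair in no dangerous set can be detached, and the
  -- recursion supplies a packing. If there were none, all pairs would be blocked, against
  -- `Stuck.stuck`.
  pack : ∀ {nL} (ℓ : Fin nJ → Fin nL) k m₀ → Connected h k ℓ → 2 ≤ k → 3 * suc m₀ ≤ k → Fin nV →
    ¬ ¬ (∃ λ (c : Fin nJ → Fin (suc m₀)) → Packs h ℓ c)
  pack ℓ k m₀ conn 2≤k 3m≤k x₀ = go ℓ conn (<-wellFounded (pairs ℓ))
    where
    go : ∀ {nL} (ℓ : Fin nJ → Fin nL) → Connected h k ℓ → Acc _<_ (pairs ℓ) →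
      ¬ ¬ (∃ λ (c : Fin nJ → Fin (suc m₀)) → Packs h ℓ c)
    go {nL} ℓ conn (acc rs) no-pack with all? (λ s → count (λ j → ℓ j == s) ≤? 3)
    ... | yes all-small = Hypergraph.small-blocks-pack h ℓ m₀ k conn 3m≤k all-small x₀ no-pack
    ... | no ¬small with ¬∀⟶∃¬ nL _ (λ s → count (λ j → ℓ j == s) ≤? 3) ¬small
    ...   | s , ¬3 = Stuck.stuck conn 2≤k (≰⇒> ¬3) blocked
      where
      open Block h ℓ s k
      blocked : ∀ j₁ j₂ → at j₁ ≡ true → at j₂ ≡ true → j₁ ≢ j₂ →
        ¬ ¬ (∃ λ Z → Dangerous Z × Z ∋ j₁ ≡ true × Z ∋ j₂ ≡ true)
      blocked j₁ j₂ a₁ a₂ _ safe = go ℓ′ conn′ (rs smaller) λ { (c , p) → no-pack (c , λ i x y → eq-map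
          (λ { (j , j′ , e , rest) → j , j′ , detach-refines ℓ (==⇒≡ a₁) (==⇒≡ a₂) e , rest }) (p i x y)) }
        where
        ℓ′ = detach h ℓ j₁ j₂
        module D₁ = Detach h ℓ s k conn (==⇒≡ a₁) (==⇒≡ a₂) ℓ′ (detach-first ℓ) (detach-second ℓ {j₁}) (detach-keep ℓ)
        module D₂ = Detach h ℓ s k conn (==⇒≡ a₂) (==⇒≡ a₁) ℓ′ (detach-second ℓ {j₁}) (detach-first ℓ)
          (λ j n₂ n₁ → detach-keep ℓ j n₁ n₂)
        conn-off : ∀ X Y′ → Nonconst X → Y′ (suc s) ≡ false → k ≤ cut h ℓ′ X Y′
        conn-off X Y′ sep o = ≮⇒≥ λ bad → safe (side X (Y′ ∘ suc) o ,
          record { separates = sep ; small = D₁.small X Y′ sep o bad } , D₁.meets X Y′ sep o bad , D₂.meets X Y′ sep o bad)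
        xor-not : ∀ x y → ind (not x xor not y) ≤ ind (x xor y)
        xor-not true true = ≤-refl
        xor-not true false = ≤-refl
        xor-not false true = ≤-refl
        xor-not false false = ≤-refl
        conn′ : Connected h k ℓ′
        conn′ X Y′ sep@((u , xu) , (w , xw)) with Y′ (suc s) in eq
        ... | false = conn-off X Y′ sep eq
        -- Complementing both sides leaves the cut as it is and takes the block `s` off the chosen
        -- side.
        ... | true = ≤-trans (conn-off (not ∘ X) (not ∘ Y′) ((w , cong not xw) , (u , cong not xu)) (cong not eq))
          (sum-mono λ j → xor-not (X (h j)) (Y′ (ℓ′ j)))
        refine : ∀ i j → (ℓ′ i == ℓ′ j) ≡ true → (ℓ i == ℓ j) ≡ true
        refine i j e = subst (λ z → (ℓ i == z) ≡ true) (detach-refines ℓ (==⇒≡ a₁) (==⇒≡ a₂) (==⇒≡ e)) (==-refl (ℓ i))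
        smaller : pairs ℓ′ < pairs ℓ
        smaller with third-member at (≤-trans (n≤1+n 3) (≰⇒> ¬3)) j₁ j₂
        ... | j₃ , a₃ , n₁ , n₂ = sum-mono-< (λ i → count-mono (refine i)) j₁
          (sum-mono-< (λ j → ind-mono (refine j₁ j)) j₃
            (subst₂ (λ b c → ind b < ind c) (sym (≢⇒==-false apart)) (sym (trans (cong (ℓ j₁ ==_) same) (==-refl (ℓ j₁)))) ≤-refl))
          where
          apart : ℓ′ j₁ ≢ ℓ′ j₃
          apart e = case trans (sym (detach-first ℓ {j₁} {j₂})) (trans e (detach-keep ℓ j₃ n₁ n₂)) of λ ()
          same : ℓ j₃ ≡ ℓ j₁
          same = trans (==⇒≡ a₃) (sym (==⇒≡ a₁))

-- Cuts of a multigraph whose line graph is highly connected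

lookup-injective : ∀ {A : Set} {xs : List A} → Unique xs → ∀ i j → lookup xs i ≡ lookup xs j → i ≡ j
lookup-injective (x∉xs ∷ u) zero    zero    e = refl
lookup-injective {xs = x ∷ xs} (x∉xs ∷ u) zero    (suc j) e = contradiction e (All.lookup x∉xs (∈-lookup j))
lookup-injective {xs = x ∷ xs} (x∉xs ∷ u) (suc i) zero    e = contradiction (sym e) (All.lookup x∉xs (∈-lookup i))
lookup-injective (x∉xs ∷ u) (suc i) (suc j) e = cong suc (lookup-injective u i j e)

∣tabulate∣ : ∀ {n} (p : Fin n → Bool) → ∣ Vec.tabulate p ∣ ≡ count p
∣tabulate∣ {zero}  p = refl
∣tabulate∣ {suc n} p with p zero
... | true  = cong suc (∣tabulate∣ (p ∘ suc))
... | false = ∣tabulate∣ (p ∘ suc)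

false⇒∉ : ∀ {n} {p : Fin n → Bool} {x} → p x ≡ false → x ∉ Vec.tabulate p
false⇒∉ {p = p} {x} px x∈ = true≢false (trans (sym (lookup∘tabulate p x)) ([]=⇒lookup x∈)) px

∉⇒false : ∀ {n} {p : Fin n → Bool} {x} → x ∉ Vec.tabulate p → p x ≡ false
∉⇒false {p = p} {x} x∉ = ¬true⇒false λ px → x∉ (lookup⇒[]= x (Vec.tabulate p) (trans (lookup∘tabulate p x) px))

reach-map : ∀ {G P Q u w} → (∀ {z} → P z → Q z) → Reach G P u w → Reach G Q u w
reach-map f (here p)     = here (f p)
reach-map f (step p a r) = step (f p) a (reach-map f r)

reach-start : ∀ {G P u w} → Reach G P u w → P u
reach-start (here p)     = p
reach-start (step p _ _) = p

module Multigraph {v e : ℕ} (a b : Fin e → Fin v) where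

  End : Fin e → Fin v → Set
  End i x = (a i ≡ x) ⊎ (b i ≡ x)

  end? : ∀ i x → Dec (End i x)
  end? i x = (a i ≟ x) ⊎-dec (b i ≟ x)

  incident : Fin v → Fin e → Bool
  incident x i = does (end? i x)

  degree : Fin v → ℕ
  degree x = count (incident x)

  Share : Fin e → Fin e → Set
  Share i j = ∃ λ x → End i x × End j x

  ends-con : ∀ {A i x y} → A i ≡ true → End i x → End i y → Con a b A x y
  ends-con Ai (inj₁ refl) (inj₁ refl) = con-refl
  ends-con Ai (inj₁ refl) (inj₂ refl) = con-link _ Ai
  ends-con Ai (inj₂ refl) (inj₁ refl) = con-sym (con-link _ Ai)
  ends-con Ai (inj₂ refl) (inj₂ refl) = con-refl

module Cuts (G : Graph) {v : ℕ} (a b : Fin (n G) → Fin v)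
  (share : ∀ {i j} → Adj G i j → Multigraph.Share a b i j) (k : ℕ) (kc : KConnected k G) where

  open Multigraph a b

  avoid : ∀ (S : Fin (n G) → Bool) → count S < k → ∀ {i j} → S i ≡ false → S j ≡ false →
    Reach G (λ z → S z ≡ false) i j
  avoid S small Si Sj = reach-map ∉⇒false
    (proj₂ kc (Vec.tabulate S) (subst (_< k) (sym (∣tabulate∣ S)) small) _ _ (false⇒∉ Si) (false⇒∉ Sj))

  -- A smaller cut `S` cannot contain the star of `u` or of `w`, so some edge lies inside each side.
  -- Removing `S` from `G` does not separate these two edges, but a path in `G` avoiding `S` never
  -- changes sides.
  cut-bound : ∀ kk → kk ≤ k → ∀ (X : Fin v → Bool) {u w} → kk ≤ degree u → kk ≤ degree w →
    X u ≡ true → X w ≡ false → kk ≤ count (λ i → X (a i) xor X (b i))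
  cut-bound kk kk≤k X {u} {w} du dw Xu Xw = ≮⇒≥ contra
    where
    S : Fin (n G) → Bool
    S i = X (a i) xor X (b i)
    xor-≢ : ∀ {p q} → p ≢ q → p xor q ≡ true
    xor-≢ {true}  {true}  ne = contradiction refl ne
    xor-≢ {true}  {false} ne = refl
    xor-≢ {false} {true}  ne = refl
    xor-≢ {false} {false} ne = contradiction refl ne
    -- Without an edge inside the side of x, the whole star of x lies in the cut.
    star≤ : ∀ {x c} → X x ≡ c → ¬ (∃ λ i → X (a i) ≡ c × X (b i) ≡ c) → degree x ≤ count S
    star≤ {x} {c} Xx none = count-mono λ i inc → lem i (does⇒ (end? i x) inc)
      where
      lem : ∀ i → End i x → S i ≡ true
      lem i (inj₁ refl) = xor-≢ λ eq → none (i , Xx , trans (sym eq) Xx)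
      lem i (inj₂ refl) = xor-≢ λ eq → none (i , trans eq Xx , Xx)
    inner? : ∀ c → Dec (∃ λ i → X (a i) ≡ c × X (b i) ≡ c)
    inner? c = any? λ i → (X (a i) ≟ᵇ c) ×-dec (X (b i) ≟ᵇ c)
    uncut : ∀ {p q c} → p ≡ c → q ≡ c → p xor q ≡ false
    uncut {true} refl refl = refl
    uncut {false} refl refl = refl
    xor-eq : ∀ {p q} → p xor q ≡ false → p ≡ q
    xor-eq {true} {true} _ = refl
    xor-eq {false} {false} _ = refl
    side-end : ∀ {i x} → S i ≡ false → End i x → X (a i) ≡ X x
    side-end s (inj₁ refl) = refl
    side-end s (inj₂ refl) = xor-eq s
    same-side : ∀ {i j} → Reach G (λ z → S z ≡ false) i j → X (a i) ≡ X (a j)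
    same-side (here _) = refl
    same-side (step s adj r) with share adj
    ... | x , ix , jx = trans (trans (side-end s ix) (sym (side-end (reach-start r) jx))) (same-side r)
    contra : count S < kk → ⊥
    contra small with inner? true | inner? false
    ... | no none | _ = <⇒≱ small (≤-trans du (star≤ Xu none))
    ... | yes _ | no none = <⇒≱ small (≤-trans dw (star≤ Xw none))
    ... | yes (i , ai , bi) | yes (j , aj , bj) =
      true≢false ai (trans (same-side (avoid S (≤-trans small kk≤k) (uncut ai bi) (uncut aj bj))) aj)

  -- Otherwise the edges meeting i form a separator of G with fewer than k vertices.
  high-end : ∀ kk → kk + kk ≤ k + 3 → ∀ i → kk ≤ degree (a i) ⊎ kk ≤ degree (b i)
  high-end kk 2kk≤ i with kk ≤? degree (a i) | kk ≤? degree (b i)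
  ... | yes p | _ = inj₁ p
  ... | no _ | yes p = inj₂ p
  ... | no ¬p | no ¬q = contradiction (proj₁ kc) (≤⇒≯ n≤k)
    where
    S : Fin (n G) → Bool
    S j = (incident (a i) j ∨ incident (b i) j) ∧ not (j == i)
    S+2 : count S + 2 ≤ degree (a i) + degree (b i)
    S+2 = subst₂ _≤_
      (trans (∑-distrib-+ (ind ∘ S) (λ j → ind (j == i) + ind (j == i)))
        (cong (count S +_) (trans (∑-distrib-+ (λ j → ind (j == i)) _) (cong₂ _+_ (count-single i) (count-single i)))))
      (∑-distrib-+ (ind ∘ incident (a i)) _) (sum-mono lem)
      where
      or≤ : ∀ p q → ind ((p ∨ q) ∧ true) + 0 ≤ ind p + ind q
      or≤ true q = s≤s z≤n
      or≤ false true = ≤-refl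
      or≤ false false = ≤-refl
      lem : ∀ j → ind (S j) + (ind (j == i) + ind (j == i)) ≤ ind (incident (a i) j) + ind (incident (b i) j)
      lem j with j ≟ i
      ... | no _ = or≤ (incident (a i) j) (incident (b i) j)
      ... | yes refl rewrite dec-true (end? i (a i)) (inj₁ refl) | dec-true (end? i (b i)) (inj₂ refl) = ≤-refl
    -- The edge `i` is counted in both degrees, so `count S` is at most `2 (kk - 1) - 2`, which is
    -- below `k` exactly when `kk + kk ≤ k + 3`.
    S<k : count S < k
    S<k = s≤s⁻¹ (+-cancelʳ-≤ 2 _ _ (≤-trans (s≤s (s≤s S+2))
      (≤-trans (≤-trans (≤-reflexive (cong suc (sym (+-suc (degree (a i)) _)))) (+-mono-≤ (≰⇒> ¬p) (≰⇒> ¬q)))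
        (≤-trans 2kk≤ (≤-reflexive (+-suc k 2))))))
    isolated : ∀ {j} → Reach G (λ z → S z ≡ false) i j → i ≡ j
    isolated (here _) = refl
    isolated (step {w = z} _ adj r) with share adj
    ... | x , ix , zx = contradiction (reach-start r) λ Sz → true≢false (∧-intro (hit ix zx) (cong not (≢⇒==-false z≢i))) Sz
      where
      z≢i : z ≢ i
      z≢i refl = adj-irr G adj
      hit : End i x → End z x → incident (a i) z ∨ incident (b i) z ≡ true
      hit (inj₁ refl) zx rewrite dec-true (end? z (a i)) zx = refl
      hit (inj₂ refl) zx rewrite dec-true (end? z (b i)) zx with incident (a i) z
      ... | true = refl
      ... | false = refl
    Si : S i ≡ false
    Si rewrite ==-refl i with incident (a i) i ∨ incident (b i) i
    ... | true = refl
    ... | false = refl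
    -- Outside `S` the vertex `i` reaches only itself, hence `S` and `i` are all of `G`.
    covers : ∀ j → 1 ≤ ind (S j) + ind (j == i)
    covers j with S j in Sj
    ... | true = s≤s z≤n
    ... | false = ≤-reflexive (cong ind (sym (trans (cong (_== i) (sym (isolated (avoid S S<k Si Sj)))) (==-refl i))))
    n≤k : n G ≤ k
    n≤k = ≤-trans (≤-reflexive (sym (*-identityʳ (n G)))) (≤-trans (n*c≤sum 1 covers)
      (≤-trans (≤-reflexive (trans (∑-distrib-+ (ind ∘ S) _) (cong (count S +_) (count-single i))))
        (≤-trans (≤-reflexive (+-comm (count S) 1)) S<k)))

-- From half-edges back to the multigraph

module TreePacking {v e : ℕ} (a b : Fin e → Fin v) (kk : ℕ)
  (high-end : ∀ i → kk ≤ Multigraph.degree a b (a i) ⊎ kk ≤ Multigraph.degree a b (b i))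
  (cut-bound : ∀ (X : Fin v → Bool) {u w} → kk ≤ Multigraph.degree a b u → kk ≤ Multigraph.degree a b w →
    X u ≡ true → X w ≡ false → kk ≤ count (λ i → X (a i) xor X (b i))) where

  open Multigraph a b

  high? : ∀ x → Dec (kk ≤ degree x)
  high? x = kk ≤? degree x

  highs : List (Fin v)
  highs = filter high? (allFin v)

  q : ℕ
  q = length highs

  vtx : Fin q → Fin v
  vtx = lookup highs

  vtx-high : ∀ i → kk ≤ degree (vtx i)
  vtx-high i = proj₂ (∈-filter⁻ high? {xs = allFin v} (∈-lookup {xs = highs} i))

  vtx-injective : ∀ i j → vtx i ≡ vtx j → i ≡ j
  vtx-injective = lookup-injective (Unique.filter⁺ high? (Unique.allFin⁺ v))

  high-index : ∀ {x} → kk ≤ degree x → ∃ λ i → vtx i ≡ x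
  high-index {x} d = index x∈ , sym (lookup-index x∈)
    where
    x∈ : x ∈ highs
    x∈ = ∈-filter⁺ high? (∈-allFin x) d

  classify : ∀ x → (∃ λ i → vtx i ≡ x) ⊎ ¬ (kk ≤ degree x)
  classify x with high? x
  ... | yes d = inj₁ (high-index d)
  ... | no ¬d = inj₂ ¬d

  L : ℕ
  L = e + v

  -- The blocks are the edges (as i ↑ˡ v) and the vertices of low degree (as e ↑ʳ x). An edge between two
  -- high vertices has both half-edges in its own block; an edge with a low end has one half-edge in the
  -- block of that end, and a second, junk one that is alone in the block of the edge.
  record Halves (i : Fin e) : Set where
    field
      h₁ h₂ : Fin q
      l₁    : Fin L
      end₁  : End i (vtx h₁)
      end₂  : End i (vtx h₂)
      kind  : l₁ ≡ i ↑ˡ v ⊎ (∃ λ x → l₁ ≡ e ↑ʳ x × End i x)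
      cuts  : ∀ (X : Fin v → Bool) (X′ : Fin q → Bool) (Y : Fin L → Bool) →
        (∀ p → X (vtx p) ≡ X′ p) → (∀ x → ¬ kk ≤ degree x → X x ≡ Y (e ↑ʳ x)) →
        ind (X (a i) xor X (b i)) ≤ ind (X′ h₁ xor Y l₁) + ind (X′ h₂ xor Y (i ↑ˡ v))

  halves : ∀ i → Halves i
  halves i with classify (a i) | classify (b i)
  ... | inj₁ (p , pa) | inj₁ (p′ , pb) = record
    { h₁ = p ; h₂ = p′ ; l₁ = i ↑ˡ v ; end₁ = inj₁ (sym pa) ; end₂ = inj₂ (sym pb) ; kind = inj₁ refl
    ; cuts = λ X X′ Y hX lX → subst₂ (λ s t → ind (s xor t) ≤ _) (trans (sym (hX p)) (cong X pa)) (trans (sym (hX p′)) (cong X pb))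
        (triangle (X′ p) (X′ p′) (Y (i ↑ˡ v))) }
    where
    triangle : ∀ s t y → ind (s xor t) ≤ ind (s xor y) + ind (t xor y)
    triangle true true y = z≤n
    triangle true false true = ≤-refl
    triangle true false false = ≤-refl
    triangle false true true = ≤-refl
    triangle false true false = ≤-refl
    triangle false false y = z≤n
  ... | inj₁ (p , pa) | inj₂ low = record
    { h₁ = p ; h₂ = p ; l₁ = e ↑ʳ b i ; end₁ = inj₁ (sym pa) ; end₂ = inj₁ (sym pa) ; kind = inj₂ (b i , refl , inj₂ refl)
    ; cuts = λ X X′ Y hX lX → ≤-trans (≤-reflexive (cong₂ (λ s t → ind (s xor t)) (trans (cong X (sym pa)) (hX p)) (lX (b i) low)))
        (m≤m+n _ _) }
  ... | inj₂ low | inj₁ (p , pb) = record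
    { h₁ = p ; h₂ = p ; l₁ = e ↑ʳ a i ; end₁ = inj₂ (sym pb) ; end₂ = inj₂ (sym pb) ; kind = inj₂ (a i , refl , inj₁ refl)
    ; cuts = λ X X′ Y hX lX → ≤-trans (≤-reflexive (trans (cong₂ (λ s t → ind (s xor t)) (lX (a i) low) (trans (cong X (sym pb)) (hX p)))
        (cong ind (xor-comm (Y (e ↑ʳ a i)) (X′ p))))) (m≤m+n _ _) }
  ... | inj₂ ¬p | inj₂ ¬q = ⊥-elim ([ ¬p , ¬q ]′ (high-end i))

  module Half i = Halves (halves i)

  hh : Fin (e + e) → Fin q
  hh j = [ Half.h₁ , Half.h₂ ]′ (splitAt e j)

  ll : Fin (e + e) → Fin L
  ll j = [ Half.l₁ , (_↑ˡ v) ]′ (splitAt e j)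

  -- Placing each low vertex on the side of its block gives a cut of the multigraph, and by `cuts`
  -- every edge in it has a half-edge that is cut.
  half-connected : Connected hh kk ll
  half-connected X′ Y ((u , Xu) , (w , Xw)) = ≤-trans
    (cut-bound X (vtx-high u) (vtx-high w) (trans (hX u) Xu) (trans (hX w) Xw))
    (≤-trans (sum-mono λ i → Half.cuts i X X′ Y hX lX) (≤-reflexive (trans (∑-distrib-+ f g)
      (sym (trans (sum-++ e (λ j → ind (X′ (hh j) xor Y (ll j)))) (cong₂ _+_ (sum-cong-≗ fe) (sum-cong-≗ ge)))))))
    where
    X : Fin v → Bool
    X x = [ X′ ∘ proj₁ , (λ _ → Y (e ↑ʳ x)) ]′ (classify x)
    hX : ∀ p → X (vtx p) ≡ X′ p
    hX p with classify (vtx p)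
    ... | inj₁ (p′ , eq) = cong X′ (vtx-injective p′ p eq)
    ... | inj₂ low = contradiction (vtx-high p) low
    lX : ∀ x → ¬ kk ≤ degree x → X x ≡ Y (e ↑ʳ x)
    lX x low with classify x
    ... | inj₁ (p , refl) = contradiction (vtx-high p) low
    ... | inj₂ _ = refl
    f g : Fin e → ℕ
    f i = ind (X′ (Half.h₁ i) xor Y (Half.l₁ i))
    g i = ind (X′ (Half.h₂ i) xor Y (i ↑ˡ v))
    fe : ∀ i → ind (X′ (hh (i ↑ˡ e)) xor Y (ll (i ↑ˡ e))) ≡ f i
    fe i rewrite splitAt-↑ˡ e i e = refl
    ge : ∀ i → ind (X′ (hh (e ↑ʳ i)) xor Y (ll (e ↑ʳ i))) ≡ g i
    ge i rewrite splitAt-↑ʳ e e i = refl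

  ColorsJoin : ∀ {m} → (Fin e → Fin m) → Set
  ColorsJoin C = ∀ κ x y → Con a b (λ i → C i == κ) (vtx x) (vtx y)

  ↑ˡ≢↑ʳ : ∀ {i : Fin e} {x : Fin v} → i ↑ˡ v ≡ e ↑ʳ x → ⊥
  ↑ˡ≢↑ʳ {i} {x} eq with trans (sym (splitAt-↑ˡ e i v)) (trans (cong (splitAt e) eq) (splitAt-↑ʳ e v x))
  ... | ()

  module _ {m : ℕ} (c : Fin (e + e) → Fin m) where

    -- The first half-edge decides: the second is either junk or shares its block with the first
    -- alone, and a monochromatic pair of the two shows the same colour.
    edge-color : Fin e → Fin m
    edge-color i = c (i ↑ˡ e)

    data HalfEdge : Fin (e + e) → Set where
      first  : ∀ i → HalfEdge (i ↑ˡ e)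
      second : ∀ i → HalfEdge (e ↑ʳ i)

    half-edge : ∀ j → HalfEdge j
    half-edge j with splitAt e j in eq
    ... | inj₁ i = subst HalfEdge (splitAt⁻¹-↑ˡ eq) (first i)
    ... | inj₂ i = subst HalfEdge (splitAt⁻¹-↑ʳ {e} {e} eq) (second i)

    hh-first : ∀ i → hh (i ↑ˡ e) ≡ Half.h₁ i
    hh-first i rewrite splitAt-↑ˡ e i e = refl
    ll-first : ∀ i → ll (i ↑ˡ e) ≡ Half.l₁ i
    ll-first i rewrite splitAt-↑ˡ e i e = refl
    hh-second : ∀ i → hh (e ↑ʳ i) ≡ Half.h₂ i
    hh-second i rewrite splitAt-↑ʳ e e i = refl
    ll-second : ∀ i → ll (e ↑ʳ i) ≡ i ↑ˡ v
    ll-second i rewrite splitAt-↑ʳ e e i = refl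

    -- A monochromatic pair in the block of a low vertex is a path of two edges through that vertex;
    -- in the block of an edge it is that edge, or trivial.
    packs⇒join : Packs hh ll c → ColorsJoin edge-color
    packs⇒join packs κ x y = gfold con-equiv vtx
      (λ { (j , j′ , el , cj , cj′ , refl , refl) → mono (half-edge j) (half-edge j′) el cj cj′ }) (packs κ x y)
      where
      K : Fin v → Fin v → Set
      K = Con a b (λ i → edge-color i == κ)
      in-κ : ∀ {i} → c (i ↑ˡ e) ≡ κ → (edge-color i == κ) ≡ true
      in-κ refl = ==-refl κ
      first-second : ∀ i i′ → ll (i ↑ˡ e) ≡ ll (e ↑ʳ i′) → c (i ↑ˡ e) ≡ κ → K (vtx (hh (i ↑ˡ e))) (vtx (hh (e ↑ʳ i′)))
      first-second i i′ el ci rewrite ll-first i | ll-second i′ | hh-first i | hh-second i′ with Half.kind i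
      ... | inj₂ (x , eq , _) = ⊥-elim (↑ˡ≢↑ʳ (trans (sym el) eq))
      ... | inj₁ eq with ↑ˡ-injective v i i′ (trans (sym eq) el)
      ...   | refl = ends-con (in-κ ci) (Half.end₁ i) (Half.end₂ i)
      mono : ∀ {j j′} → HalfEdge j → HalfEdge j′ → ll j ≡ ll j′ → c j ≡ κ → c j′ ≡ κ → K (vtx (hh j)) (vtx (hh j′))
      mono (first i) (second i′) el ci ci′ = first-second i i′ el ci
      mono (second i) (first i′) el ci ci′ = con-sym (first-second i′ i (sym el) ci′)
      mono (second i) (second i′) el ci ci′ rewrite ll-second i | ll-second i′ with ↑ˡ-injective v i i′ el
      ... | refl = con-refl
      mono (first i) (first i′) el ci ci′ rewrite ll-first i | ll-first i′ | hh-first i | hh-first i′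
        with Half.kind i | Half.kind i′
      ... | inj₁ eq | inj₂ (_ , eq′ , _) = ⊥-elim (↑ˡ≢↑ʳ (trans (sym eq) (trans el eq′)))
      ... | inj₂ (_ , eq , _) | inj₁ eq′ = ⊥-elim (↑ˡ≢↑ʳ (trans (sym eq′) (trans (sym el) eq)))
      ... | inj₁ eq | inj₁ eq′ with ↑ˡ-injective v i i′ (trans (sym eq) (trans el eq′))
      ...   | refl = con-refl
      mono (first i) (first i′) el ci ci′ | inj₂ (x , eq , ix) | inj₂ (x′ , eq′ , ix′)
        with ↑ʳ-injective e x x′ (trans (sym eq) (trans el eq′))
      ...   | refl = con-trans (ends-con (in-κ ci) (Half.end₁ i) ix) (ends-con (in-κ ci′) ix′ (Half.end₁ i′))

  -- Colourings are coded by `finToFun` as elements of a finite set and `ColorsJoin` is decidable,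
  -- so a search turns the doubly negated packing into a colouring.
  packing : ∀ m₀ → 2 ≤ kk → 3 * suc m₀ ≤ kk → Fin q → ∃ λ (C : Fin e → Fin (suc m₀)) → ColorsJoin C
  packing m₀ 2≤kk 3m≤kk x₀ with any? (λ z → joins? (finToFun {suc m₀} {e} z))
    where
    joins? : ∀ C → Dec (ColorsJoin C)
    joins? C = all? λ κ → all? λ x → all? λ y → con? a b (λ i → C i == κ) (vtx x) (vtx y)
  ... | yes (z , J) = finToFun z , J
  ... | no ¬J = ⊥-elim (pack hh ll kk m₀ half-connected 2≤kk 3m≤kk x₀ λ { (c , p) →
    ¬J (funToFin (edge-color c) , λ κ x y → con-mono
      (λ i eq → trans (cong (_== κ) (finToFun-funToFin (edge-color c) i)) eq) (packs⇒join c p κ x y)) })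

  some-high : Fin e → Fin q
  some-high i = [ proj₁ ∘ high-index , proj₁ ∘ high-index ]′ (high-end i)

  edge-coloring : ∀ m₀ → 2 ≤ kk → 3 * suc m₀ ≤ kk → Fin e → ∃ λ (C : Fin e → Fin (suc m₀)) →
    ∀ κ {x y} → kk ≤ degree x → kk ≤ degree y → Con a b (λ i → C i == κ) x y
  edge-coloring m₀ 2≤kk 3m≤kk i with packing m₀ 2≤kk 3m≤kk (some-high i)
  ... | C , join = C , λ κ hx hy → lem κ (high-index hx) (high-index hy)
    where
    lem : ∀ κ {x y} → (∃ λ p → vtx p ≡ x) → (∃ λ p → vtx p ≡ y) → Con a b (λ i → C i == κ) x y
    lem κ (p , refl) (p′ , refl) = join κ p p′

  -- Every edge has a high end, so the stars of the high vertices cover all edges. Many edges thus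
  -- force many high vertices.
  edges≤ : ∀ D → (∀ z → degree z ≤ D) → e ≤ q * D
  edges≤ D degree≤D = ≤-trans (≤-reflexive (sym (*-identityʳ e))) (≤-trans (n*c≤sum 1 one)
    (≤-trans (≤-reflexive (∑-comm (λ i p → ind (incident (vtx p) i)))) (sum≤n*c D (degree≤D ∘ vtx))))
    where
    counted : ∀ {i x} → kk ≤ degree x → End i x → 1 ≤ sum (λ p → ind (incident (vtx p) i))
    counted {i} {x} hx ix with high-index hx
    ... | p , refl = true⇒count≥1 _ p (dec-true (end? i x) ix)
    one : ∀ i → 1 ≤ sum (λ p → ind (incident (vtx p) i))
    one i with high-end i
    ... | inj₁ h = counted h (inj₁ refl)
    ... | inj₂ h = counted h (inj₂ refl)

-- Monotone sequences and combs

length-filter-¬ : ∀ {A : Set} {P : A → Set} (P? : Decidable P) xs →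
  length (filter P? xs) + length (filter (¬? ∘ P?) xs) ≡ length xs
length-filter-¬ P? [] = refl
length-filter-¬ P? (x ∷ xs) with P? x
... | yes _ = cong suc (length-filter-¬ P? xs)
... | no _  = trans (+-suc _ _) (cong suc (length-filter-¬ P? xs))

-- An Erdős-Szekeres bound by a Pascal-like recursion, not the optimal product: the head extends an
-- increasing list of larger entries or a decreasing list of smaller ones.
ramsey : ℕ → ℕ → ℕ
ramsey zero    b       = 0
ramsey (suc a) zero    = 0
ramsey (suc a) (suc b) = suc (ramsey a (suc b) + ramsey (suc a) b)

_<ᶠ_ _>ᶠ_ : ∀ {n} → Fin n → Fin n → Set
x <ᶠ y = toℕ x < toℕ y
x >ᶠ y = toℕ y < toℕ x

monotone-sublist : ∀ {n} a b (ys : List (Fin n)) → Unique ys → ramsey a b ≤ length ys →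
  (∃ λ zs → zs ⊆ ys × AllPairs _<ᶠ_ zs × length zs ≡ a) ⊎ (∃ λ zs → zs ⊆ ys × AllPairs _>ᶠ_ zs × length zs ≡ b)
monotone-sublist zero b ys u len = inj₁ ([] , minimum ys , [] , refl)
monotone-sublist (suc a) zero ys u len = inj₂ ([] , minimum ys , [] , refl)
monotone-sublist (suc a) (suc b) (y ∷ ys) (y∉ys ∷ u) (s≤s len) with ramsey a (suc b) ≤? length (filter (λ x → toℕ y <? toℕ x) ys)
... | yes big = case monotone-sublist a (suc b) up (Unique.filter⁺ _ u) big of λ
    { (inj₁ (zs , zs⊆ , inc , l)) → inj₁ (y ∷ zs , refl ∷ ⊆-trans zs⊆ (filter-⊆ _ ys) , All-resp-⊆ zs⊆ (all-filter _ ys) ∷ inc , cong suc l)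
    ; (inj₂ (zs , zs⊆ , r)) → inj₂ (zs , y ∷ʳ ⊆-trans zs⊆ (filter-⊆ _ ys) , r) }
  where up = filter (λ x → toℕ y <? toℕ x) ys
... | no small = case monotone-sublist (suc a) b down (Unique.filter⁺ _ u) big of λ
    { (inj₁ (zs , zs⊆ , r)) → inj₁ (zs , y ∷ʳ ⊆-trans zs⊆ (filter-⊆ _ ys) , r)
    ; (inj₂ (zs , zs⊆ , dec , l)) → inj₂ (y ∷ zs , refl ∷ ⊆-trans zs⊆ (filter-⊆ _ ys) , All-resp-⊆ zs⊆ below-y ∷ dec , cong suc l) }
  where
  y<? = λ x → toℕ y <? toℕ x
  down = filter (¬? ∘ y<?) ys
  big : ramsey (suc a) b ≤ length down
  big = +-cancelˡ-≤ (ramsey a (suc b)) _ _ (≤-trans len (≤-trans (≤-reflexive (sym (length-filter-¬ y<? ys)))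
    (+-monoˡ-≤ _ (<⇒≤ (≰⇒> small)))))
  below-y : All (y >ᶠ_) down
  below-y = All.zipWith (λ { (¬lt , ne) → ≤∧≢⇒< (≮⇒≥ ¬lt) (λ e → ne (toℕ-injective (sym e))) })
    (all-filter (¬? ∘ y<?) ys , all-filter⁺ (¬? ∘ y<?) y∉ys)

-- Sorted lists have only one possible order, so membership gives the embedding. This restricts a
-- lane found earlier to a later selection.
increasing-⊆ : ∀ {n} {zs xs : List (Fin n)} → AllPairs _<ᶠ_ zs → AllPairs _<ᶠ_ xs → All (_∈ xs) zs → zs ⊆ xs
increasing-⊆ {xs = xs} [] _ [] = minimum xs
increasing-⊆ (z<zs ∷ zs↑) (x<xs ∷ xs↑) (here refl ∷ zs∈) =
  refl ∷ increasing-⊆ zs↑ xs↑ (All.zipWith (λ { (lt , here refl) → contradiction lt (<-irrefl refl) ; (_ , there m) → m }) (z<zs , zs∈))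
increasing-⊆ {xs = x ∷ xs} (z<zs ∷ zs↑) (x<xs ∷ xs↑) (there z∈ ∷ zs∈) =
  x ∷ʳ increasing-⊆ (z<zs ∷ zs↑) xs↑ (z∈ ∷ All.zipWith
    (λ { (lt , here refl) → contradiction (<-trans lt (All.lookup x<xs z∈)) (<-irrefl refl) ; (_ , there m) → m }) (z<zs , zs∈))

reverse-increasing : ∀ {n} (zs ys : List (Fin n)) → AllPairs _>ᶠ_ zs → AllPairs _<ᶠ_ ys →
  All (λ z → All (z <ᶠ_) ys) zs → AllPairs _<ᶠ_ (zs ʳ++ ys)
reverse-increasing [] ys _ ys↑ _ = ys↑
reverse-increasing (z ∷ zs) ys (z>zs ∷ zs↓) ys↑ (z<ys ∷ zs<ys) =
  reverse-increasing zs (z ∷ ys) zs↓ (z<ys ∷ ys↑) (All.zipWith (λ { (lt , l) → lt ∷ l }) (z>zs , zs<ys))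

all-ʳ++ : ∀ {A : Set} {P : A → Set} {xs ys} → All P xs → All P ys → All P (xs ʳ++ ys)
all-ʳ++ [] q = q
all-ʳ++ (p ∷ ps) q = all-ʳ++ ps (p ∷ q)

_⊑_ : ∀ {e} → (Fin e → Bool) → (Fin e → Bool) → Set
A ⊑ B = ∀ i → A i ≡ true → B i ≡ true

Disjoint : ∀ {e} → (Fin e → Bool) → (Fin e → Bool) → Set
Disjoint A B = ∀ i → A i ≡ true → B i ≡ true → ⊥

_∪_ : ∀ {e} → (Fin e → Bool) → (Fin e → Bool) → Fin e → Bool
(A ∪ B) i = A i ∨ B i

∪-case : ∀ {e} (A B : Fin e → Bool) i → (A ∪ B) i ≡ true → A i ≡ true ⊎ B i ≡ true
∪-case A B i eq with A i
... | true = inj₁ refl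
... | false = inj₂ eq

∪-left : ∀ {e} (A B : Fin e → Bool) → A ⊑ (A ∪ B)
∪-left A B i eq rewrite eq = refl

∪-right : ∀ {e} (A B : Fin e → Bool) → B ⊑ (A ∪ B)
∪-right A B i eq rewrite eq = ∨-zeroʳ (A i)

∪-least : ∀ {e} {A B C : Fin e → Bool} → A ⊑ C → B ⊑ C → (A ∪ B) ⊑ C
∪-least {A = A} {B} f g i eq with ∪-case A B i eq
... | inj₁ p = f i p
... | inj₂ p = g i p

-- One of at most `D` branches at a vertex has to keep `teeth D n` candidates. The 2 ensures that
-- some candidate differs from the root, so the walk cannot end there.
teeth : ℕ → ℕ → ℕ
teeth D zero    = 0
teeth D (suc n) = D * teeth D n + 2

-- For each colour a comb is found among the vertices left so far and its teeth are thinned to a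
-- monotone list, hence the nesting.
threshold : ∀ {C : Set} → ℕ → ℕ → List C → ℕ
threshold D n []       = n
threshold D n (c ∷ cs) = teeth D (ramsey (threshold D n cs) (threshold D n cs))

data At {A : Set} : List A → ℕ → A → Set where
  here  : ∀ {x xs} → At (x ∷ xs) 0 x
  there : ∀ {x y xs k} → At xs k x → At (y ∷ xs) (suc k) x

positive : ∀ {n} → 1 ≤ n → ∃ λ m → n ≡ suc m
positive (s≤s _) = _ , refl

module Combs {v e : ℕ} (a b : Fin e → Fin v) where

  open Multigraph a b

  -- A comb with root z and teeth xs: A₁ carries the first tooth and the passage to the rest of the comb.
  data Lane (A : Fin e → Bool) (z : Fin v) : List (Fin v) → Set where
    []   : Lane A z []
    cons : ∀ {A₁ A₂ z′ x xs} → A₁ ⊑ A → A₂ ⊑ A → Disjoint A₁ A₂ →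
      Con a b A₁ z x → Con a b A₁ z z′ → Lane A₂ z′ xs → Lane A z (x ∷ xs)

  lane-mono : ∀ {A B z xs} → A ⊑ B → Lane A z xs → Lane B z xs
  lane-mono A⊑B [] = []
  lane-mono A⊑B (cons s t d c c′ l) = cons (λ i → A⊑B i ∘ s i) (λ i → A⊑B i ∘ t i) d c c′ l

  lane-prepend : ∀ {A₁ A₂ B z z′ xs} → A₁ ⊑ B → A₂ ⊑ B → Disjoint A₁ A₂ → Con a b A₁ z z′ → Lane A₂ z′ xs → Lane B z xs
  lane-prepend s t d c [] = []
  lane-prepend {A₁} s t d c (cons {A₃} {A₄} s′ t′ d′ c₁ c₂ l) = cons {A₁ = A₁ ∪ A₃} {A₄}
    (∪-least s (λ i → t i ∘ s′ i)) (λ i → t i ∘ t′ i)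
    (λ i p q → case ∪-case A₁ A₃ i p of λ { (inj₁ r) → d i r (t′ i q) ; (inj₂ r) → d′ i r q })
    (con-trans (con-mono (∪-left A₁ A₃) c) (con-mono (∪-right A₁ A₃) c₁))
    (con-trans (con-mono (∪-left A₁ A₃) c) (con-mono (∪-right A₁ A₃) c₂)) l

  -- A dropped tooth leaves its passage behind, which becomes part of the next piece.
  lane-sublist : ∀ {A z xs zs} → zs ⊆ xs → Lane A z xs → Lane A z zs
  lane-sublist [] l = l
  lane-sublist (_ ∷ʳ σ) (cons s t d c c′ l) = lane-prepend s t d c′ (lane-sublist σ l)
  lane-sublist (refl ∷ σ) (cons s t d c c′ l) = cons s t d c c′ (lane-sublist σ l)

  -- Pieces are handed over one at a time. Walked backwards, a piece has root `z′`, reaches its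
  -- tooth through `z`, and its passage leads on to `z`.
  lane-ʳ++ : ∀ {A B D z xs ys} → A ⊑ D → B ⊑ D → Disjoint A B → Lane A z xs → Lane B z ys → ∃ λ z′ → Lane D z′ (xs ʳ++ ys)
  lane-ʳ++ s t d [] l = _ , lane-mono t l
  lane-ʳ++ {A} {B} s t d (cons {A₁} {A₂} s′ t′ d′ c c′ l) l′ =
    lane-ʳ++ {A₂} {A₁ ∪ B} (λ i → s i ∘ t′ i) (∪-least (λ i → s i ∘ s′ i) t)
      (λ i p q → case ∪-case A₁ B i q of λ { (inj₁ r) → d′ i r p ; (inj₂ r) → d i (t′ i p) r }) l
      (cons {A₁ = A₁} {B} (∪-left A₁ B) (∪-right A₁ B) (λ i p q → d i (s′ i p) q)
        (con-trans (con-sym c′) c) (con-sym c′) l′)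

  lane-reverse : ∀ {A z xs} → Lane A z xs → ∃ λ z′ → Lane A z′ (xs ʳ++ [])
  lane-reverse {A} l = lane-ʳ++ {B = λ _ → false} (λ _ p → p) (λ _ ()) (λ _ _ ()) l []

  degreeIn : (Fin e → Bool) → Fin v → ℕ
  degreeIn A z = count (λ i → A i ∧ incident z i)

  record EdgeAt (A : Fin e → Bool) (z : Fin v) : Set where
    field
      i     : Fin e
      w     : Fin v
      i∈A   : A i ≡ true
      z-end : End i z
      w-end : End i w
      via   : ∀ {x} → Con a b A z x → Con a b (without A i) z x ⊎ Con a b (without A i) w x

  edge-at? : ∀ A z → EdgeAt A z ⊎ (∀ x → Con a b A z x → z ≡ x)
  edge-at? A z with any? (λ i → (A i ≟ᵇ true) ×-dec end? i z)
  ... | no none = inj₂ lem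
    where
    lem : ∀ x → Con a b A z x → z ≡ x
    lem x ε = refl
    lem x (fwd (i , Ai , ai , bi) ◅ _) = contradiction (i , Ai , inj₁ ai) none
    lem x (bwd (i , Ai , ai , bi) ◅ _) = contradiction (i , Ai , inj₂ bi) none
  ... | yes (i , Ai , inj₁ ai) = inj₁ record { i = i ; w = b i ; i∈A = Ai ; z-end = inj₁ ai ; w-end = inj₂ refl ; via = via }
    where
    via : ∀ {x} → Con a b A z x → Con a b (without A i) z x ⊎ Con a b (without A i) (b i) x
    via c with con-without i c
    ... | inj₁ d = inj₁ d
    ... | inj₂ (inj₁ (_ , d)) = inj₂ d
    ... | inj₂ (inj₂ (_ , d)) = inj₁ (subst (λ y → Con a b (without A i) y _) ai d)
  ... | yes (i , Ai , inj₂ bi) = inj₁ record { i = i ; w = a i ; i∈A = Ai ; z-end = inj₂ bi ; w-end = inj₁ refl ; via = via }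
    where
    via : ∀ {x} → Con a b A z x → Con a b (without A i) z x ⊎ Con a b (without A i) (a i) x
    via c with con-without i c
    ... | inj₁ d = inj₁ d
    ... | inj₂ (inj₁ (_ , d)) = inj₁ (subst (λ y → Con a b (without A i) y _) bi d)
    ... | inj₂ (inj₂ (_ , d)) = inj₂ d

  degreeIn-without : ∀ {A z} (E : EdgeAt A z) → degreeIn (without A (EdgeAt.i E)) z < degreeIn A z
  degreeIn-without {A} {z} E = sum-mono-< (λ j → ind-mono λ eq → case ∧-true {without A i j} eq of λ
      { (w , inc) → ∧-intro (without-⊆ A i j w) inc }) i
    (subst₂ (λ p q → ind p < ind q) (sym (¬true⇒false λ eq → without-≢ A i i (proj₁ (∧-true eq)) refl))
      (sym (∧-intro i∈A (dec-true (end? i z) z-end))) ≤-refl)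
    where open EdgeAt E using (i; i∈A; z-end)

  count-without : ∀ (A : Fin e → Bool) i → A i ≡ true → count (without A i) < count A
  count-without A i Ai = sum-mono-< (λ j → ind-mono (without-⊆ A i j)) i
    (subst₂ (λ p q → ind p < ind q) (sym (¬true⇒false λ eq → without-≢ A i i eq refl)) (sym Ai) ≤-refl)

  component : (Fin e → Bool) → Fin v → Fin e → Bool
  component A u i = A i ∧ does (con? a b A u (a i))

  component-⊑ : ∀ A u → component A u ⊑ A
  component-⊑ A u i = proj₁ ∘ ∧-true

  component-con : ∀ {A u i} → component A u i ≡ true → Con a b A u (a i)
  component-con {A} {u} {i} eq = does⇒ (con? a b A u (a i)) (proj₂ (∧-true {A i} eq))

  in-component : ∀ {A u x} → Con a b A u x → Con a b (component A u) u x
  in-component {A} {u} c = go c con-refl con-refl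
    where
    go : ∀ {y x} → Con a b A y x → Con a b A u y → Con a b (component A u) u y → Con a b (component A u) u x
    go ε _ c = c
    go (fwd (i , Ai , refl , refl) ◅ r) uy cy = go r (con-trans uy (con-link i Ai))
      (con-trans cy (con-link i (∧-intro Ai (dec-true (con? a b A u (a i)) uy))))
    go (bwd (i , Ai , refl , refl) ◅ r) uy cy = go r (con-trans uy (con-sym (con-link i Ai)))
      (con-trans cy (con-sym (con-link i (∧-intro Ai (dec-true (con? a b A u (a i)) (con-trans uy (con-sym (con-link i Ai))))))))

  single : Fin e → Fin e → Bool
  single i j = j == i

  module _ (D : ℕ) (degree≤D : ∀ x → degree x ≤ D) where

    Comb : (Fin e → Bool) → Fin v → List (Fin v) → ℕ → Set
    Comb A z xs n = ∃ λ ys → length ys ≡ n × Unique ys × All (_∈ xs) ys × Lane A z ys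

    stuck-short : ∀ {z : Fin v} {xs} → Unique xs → All (z ≡_) xs → 2 ≤ length xs → ⊥
    stuck-short ((ne ∷ _) ∷ _) (refl ∷ refl ∷ _) _ = ne refl
    stuck-short (_ ∷ []) (_ ∷ []) (s≤s ())

    module Split {A z} (E : EdgeAt A z) (apart : ¬ Con a b (without A (EdgeAt.i E)) z (EdgeAt.w E))
      {xs : List (Fin v)} (u : Unique xs) (all : All (Con a b A z) xs) where
      open EdgeAt E public
      A′ : Fin e → Bool
      A′ = without A i
      near? : ∀ x → Dec (Con a b A′ z x)
      near? = con? a b A′ z
      near far : List (Fin v)
      near = filter near? xs
      far  = filter (¬? ∘ near?) xs
      near-unique : Unique near
      near-unique = Unique.filter⁺ near? u
      far-unique : Unique far
      far-unique = Unique.filter⁺ (¬? ∘ near?) u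
      near-con : All (Con a b A′ z) near
      near-con = all-filter near? xs
      far-¬con : All (λ x → ¬ Con a b A′ z x) far
      far-¬con = all-filter (¬? ∘ near?) xs
      far-con : All (Con a b A′ w) far
      far-con = All.zipWith (λ { (¬c , c) → case via c of λ { (inj₁ d) → contradiction d ¬c ; (inj₂ d) → d } })
        (far-¬con , all-filter⁺ (¬? ∘ near?) all)
      near⊆ : ∀ {x} → x ∈ near → x ∈ xs
      near⊆ = proj₁ ∘ ∈-filter⁻ near?
      far⊆ : ∀ {x} → x ∈ far → x ∈ xs
      far⊆ = proj₁ ∘ ∈-filter⁻ (¬? ∘ near?)
      sizes : length near + length far ≡ length xs
      sizes = length-filter-¬ near? xs
      A′⊑ : A′ ⊑ A
      A′⊑ = without-⊆ A i
      single⊑ : single i ⊑ A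
      single⊑ j eq = subst (λ j → A j ≡ true) (sym (==⇒≡ eq)) i∈A
      single-disjoint : Disjoint (single i) A′
      single-disjoint j eq w = without-≢ A i j w (==⇒≡ eq)
      bridge : Con a b (single i) z w
      bridge = ends-con (==-refl i) z-end w-end
      near-far-disjoint : ∀ {j} → component A′ z j ≡ true → component A′ w j ≡ true → ⊥
      near-far-disjoint c d = apart (con-trans (component-con {A′} c) (con-sym (component-con {A′} d)))
      shrink : ∀ {δ n} → suc δ * teeth D n + 2 ≤ length xs → ¬ teeth D n ≤ length far → δ * teeth D n + 2 ≤ length near
      shrink {δ} {n} len small = +-cancelʳ-≤ (length far) _ _ (≤-trans (+-monoʳ-≤ (δ * teeth D n + 2) (<⇒≤ (≰⇒> small)))
        (≤-trans (≤-reflexive (trans (+-comm (δ * teeth D n + 2) (teeth D n)) (sym (+-assoc (teeth D n) (δ * teeth D n) 2))))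
          (≤-trans len (≤-reflexive (sym sizes)))))

    comb : ∀ n A z xs → Unique xs → All (Con a b A z) xs → teeth D n ≤ length xs → Comb A z xs n

    -- Walk away from z until the teeth split; since a vertex has at most D branches, some later branch
    -- keeps enough of them.
    comb-suc : ∀ n N A z xs → count A ≤ N → Unique xs → All (Con a b A z) xs → teeth D (suc n) ≤ length xs → Comb A z xs (suc n)

    -- Here x₀ is a tooth already reached from z inside B.
    comb-after : ∀ n δ A B z x₀ xs → degreeIn A z ≤ δ → Unique xs → All (Con a b A z) xs → δ * teeth D n + 2 ≤ length xs →
      Disjoint A B → Con a b B z x₀ →
      ∃ λ ys → length ys ≡ n × Unique ys × All (_∈ xs) ys × Lane (A ∪ B) z (x₀ ∷ ys)
    comb-after n δ A B z x₀ xs deg u all len dis c₀ with edge-at? A z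
    ... | inj₂ stop = ⊥-elim (stuck-short u (All.map (stop _) all) (≤-trans (m≤n+m 2 (δ * teeth D n)) len))
    ... | inj₁ E with δ
    ...   | zero = contradiction (≤-trans (degreeIn-without E) deg) λ ()
    ...   | suc δ′ with con? a b (without A (EdgeAt.i E)) z (EdgeAt.w E)
    ...     | yes zw = case comb-after n δ′ A′ B z x₀ xs (s≤s⁻¹ (≤-trans (degreeIn-without E) deg)) u
                (All.map (λ c → case via c of λ { (inj₁ d) → d ; (inj₂ d) → con-trans zw d }) all)
                (≤-trans (+-monoˡ-≤ 2 (m≤n+m _ (teeth D n))) len) (λ j p → dis j (without-⊆ A i j p)) c₀ of λ
              { (ys , l , uy , m , L) → ys , l , uy , m , lane-mono widen L }
      where
      open EdgeAt E
      A′ = without A i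
      widen : (A′ ∪ B) ⊑ (A ∪ B)
      widen = ∪-least {A = A′} {B} (λ j → ∪-left A B j ∘ without-⊆ A i j) (∪-right A B)
    ...     | no apart with teeth D n ≤? length (Split.far E apart u all)
    -- This branch keeps enough candidates. The first piece is `B`, which reaches `x₀`, together
    -- with the bridge `i` as passage into the branch.
    ...       | yes big = case comb n A′ w far far-unique far-con big of λ
                { (ys , l , uy , m , L) → ys , l , uy , All.map far⊆ m ,
                  cons {A₁ = single i ∪ B} {A′}
                    (∪-least (λ j → ∪-left A B j ∘ single⊑ j) (∪-right A B))
                    (λ j → ∪-left A B j ∘ A′⊑ j)
                    (λ j p q → case ∪-case (single i) B j p of λ { (inj₁ r) → single-disjoint j r q ; (inj₂ r) → dis j (A′⊑ j q) r })
                    (con-mono (∪-right (single i) B) c₀) (con-mono (∪-left (single i) B) bridge) L }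
      where open Split E apart u all
    ...       | no small = case comb-after n δ′ A′ B z x₀ near (s≤s⁻¹ (≤-trans (degreeIn-without E) deg)) near-unique near-con
                  (shrink {δ′} {n} len small) (λ j p → dis j (A′⊑ j p)) c₀ of λ
                { (ys , l , uy , m , L) → ys , l , uy , All.map near⊆ m ,
                  lane-mono (∪-least {A = A′} {B} (λ j → ∪-left A B j ∘ A′⊑ j) (∪-right A B)) L }
      where open Split E apart u all

    comb zero A z xs _ _ _ = [] , refl , [] , [] , []
    comb (suc n) A z xs = comb-suc n e A z xs (count≤n A)

    comb-suc n zero A z xs fuel u all len with edge-at? A z
    ... | inj₂ stop = ⊥-elim (stuck-short u (All.map (stop _) all) (≤-trans (m≤n+m 2 (D * teeth D n)) len))
    ... | inj₁ E = contradiction (≤-trans (count-without A (EdgeAt.i E) (EdgeAt.i∈A E)) fuel) λ ()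
    comb-suc n (suc N′) A z xs fuel u all len with edge-at? A z
    ... | inj₂ stop = ⊥-elim (stuck-short u (All.map (stop _) all) (≤-trans (m≤n+m 2 (D * teeth D n)) len))
    ... | inj₁ E with con? a b (without A (EdgeAt.i E)) z (EdgeAt.w E)
    -- The edge `i` lies on a cycle, so deleting it loses no candidate.
    ...     | yes zw = case comb-suc n N′ (without A i) z xs (s≤s⁻¹ (≤-trans (count-without A i i∈A) fuel)) u
                (All.map (λ c → case via c of λ { (inj₁ d) → d ; (inj₂ d) → con-trans zw d }) all) len of λ
              { (ys , l , uy , m , L) → ys , l , uy , m , lane-mono (without-⊆ A i) L }
      where open EdgeAt E
    ...     | no apart = go near refl far refl
      where
      open Split E apart u all
      fuel′ : count A′ ≤ N′
      fuel′ = s≤s⁻¹ (≤-trans (count-without A i i∈A) fuel)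
      near-distinct : ∀ {x ys} → Con a b A′ z x → All (_∈ far) ys → All (x ≢_) ys
      near-distinct c = All.map λ { y∈ refl → All.lookup far-¬con y∈ c }
      go : ∀ ns → near ≡ ns → ∀ fs → far ≡ fs → Comb A z xs (suc n)
      -- All candidates lie beyond `i`, so the root moves to `w`.
      go [] en fs _ = case comb-suc n N′ A′ w far fuel′ far-unique far-con
          (≤-trans len (≤-reflexive (trans (sym sizes) (cong (λ l → length l + length far) en)))) of λ
        { (ys , l , uy , m , L) → ys , l , uy , All.map far⊆ m , lane-prepend single⊑ A′⊑ single-disjoint bridge L }
      go (_ ∷ _) en [] ef = case comb-suc n N′ A′ z near fuel′ near-unique near-con
          (≤-trans len (≤-reflexive (trans (sym sizes) (trans (cong (λ l → length near + length l) ef) (+-identityʳ _))))) of λ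
        { (ys , l , uy , m , L) → ys , l , uy , All.map near⊆ m , lane-mono A′⊑ L }
      go (x₁ ∷ _) en (x₀ ∷ _) ef with teeth D n ≤? length far
      -- The near side gives the first tooth, the far side the rest. Passing to components makes
      -- their edge sets disjoint.
      ... | yes big = case comb n (component A′ w) w far far-unique (All.map in-component far-con) big of λ
          { (ys , l , uy , m , L) → x₁ ∷ ys , cong suc l , near-distinct x₁-con m ∷ uy , near⊆ x₁∈ ∷ All.map far⊆ m ,
            cons {A₁ = single i ∪ component A′ z} {component A′ w}
              (∪-least single⊑ (λ j → A′⊑ j ∘ component-⊑ A′ z j)) (λ j → A′⊑ j ∘ component-⊑ A′ w j)
              (λ j p q → case ∪-case (single i) (component A′ z) j p of λ
                { (inj₁ r) → single-disjoint j r (component-⊑ A′ w j q) ; (inj₂ r) → near-far-disjoint r q })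
              (con-mono (∪-right (single i) (component A′ z)) (in-component x₁-con))
              (con-mono (∪-left (single i) (component A′ z)) bridge) L }
        where
        x₁∈ : x₁ ∈ near
        x₁∈ = subst (x₁ ∈_) (sym en) (here refl)
        x₁-con : Con a b A′ z x₁
        x₁-con = All.lookup near-con x₁∈
      -- The far side gives the first tooth and uses up `i` at `z`, so at most `D - 1` edges at `z`
      -- remain for the search among the branches.
      ... | no small with positive (≤-trans (s≤s z≤n) (≤-trans (degreeIn-without E)
                (≤-trans (count-mono λ j → proj₂ ∘ ∧-true {A j}) (degree≤D z))))
      ...   | δ , eD = case comb-after n δ (component A′ z) B z x₀ near few near-unique (All.map in-component near-con)
                (shrink {δ} {n} (subst (λ d → d * teeth D n + 2 ≤ length xs) eD len) small) sep reach of λ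
          { (ys , l , uy , m , L) → x₀ ∷ ys , cong suc l ,
              All.map (λ { y∈ refl → All.lookup far-¬con x₀∈ (All.lookup near-con y∈) }) m ∷ uy ,
              far⊆ x₀∈ ∷ All.map near⊆ m ,
              lane-mono (∪-least {A = component A′ z} {B} (λ j → A′⊑ j ∘ component-⊑ A′ z j)
                (∪-least single⊑ (λ j → A′⊑ j ∘ component-⊑ A′ w j))) L }
        where
        B : Fin e → Bool
        B = single i ∪ component A′ w
        x₀∈ : x₀ ∈ far
        x₀∈ = subst (x₀ ∈_) (sym ef) (here refl)
        reach : Con a b B z x₀
        reach = con-trans (con-mono (∪-left (single i) (component A′ w)) bridge)
          (con-mono (∪-right (single i) (component A′ w)) (in-component (All.lookup far-con x₀∈)))
        sep : Disjoint (component A′ z) B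
        sep j p q = case ∪-case (single i) (component A′ w) j q of λ
          { (inj₁ r) → single-disjoint j r (component-⊑ A′ z j p) ; (inj₂ r) → near-far-disjoint p r }
        few : degreeIn (component A′ z) z ≤ δ
        few = s≤s⁻¹ (≤-trans (s≤s (count-mono λ j eq → case ∧-true {component A′ z j} eq of λ
              { (c , inc) → ∧-intro (component-⊑ A′ z j c) inc }))
            (≤-trans (degreeIn-without E) (≤-trans (count-mono λ j → proj₂ ∘ ∧-true {A j}) (≤-trans (degree≤D z) (≤-reflexive eD)))))

    -- Each colour selects from the teeth chosen by the previous ones. Sorting by vertex number
    -- provides the common order: a decreasing selection is turned round together with its comb, and
    -- earlier lanes survive as sublists.
    lanes : ∀ {C : Set} (A : C → Fin e → Bool) (High : Fin v → Set) → (∀ c {x y} → High x → High y → Con a b (A c) x y) →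
      ∀ {z} → High z → ∀ n cs xs → AllPairs _<ᶠ_ xs → All High xs → threshold D n cs ≤ length xs →
      ∃ λ ys → n ≤ length ys × AllPairs _<ᶠ_ ys × All (_∈ xs) ys × All (λ c → ∃ λ z → Lane (A c) z ys) cs
    lanes A High join {z} hz n [] xs xs↑ hx len = xs , len , xs↑ , All.tabulate (λ x∈ → x∈) , []
    lanes A High join {z} hz n (c ∷ cs) xs xs↑ hx len with
      comb (ramsey k k) (A c) z xs (increasing⇒unique xs↑) (All.map (join c hz) hx) len
      where
      k = threshold D n cs
      increasing⇒unique : ∀ {xs} → AllPairs _<ᶠ_ xs → Unique xs
      increasing⇒unique [] = []
      increasing⇒unique (p ∷ ps) = All.map (λ { lt refl → <-irrefl refl lt }) p ∷ increasing⇒unique ps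
    ... | ys , l , uy , ys∈ , L = conclude ordered
      where
      k = threshold D n cs
      ordered : ∃ λ zs → AllPairs _<ᶠ_ zs × length zs ≡ k × All (_∈ xs) zs × ∃ λ z → Lane (A c) z zs
      ordered with monotone-sublist k k ys uy (≤-reflexive (sym l))
      ... | inj₁ (zs , zs⊆ , zs↑ , lz) = zs , zs↑ , lz , All-resp-⊆ zs⊆ ys∈ , z , lane-sublist zs⊆ L
      ... | inj₂ (zs , zs⊆ , zs↓ , lz) = zs ʳ++ [] , reverse-increasing zs [] zs↓ [] (All.tabulate λ _ → []) ,
          trans (length-ʳ++ zs) (trans (+-identityʳ _) lz) , all-ʳ++ (All-resp-⊆ zs⊆ ys∈) [] , lane-reverse (lane-sublist zs⊆ L)
      conclude : (∃ λ zs → AllPairs _<ᶠ_ zs × length zs ≡ k × All (_∈ xs) zs × ∃ λ z → Lane (A c) z zs) → _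
      conclude (zs , zs↑ , lz , zs∈ , z′ , Lz) with lanes A High join hz n cs zs zs↑ (All.map (All.lookup hx) zs∈) (≤-reflexive (sym lz))
      ... | ws , lw , ws↑ , ws∈ , rest = ws , lw , ws↑ , All.map (All.lookup zs∈) ws∈ ,
          (z′ , lane-sublist (increasing-⊆ ws↑ zs↑ ws∈) Lz) ∷ rest

  -- Consecutive teeth are joined inside the union of their two pieces. Pairing the pieces off makes
  -- these unions disjoint, so one label per edge encodes all the joining paths.
  lane-pairs : ∀ {A z xs} → Lane A z xs → ∃ λ (lab : Fin e → ℕ) → ∀ l {x y} → At xs (l + l) x → At xs (suc (l + l)) y →
    Con a b (λ i → A i ∧ does (lab i ℕ.≟ l)) x y
  lane-pairs [] = (λ _ → 0) , λ l ()
  lane-pairs (cons _ _ _ _ _ []) = (λ _ → 0) , λ { l p (there ()) }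
  lane-pairs {A} (cons {A₁} {A₂} s t d c c′ (cons {A₃} {A₄} s′ t′ d′ c₃ c₄ L)) with lane-pairs L
  ... | lab , pairs = lab′ , pairs′
    where
    lab′ : Fin e → ℕ
    -- Everything outside the rest `A₄` gets label 0, including edges in no piece at all.
    lab′ i = if A₄ i then suc (lab i) else 0
    first-label : ∀ i → (A₁ ∪ A₃) i ≡ true → A i ∧ does (lab′ i ℕ.≟ 0) ≡ true
    first-label i eq with A₄ i in q
    ... | false = ∧-intro (∪-least s (λ j → t j ∘ s′ j) i eq) refl
    ... | true = case ∪-case A₁ A₃ i eq of λ { (inj₁ r) → ⊥-elim (d i r (t′ i q)) ; (inj₂ r) → ⊥-elim (d′ i r q) }
    later-label : ∀ l i → A₄ i ∧ does (lab i ℕ.≟ l) ≡ true → A i ∧ does (lab′ i ℕ.≟ suc l) ≡ true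
    later-label l i eq with ∧-true {A₄ i} eq
    ... | q , r rewrite q = ∧-intro (t i (t′ i q)) (dec-true (suc (lab i) ℕ.≟ suc l) (cong suc (does⇒ (lab i ℕ.≟ l) r)))
    pairs′ : ∀ l {x y} → At _ (l + l) x → At _ (suc (l + l)) y → Con a b (λ i → A i ∧ does (lab′ i ℕ.≟ l)) x y
    pairs′ zero here (there here) = con-mono first-label (con-trans
      (con-mono (∪-left A₁ A₃) (con-trans (con-sym c) c′)) (con-mono (∪-right A₁ A₃) c₃))
    pairs′ (suc l) (there p) (there q) rewrite +-suc l l with p | q
    ... | there p′ | there q′ = con-mono (later-label l) (pairs l p′ q′)

-- Minors of the line graph

module Models (G : Graph) {v : ℕ} (a b : Fin (n G) → Fin v)
  (adj : ∀ {i j} → i ≢ j → Multigraph.Share a b i j → Adj G i j) where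

  open Multigraph a b

  module _ (K : Graph) (raw : Fin (n G) → Maybe (Fin (n K))) (x y : Fin (n K) → Fin v)
    (x≢y : ∀ j → x j ≢ y j) (xy : ∀ j → Con a b (λ i → isColor (raw i) j) (x j) (y j))
    (touch : ∀ i j → Adj K i j → ∃ λ w →
      Con a b (λ u → isColor (raw u) i) (x i) w × Con a b (λ u → isColor (raw u) j) (x j) w) where

    B : Fin (n K) → Fin (n G) → Bool
    B j i = isColor (raw i) j

    reached? : ∀ j i → Dec (Con a b (B j) (x j) (a i))
    reached? j i = con? a b (B j) (x j) (a i)

    -- Edges assigned to j but outside the component of x j are discarded.
    β : Fin (n G) → Maybe (Fin (n K))
    β i = maybe (λ j → if does (reached? j i) then just j else nothing) nothing (raw i)

    β-intro : ∀ {i j} → raw i ≡ just j → Con a b (B j) (x j) (a i) → β i ≡ just j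
    β-intro {i} {j} r c rewrite r | dec-true (reached? j i) c = refl

    β-elim : ∀ {i j} → β i ≡ just j → raw i ≡ just j × Con a b (B j) (x j) (a i)
    β-elim {i} {j} eq with raw i in r
    ... | just j′ with reached? j′ i | eq
    ...   | yes c | refl = refl , c

    at-end : ∀ {i j w} → B j i ≡ true → End i w → Con a b (B j) (x j) w → β i ≡ just j
    at-end {i} Bi e c = β-intro (isColor⇒ Bi) (con-trans c (ends-con Bi e (inj₁ refl)))

    edge-at : ∀ {j w w′} → Con a b (B j) (x j) w → Con a b (B j) w w′ → w ≢ w′ → ∃ λ i → β i ≡ just j × End i w
    edge-at c ε ne = contradiction refl ne
    edge-at c (fwd (i , Bi , e , _) ◅ _) _ = i , at-end Bi (inj₁ e) c , inj₁ e
    edge-at c (bwd (i , Bi , _ , e) ◅ _) _ = i , at-end Bi (inj₂ e) c , inj₂ e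

    -- A vertex at the start of a nontrivial walk is an end of its first edge; when `w` is `x j`
    -- itself, `x≢y` supplies such a walk.
    edge-touching : ∀ j {w} → Con a b (B j) (x j) w → ∃ λ i → β i ≡ just j × End i w
    edge-touching j {w} c with w ≟ x j
    ... | yes refl = edge-at c (xy j) (x≢y j)
    ... | no ne    = edge-at c (con-sym c) ne

    hop : ∀ {j i i′ l} → β i ≡ just j → Share i i′ → Reach G (λ z → β z ≡ just j) i′ l → Reach G (λ z → β z ≡ just j) i l
    hop {i = i} {i′} βi s r with i ≟ i′
    ... | yes refl = r
    ... | no ne = step βi (adj ne s) r

    -- Consecutive edges of a walk share a vertex, hence are equal or adjacent in `G`.
    walk : ∀ {j w w′ i i′} → Con a b (B j) w w′ → Con a b (B j) (x j) w → β i ≡ just j → End i w →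
      β i′ ≡ just j → End i′ w′ → Reach G (λ z → β z ≡ just j) i i′
    walk ε c βi e βi′ e′ = hop βi (_ , e , e′) (here βi′)
    walk (fwd (l , Bl , p , q) ◅ r) c βi e βi′ e′ = hop βi (_ , e , inj₁ p)
      (walk r (con-trans c (ends-con Bl (inj₁ p) (inj₂ q))) (at-end Bl (inj₁ p) c) (inj₂ q) βi′ e′)
    walk (bwd (l , Bl , p , q) ◅ r) c βi e βi′ e′ = hop βi (_ , e , inj₂ q)
      (walk r (con-trans c (ends-con Bl (inj₂ q) (inj₁ p))) (at-end Bl (inj₂ q) c) (inj₁ p) βi′ e′)

    touching-minor : K ≼ G
    touching-minor = β , nonempty , connected , adjacent
      where
      nonempty : ∀ j → ∃ λ i → β i ≡ just j
      nonempty j with edge-touching j con-refl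
      ... | i , βi , _ = i , βi
      connected : ∀ j i i′ → β i ≡ just j → β i′ ≡ just j → Reach G (λ z → β z ≡ just j) i i′
      connected j i i′ βi βi′ with β-elim {i} βi | β-elim {i′} βi′
      ... | _ , c | _ , c′ = walk (con-trans (con-sym c) c′) c βi (inj₁ refl) βi′ (inj₁ refl)
      adjacent : ∀ i j → Adj K i j → ∃ λ u → ∃ λ w → β u ≡ just i × β w ≡ just j × Adj G u w
      adjacent i j ij with touch i j ij
      ... | w , ci , cj with edge-touching i ci | edge-touching j cj
      ...   | u , βu , eu | u′ , βu′ , eu′ = u , u′ , βu , βu′ , adj distinct (w , eu , eu′)
        where
        distinct : u ≢ u′
        distinct refl = adj-irr K (subst (Adj K i) (just-injective (trans (sym βu′) βu)) ij)

  length-filter-tabulate : ∀ {A : Set} {P : A → Set} (P? : Decidable P) {k} (f : Fin k → A) →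
    length (filter P? (List.tabulate f)) ≡ count (λ i → does (P? (f i)))
  length-filter-tabulate P? {zero} f = refl
  length-filter-tabulate P? {suc k} f with P? (f zero)
  ... | yes _ = cong suc (length-filter-tabulate P? (f ∘ suc))
  ... | no _ = length-filter-tabulate P? (f ∘ suc)

  -- The edges at `z` pairwise share `z`, so distinct ones serve as branch sets for all vertices of
  -- `K`, whatever its edges are.
  star-minor : (∀ i → a i ≢ b i) → (K : Graph) → ∀ z → n K ≤ degree z → K ≼ G
  star-minor loopless K z big = touching-minor K raw (λ _ → z) other
    (λ j → other≢ j) (λ j → ends-con (⇒isColor (raw-ray j)) (ray-end j) (other-end j)) (λ i j _ → z , con-refl , con-refl)
    where
    rays : List (Fin (n G))
    rays = filter (λ i → end? i z) (allFin (n G))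
    ray : Fin (n K) → Fin (n G)
    ray j = lookup rays (inject≤ j (≤-trans big (≤-reflexive (sym (length-filter-tabulate (λ i → end? i z) (λ i → i))))))
    ray-injective : ∀ {i j} → ray i ≡ ray j → i ≡ j
    ray-injective eq = inject≤-injective _ _ _ _ (lookup-injective (Unique.filter⁺ _ (Unique.allFin⁺ _)) _ _ eq)
    ray-end : ∀ j → End (ray j) z
    ray-end j = proj₂ (∈-filter⁻ (λ i → end? i z) {xs = allFin (n G)} (∈-lookup {xs = rays} _))
    opposite : ∀ i → End i z → ∃ λ w → End i w × z ≢ w
    opposite i (inj₁ refl) = b i , inj₂ refl , loopless i
    opposite i (inj₂ refl) = a i , inj₁ refl , loopless i ∘ sym
    other : Fin (n K) → Fin v
    other j = proj₁ (opposite (ray j) (ray-end j))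
    other-end : ∀ j → End (ray j) (other j)
    other-end j = proj₁ (proj₂ (opposite (ray j) (ray-end j)))
    other≢ : ∀ j → z ≢ other j
    other≢ j = proj₂ (proj₂ (opposite (ray j) (ray-end j)))
    raw : Fin (n G) → Maybe (Fin (n K))
    raw i with any? (λ j → ray j ≟ i)
    ... | yes (j , _) = just j
    ... | no _ = nothing
    raw-ray : ∀ j → raw (ray j) ≡ just j
    raw-ray j with any? (λ j′ → ray j′ ≟ ray j)
    ... | yes (j′ , eq) = cong just (ray-injective eq)
    ... | no none = contradiction (j , refl) none

-- Adjacency of the groups along the cycle

next-cases : ∀ {r} (i : Fin r) → toℕ (next i) ≡ suc (toℕ i) ⊎ (toℕ (next i) ≡ 0 × suc (toℕ i) ≡ r)
next-cases {suc r} i with suc (toℕ i) <? suc r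
... | yes lt = inj₁ (trans (toℕ-fromℕ< (m%n<n (suc (toℕ i)) (suc r))) (m<n⇒m%n≡m lt))
... | no ¬lt = inj₂ (trans (toℕ-fromℕ< (m%n<n (suc (toℕ i)) (suc r)))
    (trans (cong (_% suc r) last) (n%n≡0 (suc r))) , last)
  where
  last : suc (toℕ i) ≡ suc r
  last = ≤-antisym (toℕ<n i) (≮⇒≥ ¬lt)

-- Coarser than adjacency on the cycle: group 0 is close to every group, as its branch sets will
-- meet all the vertices of the sequence. This absorbs the step from the last group back to 0.
data Close : ℕ → ℕ → Set where
  zeroˡ : ∀ {g} → Close 0 g
  zeroʳ : ∀ {g} → Close g 0
  equal : ∀ {g} → Close g g
  succˡ : ∀ {g} → Close g (suc g)
  succʳ : ∀ {g} → Close (suc g) g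

module _ {t r : ℕ} where

  group : Fin (r * t) → Fin r
  group p = proj₁ (remQuot t p)

  adjacent⇒close : ∀ i j → Adj (LineGraph (C t r)) i j → Close (toℕ (group i)) (toℕ (group j))
  adjacent⇒close i j (_ , share) = go share
    where
    forward : ∀ (g h : Fin r) → toℕ g ≡ toℕ (next h) → Close (toℕ h) (toℕ g)
    forward g h eq with next-cases h
    ... | inj₁ s rewrite trans eq s = succˡ
    ... | inj₂ (s , _) rewrite trans eq s = zeroʳ
    flip : ∀ {g h} → Close g h → Close h g
    flip zeroˡ = zeroʳ
    flip zeroʳ = zeroˡ
    flip equal = equal
    flip succˡ = succʳ
    flip succʳ = succˡ
    both : ∀ (g h : Fin r) → next g ≡ next h → Close (toℕ g) (toℕ h)
    both g h eq with next-cases g | next-cases h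
    ... | inj₁ p | inj₁ q rewrite ℕ.suc-injective (trans (sym p) (trans (cong toℕ eq) q)) = equal
    ... | inj₂ (_ , p) | inj₂ (_ , q) rewrite ℕ.suc-injective (trans p (sym q)) = equal
    ... | inj₁ p | inj₂ (q , _) = contradiction (trans (sym p) (trans (cong toℕ eq) q)) λ ()
    ... | inj₂ (p , _) | inj₁ q = contradiction (trans (sym p) (trans (cong toℕ eq) q)) λ ()
    go : ShareEnd (C t r) i j → Close (toℕ (group i)) (toℕ (group j))
    go (inj₁ eq) rewrite eq = equal
    go (inj₂ (inj₁ eq)) = flip (forward (group i) (group j) (cong toℕ eq))
    go (inj₂ (inj₂ (inj₁ eq))) = forward (group j) (group i) (cong toℕ (sym eq))
    go (inj₂ (inj₂ (inj₂ eq))) = both (group i) (group j) eq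

-- Span r g k holds when every branch set of the g-th group meets the k-th vertex of the common sequence.
Span : ℕ → ℕ → ℕ → Set
Span r zero    k = k ≤ r
Span r (suc g) k = k ≡ g ⊎ k ≡ suc g

close-spans : ∀ {r g h} → g < r → h < r → Close g h → ∃ λ k → Span r g k × Span r h k
close-spans {h = zero}  g<r h<r zeroˡ = 0 , z≤n , z≤n
close-spans {h = suc h} g<r h<r zeroˡ = h , <⇒≤ (<-trans (n<1+n h) h<r) , inj₁ refl
close-spans {g = zero}  g<r h<r zeroʳ = 0 , z≤n , z≤n
close-spans {g = suc g} g<r h<r zeroʳ = g , inj₁ refl , <⇒≤ (<-trans (n<1+n g) g<r)
close-spans {g = zero}  g<r h<r equal = 0 , z≤n , z≤n
close-spans {g = suc g} g<r h<r equal = g , inj₁ refl , inj₁ refl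
close-spans {g = zero}  g<r h<r succˡ = 0 , z≤n , inj₁ refl
close-spans {g = suc g} g<r h<r succˡ = suc g , inj₂ refl , inj₁ refl
close-spans {h = zero}  g<r h<r succʳ = 0 , inj₁ refl , z≤n
close-spans {h = suc h} g<r h<r succʳ = suc h , inj₁ refl , inj₂ refl

nth : ∀ {A : Set} → A → List A → ℕ → A
nth d []       k       = d
nth d (x ∷ xs) zero    = x
nth d (x ∷ xs) (suc k) = nth d xs k

nth-at : ∀ {A : Set} (d : A) xs k → k < length xs → At xs k (nth d xs k)
nth-at d (x ∷ xs) zero    _         = here
nth-at d (x ∷ xs) (suc k) (s≤s k<) = there (nth-at d xs k k<)

nth-all : ∀ {A : Set} {P : A → Set} {d xs} → P d → All P xs → ∀ k → P (nth d xs k)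
nth-all pd []       k       = pd
nth-all pd (p ∷ ps) zero    = p
nth-all pd (p ∷ ps) (suc k) = nth-all pd ps k

nth-increasing : ∀ {v} {d : Fin v} {xs} → AllPairs _<ᶠ_ xs → ∀ k → suc k < length xs → nth d xs k ≢ nth d xs (suc k)
nth-increasing ((lt ∷ _) ∷ _) zero _ eq = <-irrefl (cong toℕ eq) lt
nth-increasing ([] ∷ []) zero (s≤s ())
nth-increasing (_ ∷ xs↑) (suc k) (s≤s k<) = nth-increasing xs↑ k k<

data Parity : ℕ → Set where
  odd  : ∀ l → Parity (suc (l + l))
  even : ∀ l → Parity (suc (suc (l + l)))

parity : ∀ g → Parity (suc g)
parity zero = odd 0
parity (suc g) with parity g
... | odd l = even l
... | even l = subst Parity (cong {B = ℕ} (λ k → suc (suc k)) (+-suc l l)) (odd (suc l))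

-- Branch sets from the lanes

module BoundedDegree (G : Graph) {v : ℕ} (a b : Fin (n G) → Fin v)
  (adj : ∀ {i j} → i ≢ j → Multigraph.Share a b i j → Adj G i j) (t r : ℕ) (1≤r : 1 ≤ r)
  (Color : Fin (n G) → Fin (3 * t)) (High : Fin v → Set)
  (join : ∀ κ {x y} → High x → High y → Con a b (λ i → Color i == κ) x y)
  (ws : List (Fin v)) (r<ws : suc r ≤ length ws) (ws↑ : AllPairs _<ᶠ_ ws) (ws-high : All High ws)
  {d : Fin v} (d-high : High d)
  (lanes : ∀ κ → ∃ λ z → Combs.Lane a b (λ i → Color i == κ) z ws) where

  open Combs a b hiding (lanes)

  -- The default is a high vertex, so `w k` is high for every `k`, even beyond the list.
  w : ℕ → Fin v
  w = nth d ws

  w-at : ∀ k → k ≤ r → At ws k (w k)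
  w-at k k≤r = nth-at d ws k (≤-trans (s≤s k≤r) r<ws)

  tail-lane : ∀ {A z xs} → Lane A z xs → Lane A z (List.drop 1 xs)
  tail-lane {xs = []}     l = l
  tail-lane {xs = x ∷ xs} l = lane-sublist (x ∷ʳ ⊆-refl) l

  tail-at : ∀ {A : Set} {xs : List A} {k x} → At xs (suc k) x → At (List.drop 1 xs) k x
  tail-at (there p) = p

  -- The t colours of class 0 form group 0; classes 1 and 2 supply the groups of odd and even index,
  -- where group g > 0 joins w (g - 1) to w g.
  odd-label even-label : Fin (3 * t) → Fin (n G) → ℕ
  odd-label  κ = proj₁ (lane-pairs (proj₂ (lanes κ)))
  even-label κ = proj₁ (lane-pairs (tail-lane (proj₂ (lanes κ))))

  groupOf : Fin 3 → ℕ → ℕ → ℕ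
  groupOf zero             l l′ = 0
  groupOf (suc zero)       l l′ = suc (l + l)
  groupOf (suc (suc zero)) l l′ = suc (suc (l′ + l′))

  -- A lane may carry more labels than there are groups; edges with group index at least `r` stay
  -- outside the model.
  place : ℕ → Fin t → Maybe (Fin (r * t))
  place g j with g <? r
  ... | yes g<r = just (combine (fromℕ< g<r) j)
  ... | no _    = nothing

  place-toℕ : ∀ (g : Fin r) j → place (toℕ g) j ≡ just (combine g j)
  place-toℕ g j with toℕ g <? r
  ... | yes lt = cong (λ g → just (combine g j)) (fromℕ<-toℕ g lt)
  ... | no ¬lt = contradiction (toℕ<n g) ¬lt

  color : Fin 3 → Fin t → Fin (3 * t)
  color = combine

  rawOf : Fin 3 × Fin t → ℕ → ℕ → Maybe (Fin (r * t))
  rawOf (κ , j) l l′ = place (groupOf κ l l′) j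

  raw : Fin (n G) → Maybe (Fin (r * t))
  raw i = rawOf (remQuot t (Color i)) (odd-label (Color i) i) (even-label (Color i) i)

  B : Fin (r * t) → Fin (n G) → Bool
  B p i = isColor (raw i) p

  raw-at : ∀ (p : Fin (r * t)) κ i → (Color i == color κ (proj₂ (remQuot {r} t p))) ≡ true →
    groupOf κ (odd-label (Color i) i) (even-label (Color i) i) ≡ toℕ (proj₁ (remQuot {r} t p)) → B p i ≡ true
  raw-at p κ i c g = ⇒isColor (trans
    (cong (λ κj → rawOf κj (odd-label (Color i) i) (even-label (Color i) i))
      (trans (cong (remQuot t) (==⇒≡ c)) (remQuot-combine κ j)))
    (trans (cong (λ g → place g j) g) (trans (place-toℕ (proj₁ (remQuot {r} t p)) j) (cong just (combine-remQuot {r} t p)))))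
    where
    j : Fin t
    j = proj₂ (remQuot {r} t p)

  lab-at : ∀ {κ κ′ : Fin (3 * t)} {i : Fin (n G)} (lab : Fin (3 * t) → Fin (n G) → ℕ) {l} → (κ == κ′) ≡ true → does (lab κ′ i ℕ.≟ l) ≡ true → lab κ i ≡ l
  lab-at {κ} {κ′} {i} lab {l} c e = trans (cong (λ κ → lab κ i) (==⇒≡ {i = κ} {κ′} c)) (does⇒ (lab κ′ i ℕ.≟ l) e)

  spanned : ∀ p k → Span r (toℕ (group {t} {r} p)) k → Con a b (B p) (w (pred (toℕ (group {t} {r} p)))) (w k)
  spanned p k = go (toℕ (group {t} {r} p)) refl
    where
    j : Fin t
    j = proj₂ (remQuot {r} t p)
    stretch : ∀ g → Parity g → g ≡ toℕ (group {t} {r} p) → g < r → Con a b (B p) (w (pred g)) (w g)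
    stretch .(suc (l + l)) (odd l) eq g<r = con-mono
      (λ i q → case ∧-true {Color i == color (suc zero) j} q of λ { (c , lb) → raw-at p (suc zero) i c
        (trans (cong (λ l → suc (l + l)) (lab-at odd-label c lb)) eq) })
      (proj₂ (lane-pairs (proj₂ (lanes (color (suc zero) j)))) l
        (w-at (l + l) (<⇒≤ (<-trans (n<1+n _) g<r))) (w-at (suc (l + l)) (<⇒≤ g<r)))
    stretch .(suc (suc (l + l))) (even l) eq g<r = con-mono
      (λ i q → case ∧-true {Color i == color (suc (suc zero)) j} q of λ { (c , lb) → raw-at p (suc (suc zero)) i c
        (trans (cong (λ l → suc (suc (l + l))) (lab-at even-label c lb)) eq) })
      (proj₂ (lane-pairs (tail-lane (proj₂ (lanes (color (suc (suc zero)) j))))) l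
        (tail-at (w-at (suc (l + l)) (<⇒≤ (<-trans (n<1+n _) g<r)))) (tail-at (w-at (suc (suc (l + l))) (<⇒≤ g<r))))
    go : ∀ g → g ≡ toℕ (group {t} {r} p) → Span r g k → Con a b (B p) (w (pred g)) (w k)
    go zero eq _ = con-mono (λ i c → raw-at p zero i c eq)
      (join (color zero j) (nth-all d-high ws-high 0) (nth-all d-high ws-high k))
    go (suc g) eq (inj₁ refl) = con-refl
    go (suc g) eq (inj₂ refl) = stretch (suc g) (parity g) eq (subst (_< r) (sym eq) (toℕ<n (group {t} {r} p)))

  -- Every branch set must contain two vertices known to be distinct. With `pred`, group 0 uses
  -- `w 0` and `w 1`, which are in range because `1 ≤ r`.
  low : Fin (r * t) → ℕ
  low p = pred (toℕ (group {t} {r} p))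

  low<r : ∀ p → suc (low p) ≤ r
  low<r p with toℕ (group {t} {r} p) | toℕ<n (group {t} {r} p)
  ... | zero  | _  = 1≤r
  ... | suc g | lt = <⇒≤ lt

  ends-differ : ∀ p → w (low p) ≢ w (suc (low p))
  ends-differ p = nth-increasing ws↑ (low p) (≤-trans (s≤s (low<r p)) r<ws)

  ends-joined : ∀ p → Con a b (B p) (w (low p)) (w (suc (low p)))
  ends-joined p = spanned p (suc (low p)) (span (toℕ (group {t} {r} p)))
    where
    span : ∀ g → Span r g (suc (pred g))
    span zero    = 1≤r
    span (suc g) = inj₂ refl

  touch : ∀ p q → Adj (LineGraph (C t r)) p q → ∃ λ x → Con a b (B p) (w (low p)) x × Con a b (B q) (w (low q)) x
  touch p q pq with close-spans (toℕ<n (group {t} {r} p)) (toℕ<n (group {t} {r} q)) (adjacent⇒close {t} {r} p q pq)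
  ... | k , sp , sq = w k , spanned p k sp , spanned q k sq

  minor : LineGraph (C t r) ≼ G
  minor = Models.touching-minor G a b adj (LineGraph (C t r)) raw (w ∘ low) (λ p → w (suc (low p))) ends-differ ends-joined touch

-- Assembly of the theorem

bounded-degree-minor : ∀ t r → 1 ≤ r → (G : Graph) {v : ℕ} (a b : Fin (n G) → Fin v) →
  (∀ {i j} → i ≢ j → Multigraph.Share a b i j → Adj G i j) →
  (D : ℕ) (degree≤D : ∀ z → Multigraph.degree a b z ≤ D) (kk : ℕ) (Color : Fin (n G) → Fin (3 * t)) →
  (∀ κ {x y} → kk ≤ Multigraph.degree a b x → kk ≤ Multigraph.degree a b y → Con a b (λ i → Color i == κ) x y) →
  ∀ {d} → kk ≤ Multigraph.degree a b d →
  threshold D (suc r) (allFin (3 * t)) ≤ length (filter (λ x → kk ≤? Multigraph.degree a b x) (allFin v)) →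
  LineGraph (C t r) ≼ G
bounded-degree-minor t r 1≤r G {v} a b adj D degree≤D kk Color join {d} d-high enough
  with Combs.lanes a b D degree≤D (λ κ i → Color i == κ) (λ x → kk ≤ Multigraph.degree a b x) join d-high (suc r) (allFin (3 * t))
    (filter high? (allFin v)) (AllPairs.filter⁺ high? (AllPairs.tabulate⁺-< λ lt → lt)) (all-filter high? (allFin v)) enough
  where
  high? = λ x → kk ≤? Multigraph.degree a b x
... | ws , r<ws , ws↑ , ws∈ , lanes = BoundedDegree.minor G a b adj t r 1≤r Color (λ x → kk ≤ Multigraph.degree a b x) join
  ws r<ws ws↑ (All.map (All.lookup (all-filter (λ x → kk ≤? Multigraph.degree a b x) (allFin v))) ws∈) d-high
  (λ κ → All.lookup lanes (∈-allFin κ))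

large-line-graph-minor : ∀ t r → 1 ≤ r → ∀ k kk → kk ≤ k → kk + kk ≤ k + 3 → 2 ≤ kk → 3 * (3 * suc t) ≤ kk →
  (G : Graph) {v : ℕ} (a b : Fin (n G) → Fin v) → (∀ i → a i ≢ b i) →
  (∀ {i j} → Adj G i j → Multigraph.Share a b i j) →
  (∀ {i j} → i ≢ j → Multigraph.Share a b i j → Adj G i j) → KConnected k G →
  suc (threshold (r * suc t) (suc r) (allFin (3 * suc t)) * (r * suc t)) ≤ n G → LineGraph (C (suc t) r) ≼ G
large-line-graph-minor t r 1≤r k kk kk≤k 2kk≤ 2≤kk 9t≤kk G {v} a b loopless share adj kc large
  with any? (λ z → r * suc t ≤? Multigraph.degree a b z)
... | yes (z , big) = Models.star-minor G a b adj loopless (LineGraph (C (suc t) r)) z big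
... | no ¬big = bounded-degree-minor (suc t) r 1≤r G a b adj D degree≤D kk (proj₁ coloring) (proj₂ coloring)
    (TreePacking.vtx-high a b kk high-end cut-bound (TreePacking.some-high a b kk high-end cut-bound edge))
    -- The vertices of `G` are edges of the multigraph, so too few high vertices of degree at most
    -- `D` would contradict `large`.
    (≮⇒≥ λ few → <⇒≱ large (≤-trans (TreePacking.edges≤ a b kk high-end cut-bound D degree≤D) (*-monoˡ-≤ D (<⇒≤ few))))
  where
  D : ℕ
  D = r * suc t
  degree≤D : ∀ z → Multigraph.degree a b z ≤ D
  degree≤D z = <⇒≤ (≰⇒> λ big → ¬big (z , big))
  edge : Fin (n G)
  edge = fromℕ< (≤-trans (s≤s z≤n) large)
  high-end = Cuts.high-end G a b share k kc kk 2kk≤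
  cut-bound : ∀ (X : Fin v → Bool) {u w} → kk ≤ Multigraph.degree a b u → kk ≤ Multigraph.degree a b w →
    X u ≡ true → X w ≡ false → kk ≤ count (λ i → X (a i) xor X (b i))
  cut-bound = Cuts.cut-bound G a b share k kc kk kk≤k
  coloring = TreePacking.edge-coloring a b kk high-end cut-bound _ 2≤kk 9t≤kk edge

theorem1p6 : ∀ (t r : ℕ) → 1 ≤ t → 1 ≤ r →
    ∃ λ (f : ℕ) → ∀ (G : Graph) →
    KConnected (30 * t ∸ 15) G → IsLineGraph G → f ≤ n G →
    LineGraph (C t r) ≼ G
theorem1p6 (suc t) r _ 1≤r = suc (threshold (r * suc t) (suc r) (allFin (3 * suc t)) * (r * suc t)) ,
  -- The degree threshold 9 + 15 t is half of k + 3, where k = 30 (t + 1) − 15 = 15 + 30 t.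
  λ { G kc (H , loopless , φ , iso) large →
    large-line-graph-minor t r 1≤r (15 + 30 * t) (9 + 15 * t)
      (+-mono-≤ {9} {15} (m≤m+n 9 6) (*-monoˡ-≤ t (m≤m+n 15 15))) (≤-reflexive (double t)) (s≤s (s≤s z≤n))
      -- Three classes of `t + 1` colours, times three for the size of the hyperedges: `9 (t + 1)`
      -- must not exceed `9 + 15 t`.
      (≤-trans (≤-reflexive (nine t)) (+-monoʳ-≤ 9 (*-monoˡ-≤ t (m≤m+n 9 6))))
      G _ _ (λ i → loopless (Bijection.to φ i)) (λ {i} {j} → share G H φ iso i j) (λ {i} {j} → adj G H φ iso i j)
      (subst (λ k → KConnected k G) (cong (_∸ 15) (*-suc 30 t)) kc) large }
  where
  double : ∀ t → 9 + 15 * t + (9 + 15 * t) ≡ 15 + 30 * t + 3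
  double = solve-∀
  nine : ∀ t → 3 * (3 * suc t) ≡ 9 + 9 * t
  nine = solve-∀
  module _ (G : Graph) (H : RawMultigraph) (φ : Fin (n G) ⤖ Fin (E H))
    (iso : ∀ u v → (Adj G u v → Adj (LineGraph H) (Bijection.to φ u) (Bijection.to φ v)) ×
                   (Adj (LineGraph H) (Bijection.to φ u) (Bijection.to φ v) → Adj G u v)) where
    open Multigraph (λ i → proj₁ (ends H (Bijection.to φ i))) (λ i → proj₂ (ends H (Bijection.to φ i))) using (Share)
    share : ∀ i j → Adj G i j → Share i j
    share i j ij with proj₂ (proj₁ (iso i j) ij)
    ... | inj₁ p = _ , inj₁ refl , inj₁ (sym p)
    ... | inj₂ (inj₁ p) = _ , inj₁ refl , inj₂ (sym p)
    ... | inj₂ (inj₂ (inj₁ p)) = _ , inj₂ refl , inj₁ (sym p)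
    ... | inj₂ (inj₂ (inj₂ p)) = _ , inj₂ refl , inj₂ (sym p)
    adj : ∀ i j → i ≢ j → Share i j → Adj G i j
    adj i j ne s = proj₂ (iso i j) ((λ eq → ne (Bijection.injective φ eq)) , ends-share s)
      where
      ends-share : Share i j → ShareEnd H (Bijection.to φ i) (Bijection.to φ j)
      ends-share (x , inj₁ p , inj₁ q) = inj₁ (trans p (sym q))
      ends-share (x , inj₁ p , inj₂ q) = inj₂ (inj₁ (trans p (sym q)))
      ends-share (x , inj₂ p , inj₁ q) = inj₂ (inj₂ (inj₁ (trans p (sym q))))
      ends-share (x , inj₂ p , inj₂ q) = inj₂ (inj₂ (inj₂ (trans p (sym q))))
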